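{- Let $n \in \mathbb{N}$ and let $s$ be an integer with $-n \le s \le n+1$. Then the Töplitz determinant $\mathcal{N}^{(s)}_{n}(t,q) = \det(N_{s+j-k-1}(t,q))_{j,k=0,\ldots,n-1}$ of the $q$-Narayana polynomials is given by $$\mathcal{N}^{(s)}_{n}(t,q) = \varphi^{(s)}_{n}(t,q) \prod_{k=1}^{s-1} (t+q^{2k-1})^{s-k} \qquad \text{for } 1 \le s \le n+1,$$ $$\mathcal{N}^{(s)}_{n}(t,q) = \varphi^{(s)}_{n}(t,q) \prod_{k=1}^{|s|} (t+q^{ -2k+1})^{|s|-k+1} \qquad \text{for } -n \le s \le 0,$$ where $$\varphi^{(s)}_{n}(t,q) = (-1)^{\frac{n(n-1)}{2}}\, t^{ -\frac{(n-s)(n-s+1)}{2}}\, q^{\frac{n(n-1)(2s-1)}{2}}.$$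
   Context: $\mathbb{N}=\{0,1,2,\ldots\}$; empty products and $0\times 0$ determinants equal $1$. A Schröder path is a lattice path in $\mathbb{Z}^2$ consisting of up steps $(1,1)$, down steps $(1,-1)$ and level steps $(2,0)$, never going beneath the $x$-axis (the path without steps is allowed). For $k\in\mathbb{N}$, $S_k$ is the set of Schröder paths from $(0,0)$ to $(2k,0)$. For a Schröder path $P$, $\mathrm{level}(P)$ is the number of level steps in $P$ and $\mathrm{area}(P)$ is the area of the region between $P$ and the $x$-axis. The $q$-Narayana polynomials are $$N_k(t,q)=\sum_{P\in S_k} t^{\mathrm{level}(P)} q^{\mathrm{area}(P)},\qquad k\in\mathbb{N},$$ with $t,q$ indeterminates (or nonzero constants). For negative integers $k$ one defines $$N_k(t,q)=t^{ -2|k|+1} N_{|k|-1}(t,q^{ -1}),\qquad k<0.$$ -}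

module Defs where

open import Algebra.Bundles using (CommutativeRing; Semiring)
open import Algebra.Definitions using (Invertible)
import Algebra.Definitions.RawSemiring as RawSemiringDefs
open import Data.Empty using (⊥)
open import Data.Fin using (Fin; zero; suc; toℕ; punchIn)
open import Data.Integer as ℤ using (ℤ; +_; -[1+_]; _/ℕ_)
open import Data.List using (List; []; _∷_; _++_; map; foldr)
open import Data.List.Membership.Propositional using (_∈_)
open import Data.List.Membership.Propositional.Properties using (∈-map⁺; ∈-map⁻; ∈-++⁺ˡ; ∈-++⁺ʳ; ∈-++⁻)
open import Data.List.Relation.Unary.All using ([])
open import Data.List.Relation.Unary.AllPairs using ([]; _∷_)
open import Data.List.Relation.Unary.Any using (here)
open import Data.List.Relation.Unary.Unique.Propositional using (Unique)
open import Data.List.Relation.Unary.Unique.Propositional.Properties using (map⁺; ++⁺)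
open import Data.Nat as ℕ using (ℕ; zero; suc; _/_)
open import Data.Nat.Divisibility using (_∣_; _∣0; ∣-refl; ∣m∣n⇒∣m+n; ∣m+n∣m⇒∣n; m∣m*n)
open import Data.Nat.DivMod using (m/n*n≡m)
open import Data.Nat.Properties using (+-identityʳ)
open import Data.Nat.Solver using (module +-*-Solver)
open import Data.Product using (∃; _×_; _,_; proj₁)
open import Data.Sum using (inj₁; inj₂)
open import Relation.Binary.PropositionalEquality using (_≡_; refl; sym; subst)

-- Path n h: the lattice paths with steps (1,1), (1,-1), (2,0) from a point
-- (x , h) to (x + n , 0). All heights are natural numbers, so such a path
-- never goes beneath the x-axis.
data Path : ℕ → ℕ → Set where
  done  : Path 0 0
  up    : ∀ {n h} → Path n (suc h) → Path (suc n) h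
  down  : ∀ {n h} → Path n h → Path (suc n) (suc h)
  level : ∀ {n h} → Path n h → Path (suc (suc n)) h

S : ℕ → Set
S k = Path (2 ℕ.* k) 0

levels : ∀ {n h} → Path n h → ℕ
levels done      = 0
levels (up p)    = levels p
levels (down p)  = levels p
levels (level p) = suc (levels p)

-- Each step contributes a trapezoid (base 1, parallel sides h and h + 1) or a
-- rectangle (base 2, height h); doubling keeps the sum in ℕ.
twiceArea : ∀ {n h} → Path n h → ℕ
twiceArea done              = 0
twiceArea (up {h = h} p)    = (h ℕ.+ suc h) ℕ.+ twiceArea p
twiceArea (down {h = h} p)  = (suc h ℕ.+ h) ℕ.+ twiceArea p
twiceArea (level {h = h} p) = 4 ℕ.* h ℕ.+ twiceArea p

-- The division is exact, see area*2≡twiceArea.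
area : ∀ {n} → Path n 0 → ℕ
area p = twiceArea p / 2

2∣twiceArea+h : ∀ {n h} (p : Path n h) → 2 ∣ twiceArea p ℕ.+ h
2∣twiceArea+h done = 2 ∣0
2∣twiceArea+h (up {h = h} p) =
  ∣m+n∣m⇒∣n (subst (2 ∣_) eq (∣m∣n⇒∣m+n (m∣m*n (suc h)) (2∣twiceArea+h p))) ∣-refl
  where
  open +-*-Solver
  eq : 2 ℕ.* suc h ℕ.+ (twiceArea p ℕ.+ suc h) ≡ 2 ℕ.+ (h ℕ.+ suc h ℕ.+ twiceArea p ℕ.+ h)
  eq = solve 2 (λ x a → con 2 :* (con 1 :+ x) :+ (a :+ (con 1 :+ x))
                  := con 2 :+ (x :+ (con 1 :+ x) :+ a :+ x)) refl h (twiceArea p)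
2∣twiceArea+h (down {h = h} p) =
  subst (2 ∣_) eq (∣m∣n⇒∣m+n (m∣m*n (suc h)) (2∣twiceArea+h p))
  where
  open +-*-Solver
  eq : 2 ℕ.* suc h ℕ.+ (twiceArea p ℕ.+ h) ≡ suc h ℕ.+ h ℕ.+ twiceArea p ℕ.+ suc h
  eq = solve 2 (λ x a → con 2 :* (con 1 :+ x) :+ (a :+ x)
                  := con 1 :+ x :+ x :+ a :+ (con 1 :+ x)) refl h (twiceArea p)
2∣twiceArea+h (level {h = h} p) =
  subst (2 ∣_) eq (∣m∣n⇒∣m+n (m∣m*n (2 ℕ.* h)) (2∣twiceArea+h p))
  where
  open +-*-Solver
  eq : 2 ℕ.* (2 ℕ.* h) ℕ.+ (twiceArea p ℕ.+ h) ≡ 4 ℕ.* h ℕ.+ twiceArea p ℕ.+ h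
  eq = solve 2 (λ x a → con 2 :* (con 2 :* x) :+ (a :+ x)
                  := con 4 :* x :+ a :+ x) refl h (twiceArea p)

area*2≡twiceArea : ∀ {n} (p : Path n 0) → area p ℕ.* 2 ≡ twiceArea p
area*2≡twiceArea p = m/n*n≡m (subst (2 ∣_) (+-identityʳ (twiceArea p)) (2∣twiceArea+h p))

-- Every path occurs in this list exactly once, see paths-complete and
-- paths-unique.
paths downPaths levelPaths : ∀ n h → List (Path n h)
paths zero    zero    = done ∷ []
paths zero    (suc h) = []
paths (suc n) h       = map up (paths n (suc h)) ++ (downPaths (suc n) h ++ levelPaths (suc n) h)

downPaths (suc n) (suc h) = map down (paths n h)
downPaths _       _       = []

levelPaths (suc (suc n)) h = map level (paths n h)
levelPaths _             _ = []

paths-complete : ∀ {n h} (p : Path n h) → p ∈ paths n h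
paths-complete done = here refl
paths-complete (up p) = ∈-++⁺ˡ (∈-map⁺ up (paths-complete p))
paths-complete (down {n} {h} p) =
  ∈-++⁺ʳ (map up (paths n (suc (suc h)))) (∈-++⁺ˡ (∈-map⁺ down (paths-complete p)))
paths-complete (level {n} {h} p) =
  ∈-++⁺ʳ (map up (paths (suc n) (suc h)))
    (∈-++⁺ʳ (downPaths (suc (suc n)) h) (∈-map⁺ level (paths-complete p)))

private
  up∉down : ∀ {n h} {p : Path n (suc h)} → up p ∈ downPaths (suc n) h → ⊥
  up∉down {h = suc _} e with ∈-map⁻ down e
  ... | _ , _ , ()

  up∉level : ∀ {n h} {p : Path n (suc h)} → up p ∈ levelPaths (suc n) h → ⊥
  up∉level {suc _} e with ∈-map⁻ level e
  ... | _ , _ , ()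

  down∉level : ∀ {n h} {p : Path n h} → down p ∈ levelPaths (suc n) (suc h) → ⊥
  down∉level {suc _} e with ∈-map⁻ level e
  ... | _ , _ , ()

  down#level : ∀ n h {p : Path (suc n) h} →
    p ∈ downPaths (suc n) h × p ∈ levelPaths (suc n) h → ⊥
  down#level n (suc h) (d , l) with ∈-map⁻ down d
  ... | _ , _ , refl = down∉level l

  up#rest : ∀ n h {p : Path (suc n) h} →
    p ∈ map up (paths n (suc h)) × p ∈ downPaths (suc n) h ++ levelPaths (suc n) h → ⊥
  up#rest n h (u , r) with ∈-map⁻ up u | ∈-++⁻ (downPaths (suc n) h) r
  ... | _ , _ , refl | inj₁ d = up∉down d
  ... | _ , _ , refl | inj₂ l = up∉level l

paths-unique : ∀ n h → Unique (paths n h)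
downPaths-unique : ∀ n h → Unique (downPaths n h)
levelPaths-unique : ∀ n h → Unique (levelPaths n h)

paths-unique zero    zero    = [] ∷ []
paths-unique zero    (suc h) = []
paths-unique (suc n) h       =
  ++⁺ (map⁺ (λ { refl → refl }) (paths-unique n (suc h)))
      (++⁺ (downPaths-unique (suc n) h) (levelPaths-unique (suc n) h) (down#level n h))
      (up#rest n h)

downPaths-unique (suc n) (suc h) = map⁺ (λ { refl → refl }) (paths-unique n h)
downPaths-unique (suc n) zero    = []
downPaths-unique zero    _       = []

levelPaths-unique (suc (suc n)) h = map⁺ (λ { refl → refl }) (paths-unique n h)
levelPaths-unique (suc zero)    _ = []
levelPaths-unique zero          _ = []

module Narayana {c ℓ} (R : CommutativeRing c ℓ) where
  open CommutativeRing R hiding (zero)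
  open RawSemiringDefs (Semiring.rawSemiring semiring) using (_^_; sum; product) public

  -- t and q range over the units of an arbitrary commutative ring: this covers
  -- indeterminates (in the Laurent polynomial ring) and nonzero constants.
  Unit : Set _
  Unit = ∃ (Invertible _≈_ 1# _*_)

  val : Unit → Carrier
  val = proj₁

  infix 9 _⁻¹
  _⁻¹ : Unit → Unit
  (x , y , yx≈1 , xy≈1) ⁻¹ = y , x , xy≈1 , yx≈1

  infixr 8 _^ℤ_
  _^ℤ_ : Unit → ℤ → Carrier
  u ^ℤ (+ n)    = val u ^ n
  u ^ℤ -[1+ n ] = val (u ⁻¹) ^ suc n

  ∏ : ℕ → (ℕ → Carrier) → Carrier
  ∏ m f = product {m} (λ i → f (suc (toℕ i)))

  syntax ∏ m (λ k → e) = ∏[1≤ k ≤ m ] e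

  -- Laplace expansion along the first row.
  det : ∀ n → (Fin n → Fin n → Carrier) → Carrier
  det zero    M = 1#
  det (suc n) M =
    sum (λ k → (- 1#) ^ toℕ k * M zero k * det n (λ i j → M (suc i) (punchIn k j)))

  weight : ∀ {k} → Unit → Unit → S k → Carrier
  weight t q P = val t ^ levels P * val q ^ area P

  Nℕ : ℕ → Unit → Unit → Carrier
  Nℕ k t q = foldr _+_ 0# (map (weight {k} t q) (paths (2 ℕ.* k) 0))

  N : ℤ → Unit → Unit → Carrier
  N (+ k)        t q = Nℕ k t q
  N k@(-[1+ _ ]) t q =
    t ^ℤ (ℤ.- (+ 2) ℤ.* + ℤ.∣ k ∣ ℤ.+ + 1) * Nℕ (ℤ.∣ k ∣ ℕ.∸ 1) t (q ⁻¹)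

  𝒩 : ℕ → ℤ → Unit → Unit → Carrier
  𝒩 n s t q = det n (λ j k → N (s ℤ.+ + toℕ j ℤ.- + toℕ k ℤ.- + 1) t q)

  -- Each number halved here is even, so the divisions are exact.
  φ : ℕ → ℤ → Unit → Unit → Carrier
  φ n s t q =
    (- 1#) ^ (n ℕ.* (n ℕ.∸ 1) / 2)
    * t ^ℤ (ℤ.- (((+ n ℤ.- s) ℤ.* (+ n ℤ.- s ℤ.+ + 1)) /ℕ 2))
    * q ^ℤ ((+ n ℤ.* (+ n ℤ.- + 1) ℤ.* (+ 2 ℤ.* s ℤ.- + 1)) /ℕ 2)

{-# OPTIONS --safe #-}

-- The generating function f of the q-Narayana polynomials satisfies f = 1 + t x f + q x f(q²x) f, and if
-- f̃ denotes the same series with t q⁻² in place of t, it follows that f = 1 + x (t + q f) f̃(q²x). This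
-- relation between neighbouring values of t extends to the part of the bilateral sequence N with negative
-- indices. It says that suitable polynomial combinations of the columns of the Töplitz matrix of N factor
-- through the Töplitz matrix for t q⁻², so that
--   𝒩_n^(s)(t,q) = (-1)^(n-1) q^((4s-5)(n-1)) (t+q)^(s-1) 𝒩_(n-1)^(s-1)(t q⁻²,q)   for 1 ≤ s ≤ n+1.
-- Iterating this leads to s = 0, and the duality N_k(t,q) = t^(2k+1) N_(-k-1)(t,q⁻¹), which exchanges s and
-- 1-s, leads back from s = 0 to s = 1. The factors t + q^(2k-1) need not be cancellable: no step divides by them.

module Submission where

open import Defs
open import Algebra.Bundles using (CommutativeRing; CommutativeSemiring)
import Algebra.Properties.CommutativeMonoid.Sum as MonoidSum
import Algebra.Properties.CommutativeSemiring.Exp as SemiringExp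
import Algebra.Properties.Ring as RingProperties
import Algebra.Properties.Semiring.Sum as SemiringSum
import Algebra.Solver.Ring.NaturalCoefficients.Default as SemiringSolver
open import Algebra.Structures.Biased using (isCommutativeSemiringˡ)
open import Data.Bool using (if_then_else_; true; false)
open import Data.Empty using (⊥-elim)
open import Data.Fin using (Fin; zero; suc; toℕ; punchIn; punchOut; opposite)
open import Data.Fin.Properties using
  (punchIn-injective; punchInᵢ≢i; punchIn-punchOut; suc-injective; toℕ<n; opposite-prop;
      opposite-involutive)
  renaming (_≟_ to _≟ᶠ_)
open import Data.Integer as ℤ using (ℤ; +_; -[1+_]; ∣_∣; _⊖_; _/ℕ_)
open import Data.Integer.Properties as ℤₚ using ([1+m]⊖[1+n]≡m⊖n; m-n≡m⊖n; +-cancelˡ-⊖; ⊖-≤; pos-*)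
open import Data.Integer.Tactic.RingSolver using (solve-∀)
open import Data.Nat as ℕ using (ℕ; zero; suc; z≤n; s≤s; _<ᵇ_; _/_)
open import Data.Nat.DivMod using (m*n/n≡m; m*n%n≡0)
import Data.Nat.Properties as ℕₚ
open import Data.Nat.Solver using (module +-*-Solver)
open import Data.Product using (∃₂; _×_; _,_)
open import Data.Sum as Sum using (_⊎_; inj₁; inj₂)
open import Function using (_∘_)
open import Level using (_⊔_)
open import Relation.Binary using (IsEquivalence; Setoid)
import Relation.Binary.Reasoning.Setoid as SetoidReasoning
open import Relation.Binary.PropositionalEquality as ≡ using (_≡_; _≢_)
open import Relation.Nullary using (yes; no)

-- Write F for the bilateral sequence N, F⁺ for its part in positive degrees, F⁻ for the rest, u for
-- t + q, and ψ_z = q^(4z-1) N_(z-1)(t q⁻², q). With this normalisation of ψ one relation holds for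
-- all r, k ≥ 0: F_(r-k) + Σ_(l≤k) F⁻_(r-l) ψ_(l-k) = u F_(r-k-1) + Σ_(l>k) F⁺_(r-l) ψ_(l-k). For r
-- > k it is an identity of power series in q, for r ≤ k one in q⁻¹. The cut between the two sums
-- depends on the column k. Adding the multiples F_(r-l) ψ_(l-k) with k < l < d moves it to an index
-- d common to all columns, and then the sums are the entries of a matrix product A B. Here B
-- contains the smaller Töplitz matrix, and A has a row whose only possibly nonzero entry is N_0 or
-- N_1, in the first column. Without that row and the first column, A is block diagonal with
-- triangular blocks, whose diagonal entries are 1 in one block and -N_1 = -(t+q) in the other.
-- These entries N_1 are the source of the power of t + q.

-- Adjacent indices and the deletion of an index.

data Next : ∀ {n} → Fin n → Fin n → Set where
  here  : ∀ {n} → Next {suc (suc n)} zero (suc zero)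
  there : ∀ {n} {i j : Fin n} → Next i j → Next (suc i) (suc j)

toℕ-Next : ∀ {n} {i j : Fin n} → Next i j → toℕ j ≡ suc (toℕ i)
toℕ-Next here      = ≡.refl
toℕ-Next (there a) = ≡.cong suc (toℕ-Next a)

-- Deleting a third column keeps an adjacent pair adjacent. This is why alternation is stated for
-- adjacent columns only: the property passes to minors.
Next-punchIn : ∀ {n} (k : Fin (suc n)) {i j} → Next i j →
  k ≡ i ⊎ k ≡ j ⊎ ∃₂ λ i′ j′ → Next i′ j′ × punchIn k i′ ≡ i × punchIn k j′ ≡ j
Next-punchIn zero          here      = inj₁ ≡.refl
Next-punchIn (suc zero)    here      = inj₂ (inj₁ ≡.refl)
Next-punchIn {suc (suc n)} (suc (suc k)) here = inj₂ (inj₂ (zero , suc zero , here , ≡.refl , ≡.refl))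
Next-punchIn zero (there {i = i} {j} a) = inj₂ (inj₂ (i , j , a , ≡.refl , ≡.refl))
Next-punchIn {suc n} (suc k) (there a) with Next-punchIn k a
... | inj₁ e = inj₁ (≡.cong suc e)
... | inj₂ (inj₁ e) = inj₂ (inj₁ (≡.cong suc e))
... | inj₂ (inj₂ (i , j , b , p , q)) =
  inj₂ (inj₂ (suc i , suc j , there b , ≡.cong suc p , ≡.cong suc q))

-- The complements of two adjacent indices list the same columns in the same order, except that one
-- has j where the other has i. Minors that omit one of two equal adjacent columns therefore agree.
punchIn-Next : ∀ {n} {i j : Fin (suc n)} → Next i j → ∀ l →
  punchIn i l ≡ punchIn j l ⊎ (punchIn i l ≡ j × punchIn j l ≡ i)
punchIn-Next here zero = inj₂ (≡.refl , ≡.refl)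
punchIn-Next here (suc l) = inj₁ ≡.refl
punchIn-Next (there a) zero = inj₁ ≡.refl
punchIn-Next (there a) (suc l) with punchIn-Next a l
... | inj₁ e = inj₁ (≡.cong suc e)
... | inj₂ (p , q) = inj₂ (≡.cong suc p , ≡.cong suc q)

-- Alternating multilinear functions and the determinant.

module Determinant {c ℓ} (R : CommutativeRing c ℓ) where
  open import Data.Vec.Functional using (_∷_)
  open CommutativeRing R hiding (zero)
  open Narayana R using (det; _^_; sum)
  open RingProperties ring
  open SemiringSum semiring using (sum-cong-≋; ∑-distrib-+; *-distribˡ-sum; *-distribʳ-sum; sum-replicate-zero)
  open SemiringSolver commutativeSemiring using (solve; _:+_; _:*_; _:=_; con)
  open SetoidReasoning setoid

  sum-zero : ∀ {n} (f : Fin n → Carrier) → (∀ i → f i ≈ 0#) → sum f ≈ 0#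
  sum-zero {n} f f≈0 = trans (sum-cong-≋ f≈0) (sum-replicate-zero n)

  sum-single : ∀ {n} (f : Fin n → Carrier) i → (∀ k → k ≢ i → f k ≈ 0#) → sum f ≈ f i
  sum-single f zero    z = trans (+-congˡ (sum-zero (f ∘ suc) (λ k → z (suc k) λ ()))) (+-identityʳ _)
  sum-single f (suc i) z =
    trans (+-cong (z zero λ ()) (sum-single (f ∘ suc) i λ k k≢i → z (suc k) (k≢i ∘ suc-injective)))
          (+-identityˡ _)

  sum-Next : ∀ {n} (f : Fin n → Carrier) {i j} → Next i j → f i + f j ≈ 0# →
    (∀ k → k ≢ i → k ≢ j → f k ≈ 0#) → sum f ≈ 0#
  sum-Next f here e z = trans (sym (+-assoc _ _ _))
    (trans (+-cong e (sum-zero _ λ k → z (suc (suc k)) (λ ()) (λ ()))) (+-identityˡ _))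
  sum-Next f (there a) e z = trans (+-cong (z zero (λ ()) (λ ()))
    (sum-Next (f ∘ suc) a e λ k p q → z (suc k) (p ∘ suc-injective) (q ∘ suc-injective)))
        (+-identityˡ _)

  Matrix : ℕ → ℕ → Set c
  Matrix m n = Fin m → Fin n → Carrier

  det-cong : ∀ n {M M′ : Matrix n n} → (∀ i j → M i j ≈ M′ i j) → det n M ≈ det n M′
  det-cong zero    e = refl
  det-cong (suc n) e = sum-cong-≋ λ k →
    *-cong (*-congˡ {x = (- 1#) ^ toℕ k} (e zero k)) (det-cong n λ i j → e (suc i) (punchIn k j))

  -- The argument X lists column vectors, so X j i is the i-th entry of the j-th of them.
  record Alternating {m n} (D : Matrix n m → Carrier) : Set (c ⊔ ℓ) where
    field
      D-cong   : ∀ {X Y} → (∀ j i → X j i ≈ Y j i) → D X ≈ D Y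
      D-linear : ∀ j a b {X Y Z} → (∀ i → X j i ≈ a * Y j i + b * Z j i) →
        (∀ k → k ≢ j → ∀ i → X k i ≈ Y k i) → (∀ k → k ≢ j → ∀ i → X k i ≈ Z k i) →
        D X ≈ a * D Y + b * D Z
      D-alternates : ∀ {i j} {X} → Next i j → (∀ l → X i l ≈ X j l) → D X ≈ 0#

  open Alternating

  -- Freezing the first column is what makes induction on the number of columns possible: a column
  -- is brought to the front by `D-swap` and then frozen.
  Alternating-∷ : ∀ {m n} {D : Matrix (suc n) m → Carrier} → Alternating D → ∀ v →
    Alternating (λ X → D (v ∷ X))
  D-cong (Alternating-∷ alt v) e = D-cong alt λ { zero i → refl ; (suc j) i → e j i }
  D-linear (Alternating-∷ alt v) j a b e e₁ e₂ = D-linear alt (suc j) a b e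
    (λ { zero _ i → refl ; (suc k) k≢j → e₁ k (k≢j ∘ ≡.cong suc) })
    (λ { zero _ i → refl ; (suc k) k≢j → e₂ k (k≢j ∘ ≡.cong suc) })
  D-alternates (Alternating-∷ alt v) a e = D-alternates alt (there a) e

  module _ {m n} {D : Matrix (suc (suc n)) m → Carrier} (alt : Alternating D) where

    -- Polarisation: expand the value at `v+w`, `v+w`, which is zero, and drop the two terms with a
    -- repeated column.
    D-swap : ∀ v w X → D (v ∷ w ∷ X) ≈ - D (w ∷ v ∷ X)
    D-swap v w X = uniqueˡ-⁻¹ _ _ (begin
      D (v ∷ w ∷ X) + D (w ∷ v ∷ X)
        ≈⟨ +-cong (sym (+-identityˡ _)) (sym (+-identityʳ _)) ⟩
      (0# + D (v ∷ w ∷ X)) + (D (w ∷ v ∷ X) + 0#)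
        ≈⟨ +-cong (+-congʳ (sym (D-alternates alt here λ l → refl)))
                  (+-congˡ (sym (D-alternates alt here λ l → refl))) ⟩
      (D (v ∷ v ∷ X) + D (v ∷ w ∷ X)) + (D (w ∷ v ∷ X) + D (w ∷ w ∷ X))
        ≈⟨ +-cong (sym (second v)) (sym (second w)) ⟩
      D (v ∷ v+w ∷ X) + D (w ∷ v+w ∷ X)
        ≈⟨ sym (trans (D-linear alt zero 1# 1#
             (λ i → sym (+-cong (*-identityˡ _) (*-identityˡ _)))
             (λ { zero k≢ → ⊥-elim (k≢ ≡.refl) ; (suc k) _ i → refl })
             (λ { zero k≢ → ⊥-elim (k≢ ≡.refl) ; (suc k) _ i → refl }))
             (+-cong (*-identityˡ _) (*-identityˡ _))) ⟩
      D (v+w ∷ v+w ∷ X)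
        ≈⟨ D-alternates alt here (λ l → refl) ⟩
      0# ∎)
      where
      v+w : Fin m → Carrier
      v+w i = v i + w i
      second : ∀ x → D (x ∷ v+w ∷ X) ≈ D (x ∷ v ∷ X) + D (x ∷ w ∷ X)
      second x = trans (D-linear alt (suc zero) 1# 1#
        (λ i → sym (+-cong (*-identityˡ _) (*-identityˡ _)))
        (λ { zero _ i → refl ; (suc zero) k≢ → ⊥-elim (k≢ ≡.refl) ; (suc (suc k)) _ i → refl })
        (λ { zero _ i → refl ; (suc zero) k≢ → ⊥-elim (k≢ ≡.refl) ; (suc (suc k)) _ i → refl }))
        (+-cong (*-identityˡ _) (*-identityˡ _))

  -- The multiple of v in the column next to v contributes nothing. That column, now `y zero`, is
  -- swapped to the front and frozen, so that v meets the next column; a second swap restores the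
  -- order and the sign.
  D-absorb : ∀ {m n} {D : Matrix (suc n) m → Carrier} → Alternating D → ∀ v (a : Fin n → Carrier) y →
    D (v ∷ (λ j i → a j * v i + y j i)) ≈ D (v ∷ y)
  D-absorb {n = zero} alt v a y = D-cong alt λ { zero i → refl }
  D-absorb {m} {n = suc n} {D} alt v a y = begin
    D (v ∷ x)                                 ≈⟨ D-linear alt (suc zero) (a zero) 1#
      (λ i → +-congˡ (sym (*-identityˡ _)))
      (λ { zero _ i → refl ; (suc zero) k≢ → ⊥-elim (k≢ ≡.refl) ; (suc (suc k)) _ i → refl })
      (λ { zero _ i → refl ; (suc zero) k≢ → ⊥-elim (k≢ ≡.refl) ; (suc (suc k)) _ i → refl }) ⟩
    a zero * D (v ∷ v ∷ x′) + 1# * D (v ∷ y zero ∷ x′)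
      ≈⟨ +-cong (trans (*-congˡ (D-alternates alt here λ l → refl)) (zeroʳ _)) (*-identityˡ _) ⟩
    0# + D (v ∷ y zero ∷ x′)                  ≈⟨ +-identityˡ _ ⟩
    D (v ∷ y zero ∷ x′)                       ≈⟨ D-swap alt v (y zero) x′ ⟩
    - D (y zero ∷ v ∷ x′)
      ≈⟨ -‿cong (D-absorb (Alternating-∷ alt (y zero)) v (a ∘ suc) (y ∘ suc)) ⟩
    - D (y zero ∷ v ∷ y ∘ suc)                ≈⟨ sym (D-swap alt v (y zero) (y ∘ suc)) ⟩
    D (v ∷ y zero ∷ y ∘ suc)
      ≈⟨ D-cong alt (λ { zero i → refl ; (suc zero) i → refl ; (suc (suc j)) i → refl }) ⟩
    D (v ∷ y) ∎
    where
    x : Matrix (suc n) m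
    x j i = a j * v i + y j i
    x′ : Matrix n m
    x′ = x ∘ suc

  -- Multilinear expansion: choosing v in two columns gives zero, choosing it in column k alone and
  -- moving it to the front costs k swaps. The right-hand side has the shape of a Laplace expansion
  -- along a row `a`.
  D-expand : ∀ {m n} {D : Matrix (suc n) m → Carrier} → Alternating D →
      ∀ v (a : Fin (suc n) → Carrier) y →
    D (λ j i → a j * v i + y j i) ≈
    D y + sum (λ k → (- 1#) ^ toℕ k * a k * D (v ∷ y ∘ punchIn k))
  D-expand {m} {n} {D} alt v a y = begin
    D x                                            ≈⟨ D-linear alt zero (a zero) 1#
      (λ i → +-congˡ (sym (*-identityˡ _)))
      (λ { zero k≢ → ⊥-elim (k≢ ≡.refl) ; (suc k) _ i → refl })
      (λ { zero k≢ → ⊥-elim (k≢ ≡.refl) ; (suc k) _ i → refl }) ⟩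
    a zero * D (v ∷ x ∘ suc) + 1# * D (y zero ∷ x ∘ suc)
      ≈⟨ +-cong (*-congˡ (D-absorb alt v (a ∘ suc) (y ∘ suc))) (*-identityˡ _) ⟩
    a zero * D (v ∷ y ∘ suc) + D (y zero ∷ x ∘ suc) ≈⟨ +-congˡ (tail-expand n alt a y) ⟩
    a zero * D (v ∷ y ∘ suc) + (D y + rest)
      ≈⟨ solve 4 (λ p q r s → p :* q :+ (r :+ s) := r :+ (con 1 :* p :* q :+ s)) refl
           (a zero) (D (v ∷ y ∘ suc)) (D y) rest ⟩
    D y + (1# * a zero * D (v ∷ y ∘ suc) + rest) ∎
    where
    x : Matrix (suc n) m
    x j i = a j * v i + y j i
    rest : Carrier
    rest = sum {n} (λ k → (- 1#) ^ suc (toℕ k) * a (suc k) * D (v ∷ y ∘ punchIn (suc k)))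
    -- The terms in which the first column is not v. With `y zero` frozen the expansion has one
    -- column less, and swapping `y zero` with v turns each (-1)^k into (-1)^(k+1).
    tail-expand : ∀ n {D : Matrix (suc n) m → Carrier} → Alternating D →
        ∀ (a : Fin (suc n) → Carrier) y →
      D (y zero ∷ (λ j i → a (suc j) * v i + y (suc j) i)) ≈
      D y + sum {n} (λ k → (- 1#) ^ suc (toℕ k) * a (suc k) * D (v ∷ y ∘ punchIn (suc k)))
    tail-expand zero    alt a y = trans (D-cong alt λ { zero i → refl }) (sym (+-identityʳ _))
    tail-expand (suc n) {D} alt a y =
        trans (D-expand (Alternating-∷ alt (y zero)) v (a ∘ suc) (y ∘ suc))
      (+-cong (D-cong alt λ { zero i → refl ; (suc j) i → refl }) (sum-cong-≋ λ k → begin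
        (- 1#) ^ toℕ k * a (suc k) * D (y zero ∷ v ∷ y ∘ suc ∘ punchIn k)
          ≈⟨ *-congˡ (D-swap alt (y zero) v _) ⟩
        (- 1#) ^ toℕ k * a (suc k) * - D (v ∷ y zero ∷ y ∘ suc ∘ punchIn k)
          ≈⟨ *-congˡ (trans (-‿cong (D-cong alt
               λ { zero i → refl ; (suc zero) i → refl ; (suc (suc j)) i → refl })) (sym (-1*x≈-x _))) ⟩
        (- 1#) ^ toℕ k * a (suc k) * (- 1# * D (v ∷ y ∘ punchIn (suc k)))
          ≈⟨ solve 4 (λ e b o d → e :* b :* (o :* d) := o :* e :* b :* d) refl _ _ _ _ ⟩
        (- 1#) ^ suc (toℕ k) * a (suc k) * D (v ∷ y ∘ punchIn (suc k)) ∎))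

  -- Expanding in `v zero` leaves values of D in which, once the first column is frozen, the other
  -- columns are again one more than the vectors `v ∘ suc` that they combine.
  D-dependent : ∀ {m} n {D : Matrix (suc n) m → Carrier} → Alternating D →
    ∀ (v : Matrix n m) (a : Matrix (suc n) n) →
    D (λ j i → sum (λ l → a j l * v l i)) ≈ 0#
  D-dependent zero {D} alt v a = trans
    (D-linear alt zero 0# 0# {Y = λ _ _ → 0#} {Z = λ _ _ → 0#}
      (λ i → sym (trans (+-cong (zeroˡ _) (zeroˡ _)) (+-identityʳ _)))
      (λ _ _ _ → refl) (λ _ _ _ → refl))
    (trans (+-cong (zeroˡ _) (zeroˡ _)) (+-identityʳ _))
  D-dependent {m} (suc n) {D} alt v a = begin
    D (λ j i → a j zero * v zero i + y j i) ≈⟨ D-expand alt (v zero) (λ j → a j zero) y ⟩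
    D y + sum (λ k → (- 1#) ^ toℕ k * a k zero * D (v zero ∷ y ∘ punchIn k))
      ≈⟨ +-cong (trans (D-cong alt λ { zero i → refl ; (suc j) i → refl })
                       (D-dependent n (Alternating-∷ alt (y zero)) (v ∘ suc)
                           (λ j l → a (suc j) (suc l))))
                (sum-zero _ λ k → trans (*-congˡ {x = (- 1#) ^ toℕ k * a k zero}
                    (D-dependent n (Alternating-∷ alt (v zero)) (v ∘ suc)
                  (λ j l → a (punchIn k j) (suc l)))) (zeroʳ _)) ⟩
    0# + 0# ≈⟨ +-identityʳ 0# ⟩
    0# ∎
    where
    y : Matrix (suc (suc n)) m
    y j i = sum (λ l → a j (suc l) * v (suc l) i)

  -- The universal property of the determinant. Expansion in `v zero` has the entries of the first
  -- row of M as coefficients and, by induction, minors of M as cofactors, which is the defining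
  -- Laplace expansion; the term free of `v zero` vanishes by `D-dependent`.
  D-combination : ∀ {m} n {D : Matrix n m → Carrier} → Alternating D →
      ∀ (v : Matrix n m) (M : Matrix n n) →
    D (λ j i → sum (λ l → M l j * v l i)) ≈ det n M * D v
  D-combination zero alt v M = trans (D-cong alt λ ()) (sym (*-identityˡ _))
  D-combination {m} (suc n) {D} alt v M = begin
    D (λ j i → M zero j * v zero i + y j i) ≈⟨ D-expand alt (v zero) (M zero) y ⟩
    D y + sum (λ k → (- 1#) ^ toℕ k * M zero k * D (v zero ∷ y ∘ punchIn k))
      ≈⟨ +-cong (D-dependent n alt (v ∘ suc) (λ j l → M (suc l) j)) (sum-cong-≋ λ k → begin
          (- 1#) ^ toℕ k * M zero k * D (v zero ∷ y ∘ punchIn k)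
            ≈⟨ *-congˡ (D-combination n (Alternating-∷ alt (v zero)) (v ∘ suc)
                 (λ l j → M (suc l) (punchIn k j))) ⟩
          (- 1#) ^ toℕ k * M zero k * (minor k * D (v zero ∷ v ∘ suc))
            ≈⟨ *-congˡ (*-congˡ (D-cong alt λ { zero i → refl ; (suc j) i → refl })) ⟩
          (- 1#) ^ toℕ k * M zero k * (minor k * D v)
            ≈⟨ sym (*-assoc _ _ _) ⟩
          (- 1#) ^ toℕ k * M zero k * minor k * D v ∎) ⟩
    0# + sum (λ k → (- 1#) ^ toℕ k * M zero k * minor k * D v)
      ≈⟨ trans (+-identityˡ _) (sym (*-distribʳ-sum (D v)
          (λ k → (- 1#) ^ toℕ k * M zero k * minor k))) ⟩
    det (suc n) M * D v ∎
    where
    y : Matrix (suc n) m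
    y j i = sum (λ l → M (suc l) j * v (suc l) i)
    minor : Fin (suc n) → Carrier
    minor k = det n (λ i j → M (suc i) (punchIn k j))

  -- Linearity in column j: in the Laplace term of column j the entry is linear and the minor omits
  -- that column; in every other term the minor is linear by induction. Alternation: the terms of
  -- the two equal columns have equal minors and opposite signs, and every other minor still
  -- contains both columns, side by side.
  det-columns : ∀ n → Alternating {n} {n} (λ X → det n (λ i j → X j i))
  D-cong (det-columns n) e = det-cong n λ i j → e j i
  D-linear (det-columns (suc n)) j a b {X} {Y} {Z} e e₁ e₂ = begin
    sum (term X) ≈⟨ sum-cong-≋ pointwise ⟩
    sum (λ k → a * term Y k + b * term Z k)
      ≈⟨ ∑-distrib-+ (λ k → a * term Y k) (λ k → b * term Z k) ⟩
    sum (λ k → a * term Y k) + sum (λ k → b * term Z k)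
      ≈⟨ sym (+-cong (*-distribˡ-sum a (term Y)) (*-distribˡ-sum b (term Z))) ⟩
    a * sum (term Y) + b * sum (term Z) ∎
    where
    minor : Matrix (suc n) (suc n) → Fin (suc n) → Carrier
    minor X k = det n (λ i l → X (punchIn k l) (suc i))
    term : Matrix (suc n) (suc n) → Fin (suc n) → Carrier
    term X k = (- 1#) ^ toℕ k * X k zero * minor X k
    pointwise : ∀ k → term X k ≈ a * term Y k + b * term Z k
    pointwise k with k ≟ᶠ j
    ... | yes ≡.refl = begin
      (- 1#) ^ toℕ k * X k zero * minor X k ≈⟨ *-congʳ (*-congˡ (e zero)) ⟩
      (- 1#) ^ toℕ k * (a * Y k zero + b * Z k zero) * minor X k
        ≈⟨ solve 6 (λ s a y b z m → s :* (a :* y :+ b :* z) :* m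
            := a :* (s :* y :* m) :+ b :* (s :* z :* m))
             refl _ _ _ _ _ _ ⟩
      a * ((- 1#) ^ toℕ k * Y k zero * minor X k) + b * ((- 1#) ^ toℕ k * Z k zero * minor X k)
        ≈⟨ +-cong (*-congˡ (*-congˡ (det-cong n λ i l → e₁ (punchIn k l) (punchInᵢ≢i k l) (suc i))))
                  (*-congˡ (*-congˡ (det-cong n λ i l → e₂ (punchIn k l) (punchInᵢ≢i k l) (suc i)))) ⟩
      a * term Y k + b * term Z k ∎
    ... | no k≢j = begin
      (- 1#) ^ toℕ k * X k zero * minor X k
        ≈⟨ *-congˡ (D-linear (det-columns n) (punchOut k≢j) a b
             {λ l i → X (punchIn k l) (suc i)} {λ l i → Y (punchIn k l) (suc i)}
                 {λ l i → Z (punchIn k l) (suc i)}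
             (λ i → ≡.subst (λ h → X h (suc i) ≈ a * Y h (suc i) + b * Z h (suc i))
                      (≡.sym (punchIn-punchOut k≢j)) (e (suc i)))
             (λ l l≢ i → e₁ (punchIn k l) (other l l≢) (suc i))
             (λ l l≢ i → e₂ (punchIn k l) (other l l≢) (suc i))) ⟩
      (- 1#) ^ toℕ k * X k zero * (a * minor Y k + b * minor Z k)
        ≈⟨ solve 6 (λ s x a m b m′ → s :* x :* (a :* m :+ b :* m′)
            := a :* (s :* x :* m) :+ b :* (s :* x :* m′))
             refl _ _ _ _ _ _ ⟩
      a * ((- 1#) ^ toℕ k * X k zero * minor Y k) + b * ((- 1#) ^ toℕ k * X k zero * minor Z k)
        ≈⟨ +-cong (*-congˡ (*-congʳ (*-congˡ (e₁ k k≢j zero))))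
            (*-congˡ (*-congʳ (*-congˡ (e₂ k k≢j zero)))) ⟩
      a * term Y k + b * term Z k ∎
      where
      other : ∀ l → l ≢ punchOut k≢j → punchIn k l ≢ j
      other l l≢ p = l≢ (punchIn-injective k l _ (≡.trans p (≡.sym (punchIn-punchOut k≢j))))
  D-alternates (det-columns (suc n)) {i} {j} {X} a e = sum-Next _ a cancel vanish
    where
    minor : Fin (suc n) → Carrier
    minor k = det n (λ i l → X (punchIn k l) (suc i))
    minors-agree : minor i ≈ minor j
    minors-agree = det-cong n λ r l → same r (punchIn-Next a l)
      where
      same : ∀ r {x y} → x ≡ y ⊎ (x ≡ j × y ≡ i) → X x (suc r) ≈ X y (suc r)
      same r (inj₁ ≡.refl)            = refl
      same r (inj₂ (≡.refl , ≡.refl)) = sym (e (suc r))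
    cancel : (- 1#) ^ toℕ i * X i zero * minor i + (- 1#) ^ toℕ j * X j zero * minor j ≈ 0#
    cancel = begin
      (- 1#) ^ toℕ i * X i zero * minor i + (- 1#) ^ toℕ j * X j zero * minor j
        ≈⟨ +-cong (*-cong (*-congˡ (e zero)) minors-agree)
                  (*-congʳ (*-congʳ (reflexive (≡.cong ((- 1#) ^_) (toℕ-Next a))))) ⟩
      (- 1#) ^ toℕ i * X j zero * minor j + (- 1# * (- 1#) ^ toℕ i) * X j zero * minor j
        ≈⟨ solve 4 (λ s x m o → s :* x :* m :+ (o :* s) :* x :* m := (con 1 :+ o) :* (s :* x :* m))
            refl _ _ _ _ ⟩
      (1# + - 1#) * ((- 1#) ^ toℕ i * X j zero * minor j) ≈⟨ *-congʳ (-‿inverseʳ 1#) ⟩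
      0# * ((- 1#) ^ toℕ i * X j zero * minor j) ≈⟨ zeroˡ _ ⟩
      0# ∎
    vanish : ∀ k → k ≢ i → k ≢ j → (- 1#) ^ toℕ k * X k zero * minor k ≈ 0#
    vanish k k≢i k≢j with Next-punchIn k a
    ... | inj₁ k≡i        = ⊥-elim (k≢i k≡i)
    ... | inj₂ (inj₁ k≡j) = ⊥-elim (k≢j k≡j)
    ... | inj₂ (inj₂ (i′ , j′ , a′ , ≡.refl , ≡.refl)) =
      trans (*-congˡ (D-alternates (det-columns n) {X = λ l r → X (punchIn k l) (suc r)} a′
          (e ∘ suc))) (zeroʳ _)

  -- Matrix products, reversal and conjugation.

  δ : ∀ {n} → Matrix n n
  δ zero    zero    = 1#
  δ zero    (suc j) = 0#
  δ (suc i) zero    = 0#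
  δ (suc i) (suc j) = δ i j

  δ-refl : ∀ {n} (i : Fin n) → δ i i ≈ 1#
  δ-refl zero    = refl
  δ-refl (suc i) = δ-refl i

  δ-≢ : ∀ {n} {i j : Fin n} → i ≢ j → δ i j ≈ 0#
  δ-≢ {i = zero}  {zero}  i≢j = ⊥-elim (i≢j ≡.refl)
  δ-≢ {i = zero}  {suc j} i≢j = refl
  δ-≢ {i = suc i} {zero}  i≢j = refl
  δ-≢ {i = suc i} {suc j} i≢j = δ-≢ (i≢j ∘ ≡.cong suc)

  sum-*δ : ∀ {n} (f : Fin n → Carrier) j → sum (λ l → f l * δ l j) ≈ f j
  sum-*δ f j = trans (sum-single _ j λ k k≢j → trans (*-congˡ (δ-≢ k≢j)) (zeroʳ _))
                     (trans (*-congˡ (δ-refl j)) (*-identityʳ _))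

  infixl 7 _⊗_
  _⊗_ : ∀ {l m n} → Matrix l m → Matrix m n → Matrix l n
  (A ⊗ B) i j = sum (λ l → A i l * B l j)

  -- The determinant of A X is alternating in the columns of X, and the columns of B are
  -- combinations of unit vectors with coefficient matrix B, so `D-combination` applies.
  det-⊗ : ∀ n (A B : Matrix n n) → det n (A ⊗ B) ≈ det n A * det n B
  det-⊗ n A B = begin
    det n (A ⊗ B) ≈⟨ det-cong n (λ i j → sum-cong-≋ (λ l → *-congˡ (sym (sum-*δ′ l j)))) ⟩
    D (λ j i → sum (λ l → B l j * δ i l)) ≈⟨ D-combination n {D} alt (λ l i → δ i l) B ⟩
    det n B * D (λ l i → δ i l) ≈⟨ *-congˡ (det-cong n λ i j → sum-*δ (A i) j) ⟩
    det n B * det n A ≈⟨ *-comm _ _ ⟩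
    det n A * det n B ∎
    where
    D : Matrix n n → Carrier
    D X = det n (λ i j → sum (λ l → A i l * X j l))
    sum-*δ′ : ∀ l j → sum (λ k → B k j * δ l k) ≈ B l j
    sum-*δ′ l j = trans (sum-single _ l λ k k≢l → trans (*-congˡ (δ-≢ (k≢l ∘ ≡.sym))) (zeroʳ _))
                        (trans (*-congˡ (δ-refl l)) (*-identityʳ _))
    alt : Alternating D
    D-cong alt e = det-cong n λ i j → sum-cong-≋ λ l → *-congˡ (e j l)
    D-linear alt j a b {X} {Y} {Z} e e₁ e₂ = D-linear (det-columns n) j a b
      (λ i → begin
        sum (λ l → A i l * X j l)
          ≈⟨ sum-cong-≋ (λ l → trans (*-congˡ (e l))
               (solve 5 (λ m a y b z → m :* (a :* y :+ b :* z) := a :* (m :* y) :+ b :* (m :* z))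
                   refl _ _ _ _ _)) ⟩
        sum (λ l → a * (A i l * Y j l) + b * (A i l * Z j l))
          ≈⟨ ∑-distrib-+ (λ l → a * (A i l * Y j l)) (λ l → b * (A i l * Z j l)) ⟩
        sum (λ l → a * (A i l * Y j l)) + sum (λ l → b * (A i l * Z j l))
          ≈⟨ sym (+-cong (*-distribˡ-sum a (λ l → A i l * Y j l))
              (*-distribˡ-sum b (λ l → A i l * Z j l))) ⟩
        a * sum (λ l → A i l * Y j l) + b * sum (λ l → A i l * Z j l) ∎)
      (λ k k≢j i → sum-cong-≋ λ l → *-congˡ (e₁ k k≢j l))
      (λ k k≢j i → sum-cong-≋ λ l → *-congˡ (e₂ k k≢j l))
    D-alternates alt a e = D-alternates (det-columns n) a λ i → sum-cong-≋ λ l → *-congˡ (e l)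

  sum-δ* : ∀ {n} i (f : Fin n → Carrier) → sum (λ l → δ i l * f l) ≈ f i
  sum-δ* i f = trans (sum-single _ i λ k k≢i → trans (*-congʳ (δ-≢ (k≢i ∘ ≡.sym))) (zeroˡ _))
                     (trans (*-congʳ (δ-refl i)) (*-identityˡ _))

  det-row-single : ∀ n (M : Matrix (suc n) (suc n)) k → (∀ j → j ≢ k → M zero j ≈ 0#) →
    det (suc n) M ≈ (- 1#) ^ toℕ k * M zero k * det n (λ i j → M (suc i) (punchIn k j))
  det-row-single n M k z = sum-single _ k λ j j≢k →
    trans (*-congʳ (trans (*-congˡ {x = (- 1#) ^ toℕ j} (z j j≢k)) (zeroʳ _)))
          (zeroˡ (det n (λ i l → M (suc i) (punchIn j l))))

  det-zero-column : ∀ n (M : Matrix n n) j → (∀ i → M i j ≈ 0#) → det n M ≈ 0#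
  det-zero-column n M j z = trans
    (Alternating.D-linear (det-columns n) j 0# 0# {λ l i → M i l} {λ l i → M i l} {λ l i → M i l}
      (λ i → trans (z i) (sym (trans (+-cong (zeroˡ _) (zeroˡ _)) (+-identityʳ _))))
      (λ _ _ _ → refl) (λ _ _ _ → refl))
    (trans (+-cong (zeroˡ _) (zeroˡ _)) (+-identityʳ _))

  det-δ : ∀ n → det n δ ≈ 1#
  det-δ zero    = refl
  det-δ (suc n) = begin
    det (suc n) δ
        ≈⟨ det-row-single n δ zero (λ { zero z≢ → ⊥-elim (z≢ ≡.refl) ; (suc j) _ → refl }) ⟩
    1# * 1# * det n δ                 ≈⟨ *-cong (*-identityˡ 1#) (det-δ n) ⟩
    1# * 1#                           ≈⟨ *-identityˡ 1# ⟩
    1# ∎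

  det-1⊕ : ∀ n (M : Matrix (suc n) (suc n)) → M zero zero ≈ 1# → (∀ j → M zero (suc j) ≈ 0#) →
    det (suc n) M ≈ det n (λ i j → M (suc i) (suc j))
  det-1⊕ n M e z = trans
    (det-row-single n M zero λ { zero z≢ → ⊥-elim (z≢ ≡.refl) ; (suc j) _ → z j })
    (trans (*-congʳ (trans (*-identityˡ _) e)) (*-identityˡ _))

  -- Conjugation by the reversal permutation matrix P. Its determinant enters twice, so P ⊗ P = δ
  -- settles the sign.
  det-reverse : ∀ n (M : Matrix n n) → det n (λ i j → M (opposite i) (opposite j)) ≈ det n M
  det-reverse n M = begin
    det n (λ i j → M (opposite i) (opposite j)) ≈⟨ det-cong n (λ i j → sym (PMP i j)) ⟩
    det n (P ⊗ M ⊗ P)                           ≈⟨ trans (det-⊗ n (P ⊗ M) P) (*-congʳ (det-⊗ n P M)) ⟩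
    det n P * det n M * det n P
        ≈⟨ solve 2 (λ p m → p :* m :* p := p :* p :* m) refl _ _ ⟩
    det n P * det n P * det n M                 ≈⟨ *-congʳ (sym (det-⊗ n P P)) ⟩
    det n (P ⊗ P) * det n M                     ≈⟨ *-congʳ (trans (det-cong n PP) (det-δ n)) ⟩
    1# * det n M                                ≈⟨ *-identityˡ _ ⟩
    det n M ∎
    where
    P : Matrix n n
    P i j = δ (opposite i) j
    δ-opposite : ∀ (l j : Fin n) → δ (opposite l) j ≈ δ l (opposite j)
    δ-opposite l j with opposite l ≟ᶠ j
    ... | yes ≡.refl = trans (δ-refl (opposite l)) (sym (trans
            (reflexive (≡.cong (δ l) (opposite-involutive l))) (δ-refl l)))
    ... | no ≢ = trans (δ-≢ ≢) (sym (δ-≢ λ e →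
            ≢ (≡.trans (≡.cong opposite e) (opposite-involutive j))))
    PP : ∀ i j → (P ⊗ P) i j ≈ δ i j
    PP i j = trans (sum-δ* (opposite i) (λ l → P l j))
                   (reflexive (≡.cong (λ k → δ k j) (opposite-involutive i)))
    PMP : ∀ i j → (P ⊗ M ⊗ P) i j ≈ M (opposite i) (opposite j)
    PMP i j = trans (sum-cong-≋ λ l → *-cong (sum-δ* (opposite i) (λ k → M k l)) (δ-opposite l j))
                    (sum-*δ (M (opposite i)) (opposite j))

  diagonal : ∀ {n} → (Fin n → Carrier) → Matrix n n
  diagonal x i j = x i * δ i j

  det-scale : ∀ n a (M : Matrix n n) → det n (λ i j → a * M i j) ≈ a ^ n * det n M
  det-scale zero    a M = sym (*-identityˡ 1#)
  det-scale (suc n) a M = trans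
    (sum-cong-≋ λ k → trans (*-congˡ (det-scale n a (λ i j → M (suc i) (punchIn k j))))
      (solve 5 (λ s a m p d → s :* (a :* m) :* (p :* d) := a :* p :* (s :* m :* d)) refl
         ((- 1#) ^ toℕ k) a (M zero k) (a ^ n) _))
    (sym (*-distribˡ-sum (a * a ^ n)
        (λ k → (- 1#) ^ toℕ k * M zero k * det n (λ i j → M (suc i) (punchIn k j)))))

  -- Serves to strip a power b^(α+i-j) from the entries of a Töplitz matrix: it splits into a
  -- constant, a row factor and the inverse column factor.
  det-conjugate : ∀ n a (x y : Fin n → Carrier) (M : Matrix n n) → (∀ i → x i * y i ≈ 1#) →
    det n (λ i j → a * (x i * M i j * y j)) ≈ a ^ n * det n M
  det-conjugate n a x y M xy≈1 = trans (det-scale n a (λ i j → x i * M i j * y j)) (*-congˡ (begin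
    det n (λ i j → x i * M i j * y j) ≈⟨ det-cong n (λ i j → sym (XMY i j)) ⟩
    det n (X ⊗ M ⊗ Y)                 ≈⟨ trans (det-⊗ n (X ⊗ M) Y) (*-congʳ (det-⊗ n X M)) ⟩
    det n X * det n M * det n Y       ≈⟨ solve 3 (λ p m q → p :* m :* q := p :* q :* m) refl _ _ _ ⟩
    det n X * det n Y * det n M       ≈⟨ *-congʳ (sym (det-⊗ n X Y)) ⟩
    det n (X ⊗ Y) * det n M           ≈⟨ *-congʳ (trans (det-cong n XY) (det-δ n)) ⟩
    1# * det n M                      ≈⟨ *-identityˡ _ ⟩
    det n M ∎))
    where
    X Y : Matrix n n
    X = diagonal x
    Y = diagonal y
    X⊗ : ∀ (M : Matrix n n) i j → (X ⊗ M) i j ≈ x i * M i j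
    X⊗ M i j = trans (sum-cong-≋ λ l → *-assoc (x i) (δ i l) (M l j))
      (trans (sym (*-distribˡ-sum (x i) (λ l → δ i l * M l j))) (*-congˡ (sum-δ* i (λ l → M l j))))
    XY : ∀ i j → (X ⊗ Y) i j ≈ δ i j
    XY i j = trans (X⊗ Y i j) (trans (sym (*-assoc _ _ _)) (trans (*-congʳ (xy≈1 i)) (*-identityˡ _)))
    XMY : ∀ i j → (X ⊗ M ⊗ Y) i j ≈ x i * M i j * y j
    XMY i j = trans (sum-cong-≋ λ l → trans (*-congʳ (X⊗ M i l)) (sym (*-assoc _ _ _)))
      (trans (sum-*δ (λ l → x i * M i l * y l) j) refl)

  -- Determinants of the sparse matrices that occur in the reduction.

  det-lowerToeplitz : ∀ n (L : ℤ → Carrier) → (∀ k → L -[1+ k ] ≈ 0#) →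
    det n (λ i j → L (toℕ i ⊖ toℕ j)) ≈ L (+ 0) ^ n
  det-lowerToeplitz zero    L z = refl
  det-lowerToeplitz (suc n) L z = begin
    det (suc n) (λ i j → L (toℕ i ⊖ toℕ j))
      ≈⟨ det-row-single n (λ i j → L (toℕ i ⊖ toℕ j)) zero
           (λ { zero z≢ → ⊥-elim (z≢ ≡.refl) ; (suc j) _ → z (toℕ j) }) ⟩
    1# * L (+ 0) * det n (λ i j → L (suc (toℕ i) ⊖ suc (toℕ j)))
      ≈⟨ *-cong (*-identityˡ _) (trans
           (det-cong n λ i j → reflexive (≡.cong L ([1+m]⊖[1+n]≡m⊖n (toℕ i) (toℕ j))))
           (det-lowerToeplitz n L z)) ⟩
    L (+ 0) * L (+ 0) ^ n ∎

  splitToeplitz : ℕ → (ℤ → Carrier) → (ℤ → Carrier) → (ℕ → Carrier) → ℕ → ℕ → Carrier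
  splitToeplitz p U V c i zero    = c i
  splitToeplitz p U V c i (suc j) = if j <ᵇ p then U (i ⊖ j) else V (i ⊖ j)

  -- Rows i < p are those of an upper unitriangular block, row p is (c p , 0 , … , 0), and the
  -- rows i > p are those of a lower triangular block with diagonal V 1.
  det-splitToeplitz : ∀ p r U V c → U (+ 0) ≈ 1# → (∀ k → U (+ suc k) ≈ 0#) →
    V (+ 0) ≈ 0# → (∀ k → V -[1+ k ] ≈ 0#) →
    det (suc (p ℕ.+ r)) (λ i j → splitToeplitz p U V c (toℕ i) (toℕ j))
        ≈ (- 1#) ^ p * (c p * V (+ 1) ^ r)
  det-splitToeplitz zero r U V c U0 U+ V0 V- = begin
    det (suc r) (λ i j → splitToeplitz zero U V c (toℕ i) (toℕ j))
      ≈⟨ det-row-single r (λ i j → splitToeplitz zero U V c (toℕ i) (toℕ j)) zero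
          (λ { zero z≢ → ⊥-elim (z≢ ≡.refl) ; (suc j) _ → row (toℕ j) }) ⟩
    1# * c 0 * det r (λ i j → V (suc (toℕ i) ⊖ toℕ j))
      -- Without row 0 and column 0 the matrix is Töplitz with the symbol V shifted by one, which
      -- puts `V (+ 1)` on the diagonal.
      ≈⟨ *-congˡ (trans (det-cong r λ i j → reflexive (shift (toℕ i) (toℕ j)))
                        (det-lowerToeplitz r (λ z → V (ℤ.suc z)) V-suc)) ⟩
    1# * c 0 * V (+ 1) ^ r ≈⟨ *-assoc _ _ _ ⟩
    1# * (c 0 * V (+ 1) ^ r) ∎
    where
    row : ∀ j → V (0 ⊖ j) ≈ 0#
    row zero    = V0
    row (suc j) = V- j
    V-suc : ∀ k → V (ℤ.suc -[1+ k ]) ≈ 0#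
    V-suc zero    = V0
    V-suc (suc k) = V- k
    shift : ∀ i j → V (suc i ⊖ j) ≡ V (ℤ.suc (i ⊖ j))
    shift i j = ≡.cong V (≡.sym (ℤₚ.distribʳ-⊖-+-pos 1 i j))
  det-splitToeplitz (suc p) r U V c U0 U+ V0 V- = begin
    det (suc (suc p ℕ.+ r)) M ≈⟨ sum-single term (suc zero) vanish ⟩
    term (suc zero)           ≈⟨ *-cong (*-congˡ U0)
        (det-cong (suc (p ℕ.+ r)) λ i j → reflexive (minor i j)) ⟩
    - 1# * 1# * 1# * det (suc (p ℕ.+ r)) (λ i j → splitToeplitz p U V (c ∘ suc) (toℕ i) (toℕ j))
      ≈⟨ *-cong (trans (*-identityʳ _) (*-identityʳ _))
          (det-splitToeplitz p r U V (c ∘ suc) U0 U+ V0 V-) ⟩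
    - 1# * ((- 1#) ^ p * (c (suc p) * V (+ 1) ^ r)) ≈⟨ sym (*-assoc _ _ _) ⟩
    (- 1#) ^ suc p * (c (suc p) * V (+ 1) ^ r) ∎
    where
    n : ℕ
    n = suc (p ℕ.+ r)
    M : Matrix (suc n) (suc n)
    M i j = splitToeplitz (suc p) U V c (toℕ i) (toℕ j)
    term : Fin (suc n) → Carrier
    term k = (- 1#) ^ toℕ k * M zero k * det n (λ i j → M (suc i) (punchIn k j))
    -- Column 1 lists U at 0, 1, 2, ..., so it is zero below the first row, and every minor that
    -- keeps it vanishes.
    vanish : ∀ k → k ≢ suc zero → term k ≈ 0#
    vanish zero          k≢ = trans
        (*-congˡ (det-zero-column n (λ i j → M (suc i) (suc j)) zero λ i → U+ (toℕ i))) (zeroʳ _)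
    vanish (suc zero)    k≢ = ⊥-elim (k≢ ≡.refl)
    vanish (suc (suc k)) k≢ =
      trans (*-congˡ (det-zero-column n (λ i j → M (suc i) (punchIn (suc (suc k)) j)) (position k) λ i →
        trans (reflexive (≡.cong (splitToeplitz (suc p) U V c (suc (toℕ i))) (at k))) (U+ (toℕ i))))
            (zeroʳ _)
      where
      position : ∀ {m} → Fin m → Fin (suc m)
      position zero    = suc zero
      position (suc _) = suc zero
      at : ∀ {m} (k : Fin m) → toℕ (punchIn (suc (suc k)) (position k)) ≡ 1
      at zero    = ≡.refl
      at (suc _) = ≡.refl
    minor : ∀ i j → M (suc i) (punchIn (suc zero) j) ≡ splitToeplitz p U V (c ∘ suc) (toℕ i) (toℕ j)
    minor i zero    = ≡.refl
    minor i (suc j) = ≡.cong₂ (if toℕ j <ᵇ p then_else_)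
      (≡.cong U ([1+m]⊖[1+n]≡m⊖n (toℕ i) (toℕ j))) (≡.cong V ([1+m]⊖[1+n]≡m⊖n (toℕ i) (toℕ j)))

  -- While m > 0, the first row has only the entry -1 in column 1, and the Laplace sign there is -1
  -- too, so each expansion contributes 1. What is left at the end is the 1 of column 0.
  det-cyclicLower : ∀ m (X : ℕ → ℕ → Carrier) →
    (∀ l → l ℕ.< m → X l 0 ≈ 0#) → X m 0 ≈ 1# →
    (∀ k → X k (suc k) ≈ - 1#) → (∀ l k → l ℕ.< k → X l (suc k) ≈ 0#) →
    det (suc m) (λ i j → X (toℕ i) (toℕ j)) ≈ 1#
  det-cyclicLower zero X z₀ e₀ e z =
      trans (+-identityʳ _) (trans (*-identityʳ _) (trans (*-identityˡ _) e₀))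
  det-cyclicLower (suc m) X z₀ e₀ e z = begin
    det (suc (suc m)) (λ i j → X (toℕ i) (toℕ j))
      ≈⟨ det-row-single (suc m) (λ i j → X (toℕ i) (toℕ j)) (suc zero)
          (λ { zero _ → z₀ 0 (ℕ.s≤s ℕ.z≤n) ; (suc zero) z≢ → ⊥-elim (z≢ ≡.refl)
           ; (suc (suc j)) _ → z 0 (suc (toℕ j)) (ℕ.s≤s ℕ.z≤n) }) ⟩
    - 1# * 1# * X 0 1 * det (suc m) (λ i j → X (suc (toℕ i)) (toℕ (punchIn (suc zero) j)))
      ≈⟨ *-cong (*-cong (*-identityʳ _) (e 0)) (det-cong (suc m) λ i j → reflexive (minor i j)) ⟩
    - 1# * - 1# * det (suc m) (λ i j → X′ (toℕ i) (toℕ j))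
      ≈⟨ *-cong (trans (-1*x≈-x (- 1#)) (-‿involutive 1#))
                (det-cyclicLower m X′ (λ l l<m → z₀ (suc l) (ℕ.s≤s l<m)) e₀
                   (λ k → e (suc k)) (λ l k l<k → z (suc l) (suc k) (ℕ.s≤s l<k))) ⟩
    1# * 1# ≈⟨ *-identityˡ 1# ⟩
    1# ∎
    where
    X′ : ℕ → ℕ → Carrier
    X′ l zero    = X (suc l) 0
    X′ l (suc k) = X (suc l) (suc (suc k))
    minor : ∀ (i j : Fin (suc m)) → X (suc (toℕ i)) (toℕ (punchIn (suc zero) j)) ≡ X′ (toℕ i) (toℕ j)
    minor i zero    = ≡.refl
    minor i (suc j) = ≡.refl

-- Formal power series as coefficient sequences.

module PowerSeries {c ℓ} (R : CommutativeRing c ℓ) where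
  open CommutativeRing R hiding (zero)
  open Narayana R using (_^_)
  open SemiringExp commutativeSemiring using (^-distrib-*; ^-congˡ)
  open SemiringSolver commutativeSemiring using (solve; _:+_; _:*_; _:=_; con)
  open SetoidReasoning setoid

  Series : Set c
  Series = ℕ → Carrier

  infix 4 _≋_
  _≋_ : Series → Series → Set ℓ
  a ≋ b = ∀ k → a k ≈ b k

  infixl 6 _⊕_
  _⊕_ : Series → Series → Series
  (a ⊕ b) k = a k + b k

  constant : Carrier → Series
  constant x zero    = x
  constant x (suc k) = 0#

  infixl 7 _⊛_
  _⊛_ : Series → Series → Series
  (a ⊛ b) zero    = a 0 * b 0
  (a ⊛ b) (suc k) = a 0 * b (suc k) + ((a ∘ suc) ⊛ b) k

  infix 4 _≈[_]_
  -- Congruence modulo x^m. Functional equations are solved by induction on the precision m.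
  _≈[_]_ : Series → ℕ → Series → Set ℓ
  a ≈[ m ] b = ∀ k → k ℕ.< m → a k ≈ b k

  ⊛-cong-mod : ∀ {m a a′ b b′} → a ≈[ m ] a′ → b ≈[ m ] b′ → a ⊛ b ≈[ m ] a′ ⊛ b′
  ⊛-cong-mod p q zero    k<m = *-cong (p 0 k<m) (q 0 k<m)
  ⊛-cong-mod {suc m} p q (suc k) (s≤s k<m) = +-cong (*-cong (p 0 (s≤s z≤n)) (q (suc k) (s≤s k<m)))
    (⊛-cong-mod {m} (λ i i<m → p (suc i) (s≤s i<m)) (λ i i<m → q i (ℕₚ.m≤n⇒m≤1+n i<m)) k k<m)

  ⊛-cong : ∀ {a a′ b b′} → a ≋ a′ → b ≋ b′ → a ⊛ b ≋ a′ ⊛ b′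
  ⊛-cong p q k = ⊛-cong-mod (λ i _ → p i) (λ i _ → q i) k (ℕₚ.n<1+n k)

  ⊛-zeroˡ : ∀ a → (λ _ → 0#) ⊛ a ≋ (λ _ → 0#)
  ⊛-zeroˡ a zero    = zeroˡ _
  ⊛-zeroˡ a (suc k) = trans (+-cong (zeroˡ _) (⊛-zeroˡ a k)) (+-identityʳ 0#)

  ⊛-distribʳ : ∀ c a b → (a ⊕ b) ⊛ c ≋ (a ⊛ c) ⊕ (b ⊛ c)
  ⊛-distribʳ c a b zero    = distribʳ _ _ _
  ⊛-distribʳ c a b (suc k) = trans (+-congˡ (⊛-distribʳ c (a ∘ suc) (b ∘ suc) k))
    (solve 5 (λ a b c x y → (a :+ b) :* c :+ (x :+ y) := (a :* c :+ x) :+ (b :* c :+ y)) refl _ _ _ _ _)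

  scale-⊛ : ∀ x a b → (λ k → x * a k) ⊛ b ≋ (λ k → x * (a ⊛ b) k)
  scale-⊛ x a b zero    = *-assoc _ _ _
  scale-⊛ x a b (suc k) = trans (+-cong (*-assoc _ _ _) (scale-⊛ x (a ∘ suc) b k))
      (sym (distribˡ _ _ _))

  constant-⊛ : ∀ x a → constant x ⊛ a ≋ (λ k → x * a k)
  constant-⊛ x a zero    = refl
  constant-⊛ x a (suc k) = trans (+-congˡ (⊛-zeroˡ a k)) (+-identityʳ _)

  ⊛-sucʳ : ∀ a b k → (a ⊛ b) (suc k) ≈ a (suc k) * b 0 + (a ⊛ (b ∘ suc)) k
  ⊛-sucʳ a b zero    = +-comm _ _
  ⊛-sucʳ a b (suc k) = trans (+-congˡ (⊛-sucʳ (a ∘ suc) b k))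
    (solve 3 (λ x y z → x :+ (y :+ z) := y :+ (x :+ z)) refl _ _ _)

  ⊛-comm : ∀ a b → a ⊛ b ≋ b ⊛ a
  ⊛-comm a b zero    = *-comm _ _
  ⊛-comm a b (suc k) = trans (+-cong (*-comm _ _) (⊛-comm (a ∘ suc) b k)) (sym (⊛-sucʳ b a k))

  ⊛-assoc : ∀ a b c → (a ⊛ b) ⊛ c ≋ a ⊛ (b ⊛ c)
  ⊛-assoc a b c zero    = *-assoc _ _ _
  ⊛-assoc a b c (suc k) = begin
    a 0 * b 0 * c (suc k) + (((λ i → a 0 * b (suc i)) ⊕ ((a ∘ suc) ⊛ b)) ⊛ c) k
      ≈⟨ +-congˡ (trans (⊛-distribʳ c (λ i → a 0 * b (suc i)) ((a ∘ suc) ⊛ b) k)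
           (+-cong (scale-⊛ (a 0) (b ∘ suc) c k) (⊛-assoc (a ∘ suc) b c k))) ⟩
    a 0 * b 0 * c (suc k) + (a 0 * ((b ∘ suc) ⊛ c) k + ((a ∘ suc) ⊛ (b ⊛ c)) k)
      ≈⟨ solve 5 (λ a b c x y → a :* b :* c :+ (a :* x :+ y) := a :* (b :* c :+ x) :+ y) refl _ _ _ _
          _ ⟩
    (a ⊛ (b ⊛ c)) (suc k) ∎

  -- Enough structure for the semiring solver. Identities of series are accordingly written without
  -- subtraction, and common terms are removed coefficientwise by `+-cancelʳ`.
  seriesSemiring : CommutativeSemiring c ℓ
  seriesSemiring = record
    { Carrier = Series
    ; _≈_ = _≋_
    ; _+_ = _⊕_
    ; _*_ = _⊛_
    ; 0# = λ _ → 0#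
    ; 1# = constant 1#
    ; isCommutativeSemiring = isCommutativeSemiringˡ record
      { +-isCommutativeMonoid = record
        { isMonoid = record
          { isSemigroup = record
            { isMagma = record
              { isEquivalence = ≋-isEquivalence
              ; ∙-cong = λ p q k → +-cong (p k) (q k) }
            ; assoc = λ a b c k → +-assoc _ _ _ }
          ; identity = (λ a k → +-identityˡ _) , (λ a k → +-identityʳ _) }
        ; comm = λ a b k → +-comm _ _ }
      ; *-isCommutativeMonoid = record
        { isMonoid = record
          { isSemigroup = record
            { isMagma = record
              { isEquivalence = ≋-isEquivalence
              ; ∙-cong = ⊛-cong }
            ; assoc = ⊛-assoc }
          ; identity = ⊛-identityˡ , λ a k → trans (⊛-comm a (constant 1#) k) (⊛-identityˡ a k) }
        ; comm = ⊛-comm }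
      ; distribʳ = ⊛-distribʳ
      ; zeroˡ = ⊛-zeroˡ
      }
    }
    where
    ≋-isEquivalence : IsEquivalence _≋_
    ≋-isEquivalence = record
      { refl = λ k → refl ; sym = λ p k → sym (p k) ; trans = λ p q k → trans (p k) (q k) }
    ⊛-identityˡ : ∀ a → constant 1# ⊛ a ≋ a
    ⊛-identityˡ a k = trans (constant-⊛ 1# a k) (*-identityˡ _)

  var : Series
  var zero          = 0#
  var (suc zero)    = 1#
  var (suc (suc _)) = 0#

  var-⊛-suc : ∀ a k → (var ⊛ a) (suc k) ≈ a k
  var-⊛-suc a k = trans (+-cong (zeroˡ _) (⊛-cong one (λ _ → refl) k))
    (trans (+-identityˡ _) (trans (constant-⊛ 1# a k) (*-identityˡ _)))
    where
    one : var ∘ suc ≋ constant 1#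
    one zero    = refl
    one (suc k) = refl

  -- A factor x gains one degree of precision; this drives the inductions on m.
  var-⊛-mod : ∀ {m a b} → a ≈[ m ] b → var ⊛ a ≈[ suc m ] var ⊛ b
  var-⊛-mod {a = a} {b} p zero    _         = trans (zeroˡ _) (sym (zeroˡ _))
  var-⊛-mod {a = a} {b} p (suc k) (s≤s k<m) =
      trans (var-⊛-suc a k) (trans (p k k<m) (sym (var-⊛-suc b k)))

  -- The substitution a(x) ↦ a(yx).
  dilate : Carrier → Series → Series
  dilate y a k = y ^ k * a k

  dilate-⊛ : ∀ y a b → dilate y (a ⊛ b) ≋ dilate y a ⊛ dilate y b
  dilate-⊛ y a b zero    = solve 2 (λ a b → con 1 :* (a :* b) := (con 1 :* a) :* (con 1 :* b)) refl _ _
  dilate-⊛ y a b (suc k) = begin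
    y * y ^ k * (a 0 * b (suc k) + ((a ∘ suc) ⊛ b) k)
      ≈⟨ solve 5 (λ y p a b x → y :* p :* (a :* b :+ x)
          := (con 1 :* a) :* (y :* p :* b) :+ y :* (p :* x))
           refl _ _ _ _ _ ⟩
    1# * a 0 * (y * y ^ k * b (suc k)) + y * (y ^ k * ((a ∘ suc) ⊛ b) k)
      ≈⟨ +-congˡ (trans (*-congˡ (dilate-⊛ y (a ∘ suc) b k))
           (trans (sym (scale-⊛ y (dilate y (a ∘ suc)) (dilate y b) k))
                  (⊛-cong (λ i → sym (*-assoc y (y ^ i) (a (suc i)))) (λ _ → refl) k))) ⟩
    (dilate y a ⊛ dilate y b) (suc k) ∎

  dilate-⊕ : ∀ y a b → dilate y (a ⊕ b) ≋ dilate y a ⊕ dilate y b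
  dilate-⊕ y a b k = distribˡ _ _ _

  dilate-constant : ∀ y x → dilate y (constant x) ≋ constant x
  dilate-constant y x zero    = *-identityˡ x
  dilate-constant y x (suc k) = zeroʳ _

  dilate-var : ∀ y → dilate y var ≋ constant y ⊛ var
  dilate-var y k = sym (trans (constant-⊛ y var k) (go k))
    where
    go : ∀ k → y * var k ≈ y ^ k * var k
    go zero          = trans (zeroʳ _) (sym (zeroʳ _))
    go (suc zero)    = *-congʳ (sym (*-identityʳ y))
    go (suc (suc k)) = trans (zeroʳ _) (sym (zeroʳ _))

  dilate-dilate : ∀ x y a → dilate x (dilate y a) ≋ dilate (x * y) a
  dilate-dilate x y a k = trans (sym (*-assoc _ _ _)) (*-congʳ (sym (^-distrib-* x y k)))

  dilate-cong : ∀ {x y} {a b} → x ≈ y → a ≋ b → dilate x a ≋ dilate y b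
  dilate-cong p q k = *-cong (^-congˡ k p) (q k)

  dilate-mod : ∀ {m} y {a b} → a ≈[ m ] b → dilate y a ≈[ m ] dilate y b
  dilate-mod y p k k<m = *-congˡ (p k k<m)

-- The area by recursion on the path, without division.

-- The area plus half the starting height. The correction makes the share of each step integral:
-- (2h+1)/2 becomes h for a step up from h and h + 1 for a step down to h.
halfArea : ∀ {n h} → Path n h → ℕ
halfArea done              = 0
halfArea (up {h = h} p)    = h ℕ.+ halfArea p
halfArea (down {h = h} p)  = suc h ℕ.+ halfArea p
halfArea (level {h = h} p) = (h ℕ.+ h) ℕ.+ halfArea p

halfArea*2 : ∀ {n h} (p : Path n h) → halfArea p ℕ.* 2 ≡ twiceArea p ℕ.+ h
halfArea*2 done = ≡.refl
halfArea*2 (up {h = h} p) = begin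
  (h ℕ.+ halfArea p) ℕ.* 2
      ≡⟨ solve 2 (λ h a → (h :+ a) :* con 2 := a :* con 2 :+ (h :+ h)) ≡.refl h (halfArea p) ⟩
  halfArea p ℕ.* 2 ℕ.+ (h ℕ.+ h)    ≡⟨ ≡.cong (ℕ._+ (h ℕ.+ h)) (halfArea*2 p) ⟩
  twiceArea p ℕ.+ suc h ℕ.+ (h ℕ.+ h)
    ≡⟨ solve 2 (λ h a → a :+ (con 1 :+ h) :+ (h :+ h) := h :+ (con 1 :+ h) :+ a :+ h) ≡.refl h
        (twiceArea p) ⟩
  h ℕ.+ suc h ℕ.+ twiceArea p ℕ.+ h ∎
  where open +-*-Solver
        open ≡.≡-Reasoning
halfArea*2 (down {h = h} p) = begin
  (suc h ℕ.+ halfArea p) ℕ.* 2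
      ≡⟨ solve 2 (λ h a → (con 1 :+ h :+ a) :* con 2 := a :* con 2 :+ (con 2 :+ h :+ h)) ≡.refl h
      (halfArea p) ⟩
  halfArea p ℕ.* 2 ℕ.+ (2 ℕ.+ h ℕ.+ h) ≡⟨ ≡.cong (ℕ._+ (2 ℕ.+ h ℕ.+ h)) (halfArea*2 p) ⟩
  twiceArea p ℕ.+ h ℕ.+ (2 ℕ.+ h ℕ.+ h)
    ≡⟨ solve 2 (λ h a → a :+ h :+ (con 2 :+ h :+ h) := con 1 :+ h :+ h :+ a :+ (con 1 :+ h)) ≡.refl h
        (twiceArea p) ⟩
  suc h ℕ.+ h ℕ.+ twiceArea p ℕ.+ suc h ∎
  where open +-*-Solver
        open ≡.≡-Reasoning
halfArea*2 (level {h = h} p) = begin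
  (h ℕ.+ h ℕ.+ halfArea p) ℕ.* 2
      ≡⟨ solve 2 (λ h a → (h :+ h :+ a) :* con 2 := a :* con 2 :+ con 4 :* h) ≡.refl h (halfArea p) ⟩
  halfArea p ℕ.* 2 ℕ.+ 4 ℕ.* h      ≡⟨ ≡.cong (ℕ._+ 4 ℕ.* h) (halfArea*2 p) ⟩
  twiceArea p ℕ.+ h ℕ.+ 4 ℕ.* h
    ≡⟨ solve 2 (λ h a → a :+ h :+ con 4 :* h := con 4 :* h :+ a :+ h) ≡.refl h (twiceArea p) ⟩
  4 ℕ.* h ℕ.+ twiceArea p ℕ.+ h ∎
  where open +-*-Solver
        open ≡.≡-Reasoning

area≡halfArea : ∀ {n} (p : Path n 0) → area p ≡ halfArea p
area≡halfArea p = ≡.trans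
  (≡.cong (ℕ._/ 2) (≡.trans (≡.sym (ℕₚ.+-identityʳ (twiceArea p))) (≡.sym (halfArea*2 p))))
  (m*n/n≡m (halfArea p) 2)

-- Generating functions of paths from height h, by their first step.

module PathSeries {c ℓ} (R : CommutativeRing c ℓ) where
  open import Data.List using (List; []; _∷_; _++_; map; foldr)
  open CommutativeRing R hiding (zero)
  open Narayana R
  open PowerSeries R
  open SemiringExp commutativeSemiring using (^-homo-*)
  open SemiringSolver commutativeSemiring using (solve; _:+_; _:*_; _:=_; con)

  sumOver : ∀ {a} {A : Set a} → (A → Carrier) → List A → Carrier
  sumOver f xs = foldr _+_ 0# (map f xs)

  sumOver-++ : ∀ {a} {A : Set a} (f : A → Carrier) xs ys → sumOver f (xs ++ ys)
      ≈ sumOver f xs + sumOver f ys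
  sumOver-++ f []       ys = sym (+-identityˡ _)
  sumOver-++ f (x ∷ xs) ys = trans (+-congˡ (sumOver-++ f xs ys)) (sym (+-assoc _ _ _))

  sumOver-map : ∀ {a b} {A : Set a} {B : Set b} (f : B → Carrier) (g : A → B) (h : A → Carrier) x →
    (∀ a → f (g a) ≈ x * h a) → ∀ xs → sumOver f (map g xs) ≈ x * sumOver h xs
  sumOver-map f g h x e []       = sym (zeroʳ x)
  sumOver-map f g h x e (y ∷ ys) =
      trans (+-cong (e y) (sumOver-map f g h x e ys)) (sym (distribˡ _ _ _))

  sumOver-cong : ∀ {a} {A : Set a} {f g : A → Carrier} → (∀ x → f x ≈ g x) → ∀ xs → sumOver f xs
      ≈ sumOver g xs
  sumOver-cong e []       = refl
  sumOver-cong e (x ∷ xs) = +-cong (e x) (sumOver-cong e xs)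

  module _ (t q : Carrier) where

    pathWeight : ∀ {n h} → Path n h → Carrier
    pathWeight p = t ^ levels p * q ^ halfArea p

    pathSum : ℕ → ℕ → Carrier
    pathSum n h = sumOver pathWeight (paths n h)

    downSum levelSum : ℕ → ℕ → Carrier
    downSum n h  = sumOver pathWeight (downPaths n h)
    levelSum n h = sumOver pathWeight (levelPaths n h)

    pathSum-suc : ∀ n h → pathSum (suc n) h
        ≈ q ^ h * pathSum n (suc h) + (downSum (suc n) h + levelSum (suc n) h)
    pathSum-suc n h = trans (sumOver-++ pathWeight (map up (paths n (suc h))) _)
      (+-cong (sumOver-map pathWeight up pathWeight (q ^ h)
                (λ p → trans (*-congˡ (^-homo-* q h (halfArea p)))
                  (solve 3 (λ a b c → a :* (b :* c) := b :* (a :* c)) refl _ _ _))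
                (paths n (suc h)))
              (sumOver-++ pathWeight (downPaths (suc n) h) (levelPaths (suc n) h)))

    downSum-suc : ∀ n h → downSum (suc n) (suc h) ≈ q ^ suc h * pathSum n h
    downSum-suc n h = sumOver-map pathWeight down pathWeight (q ^ suc h)
      (λ p → trans (*-congˡ (^-homo-* q (suc h) (halfArea p)))
        (solve 3 (λ a b c → a :* (b :* c) := b :* (a :* c)) refl _ _ _))
      (paths n h)

    levelSum-suc : ∀ n h → levelSum (suc (suc n)) h ≈ t * (q ^ h * q ^ h) * pathSum n h
    levelSum-suc n h = sumOver-map pathWeight level pathWeight (t * (q ^ h * q ^ h))
      (λ p → trans (*-congˡ (trans (^-homo-* q (h ℕ.+ h) (halfArea p)) (*-congʳ (^-homo-* q h h))))
        (solve 4 (λ t a b c → (t :* a) :* (b :* c) := t :* b :* (a :* c)) refl _ _ _ _))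
      (paths n h)

    -- A path cannot descend h levels over a shorter horizontal distance. This removes the up and
    -- level steps from the constant coefficient in `heightSeries-suc`.
    pathSum-high : ∀ n h → n ℕ.< h → pathSum n h ≈ 0#
    pathSum-high zero (suc h) n<h = refl
    pathSum-high (suc n) (suc h) (s≤s n<h) = trans (pathSum-suc n (suc h)) (trans
      (+-cong (trans (*-congˡ (pathSum-high n (suc (suc h)) (ℕₚ.m<n⇒m<1+n (ℕₚ.m<n⇒m<1+n n<h))))
          (zeroʳ _))
        (+-cong (trans (downSum-suc n h) (trans (*-congˡ (pathSum-high n h n<h)) (zeroʳ _)))
            (levels≈0 n n<h)))
      (trans (+-identityˡ _) (+-identityˡ _)))
      where
      levels≈0 : ∀ n → n ℕ.< h → levelSum (suc n) (suc h) ≈ 0#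
      levels≈0 zero    n<h = refl
      levels≈0 (suc n) n<h = trans (levelSum-suc n (suc h)) (trans
        (*-congˡ (pathSum-high n (suc h) (ℕₚ.m<n⇒m<1+n (ℕₚ.<-trans (ℕₚ.n<1+n n) n<h)))) (zeroʳ _))

    -- A path of length 2k + h from height h. The form `k + (k + h)` unfolds at `suc k` so that a
    -- first step can be split off, and for h = 0 it is `2 * k` by computation.
    heightSeries : ℕ → Series
    heightSeries h k = pathSum (k ℕ.+ (k ℕ.+ h)) h

    narayana : Series
    narayana = heightSeries 0

    private
      T Q : Series
      T = constant t
      Q = constant q

      after-level : ∀ k h → levelSum (suc (k ℕ.+ suc (k ℕ.+ h))) h
          ≈ t * (q ^ h * q ^ h) * heightSeries h k
      after-level k h = trans (reflexive (≡.cong (λ n → levelSum (suc n) h) (ℕₚ.+-suc k (k ℕ.+ h))))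
                              (levelSum-suc (k ℕ.+ (k ℕ.+ h)) h)

      after-up : ∀ k h → pathSum (k ℕ.+ suc (k ℕ.+ h)) (suc h) ≈ heightSeries (suc h) k
      after-up k h = reflexive (≡.cong (λ n → pathSum (k ℕ.+ n) (suc h)) (≡.sym (ℕₚ.+-suc k h)))

    -- In terms of the index k, a first step up or level leaves k - 1 and a step down leaves k.
    -- Hence `var` accompanies up and level steps, here and in `heightSeries-suc`.
    heightSeries-zero : narayana ≋ constant 1# ⊕ var ⊛ (heightSeries 1 ⊕ T ⊛ narayana)
    heightSeries-zero zero = solve 1
      (λ x → con 1 :* con 1 :+ con 0 := con 1 :+ con 0 :* x)
      refl ((heightSeries 1 ⊕ T ⊛ narayana) 0)
    heightSeries-zero (suc k) = begin
      pathSum (suc (k ℕ.+ suc (k ℕ.+ 0))) 0 ≈⟨ pathSum-suc (k ℕ.+ suc (k ℕ.+ 0)) 0 ⟩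
      1# * pathSum (k ℕ.+ suc (k ℕ.+ 0)) 1 + (0# + levelSum (suc (k ℕ.+ suc (k ℕ.+ 0))) 0)
        ≈⟨ +-cong (*-congˡ (after-up k 0)) (+-congˡ (after-level k 0)) ⟩
      1# * heightSeries 1 k + (0# + t * (1# * 1#) * narayana k)
        ≈⟨ solve 3 (λ a t b → con 1 :* a :+ (con 0 :+ t :* (con 1 :* con 1) :* b)
             := con 0 :+ (a :+ t :* b)) refl _ _ _ ⟩
      0# + (heightSeries 1 k + t * narayana k)
        ≈⟨ +-congˡ (trans (+-congˡ (sym (constant-⊛ t narayana k)))
            (sym (var-⊛-suc (heightSeries 1 ⊕ T ⊛ narayana) k))) ⟩
      0# + (var ⊛ (heightSeries 1 ⊕ T ⊛ narayana)) (suc k) ∎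
      where open SetoidReasoning setoid

    heightSeries-suc : ∀ h → let C = constant (q ^ suc h) in
      heightSeries (suc h) ≋ C ⊛ heightSeries h ⊕ var
          ⊛ (C ⊛ heightSeries (suc (suc h)) ⊕ T ⊛ (C ⊛ C) ⊛ heightSeries (suc h))
    heightSeries-suc h zero = begin
      pathSum (suc h) (suc h) ≈⟨ pathSum-suc h (suc h) ⟩
      q ^ suc h * pathSum h (suc (suc h)) + (downSum (suc h) (suc h) + levelSum (suc h) (suc h))
        ≈⟨ +-cong (*-congˡ (pathSum-high h (suc (suc h)) (ℕₚ.m<n⇒m<1+n (ℕₚ.n<1+n h))))
                  (+-cong (downSum-suc h h) (no-level h)) ⟩
      q ^ suc h * 0# + (q ^ suc h * pathSum h h + 0#)
        ≈⟨ solve 3 (λ c p x → c :* con 0 :+ (c :* p :+ con 0)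
             := c :* p :+ con 0 :* x) refl _ _ _ ⟩
      q ^ suc h * pathSum h h + 0# * _ ∎
      where
      open SetoidReasoning setoid
      no-level : ∀ h → levelSum (suc h) (suc h) ≈ 0#
      no-level zero    = refl
      no-level (suc h) = trans (levelSum-suc h (suc (suc h)))
        (trans (*-congˡ (pathSum-high h (suc (suc h)) (ℕₚ.m<n⇒m<1+n (ℕₚ.n<1+n h)))) (zeroʳ _))
    heightSeries-suc h (suc k) = begin
      pathSum (suc (k ℕ.+ suc (k ℕ.+ suc h))) (suc h) ≈⟨ pathSum-suc (k ℕ.+ suc (k ℕ.+ suc h)) (suc h) ⟩
      x * pathSum (k ℕ.+ suc (k ℕ.+ suc h)) (suc (suc h))
          + (downSum (suc (k ℕ.+ suc (k ℕ.+ suc h))) (suc h) + levelSum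
          (suc (k ℕ.+ suc (k ℕ.+ suc h))) (suc h))
        ≈⟨ +-cong (*-congˡ (after-up k (suc h)))
             (+-cong (trans (downSum-suc (k ℕ.+ suc (k ℕ.+ suc h)) h)
                            (*-congˡ (reflexive (≡.cong (λ n → pathSum n h)
                              (≡.trans (≡.cong (λ n → k ℕ.+ suc n) (ℕₚ.+-suc k h)) (ℕₚ.+-suc k _))))))
                     (after-level k (suc h))) ⟩
      x * heightSeries (suc (suc h)) k
          + (x * heightSeries h (suc k) + t * (x * x) * heightSeries (suc h) k)
        ≈⟨ solve 3 (λ a b c → a :+ (b :+ c) := b :+ (a :+ c)) refl _ _ _ ⟩
      x * heightSeries h (suc k) + (x * heightSeries (suc (suc h)) k + t * (x * x) * heightSeries
          (suc h) k)
        ≈⟨ sym (+-cong (constant-⊛ x (heightSeries h) (suc k))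
            (trans (var-⊛-suc (_ ⊕ T ⊛ (C ⊛ C) ⊛ heightSeries (suc h)) k)
             (+-cong (constant-⊛ x (heightSeries (suc (suc h))) k)
                     (trans (⊛-assoc T (C ⊛ C) _ k) (trans (constant-⊛ t _ k)
                       (trans (*-congˡ (trans (⊛-assoc C C _ k)
                           (trans (constant-⊛ x _ k) (*-congˡ (constant-⊛ x _ k)))))
                         (solve 3 (λ t x p → t :* (x :* (x :* p)) := t :* (x :* x) :* p) refl _ _
                             _))))))) ⟩
      (C ⊛ heightSeries h ⊕ var ⊛ (C ⊛ heightSeries (suc (suc h)) ⊕ T ⊛ (C ⊛ C) ⊛ heightSeries
          (suc h))) (suc k) ∎
      where
      open SetoidReasoning setoid
      x : Carrier
      x = q ^ suc h
      C : Series
      C = constant x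

-- Functional equations of the generating function.

module NarayanaSeries {c ℓ} (R : CommutativeRing c ℓ) where
  open CommutativeRing R hiding (zero)
  open Narayana R
  open PowerSeries R
  open PathSeries R
  open RingProperties ring using (+-cancelʳ)
  private
    module S = CommutativeSemiring seriesSemiring
  open SemiringSolver seriesSemiring using (solve; _:+_; _:*_; _:=_; con)

  modSetoid : ℕ → Setoid c ℓ
  modSetoid m = record
    { Carrier = Series
    ; _≈_ = λ a b → a ≈[ m ] b
    ; isEquivalence = record
      { refl = λ k _ → refl
      ; sym = λ p k k<m → sym (p k k<m)
      ; trans = λ p q k k<m → trans (p k k<m) (q k k<m)
      }
    }

  ⇒mod : ∀ {m a b} → a ≋ b → a ≈[ m ] b
  ⇒mod e k _ = e k

  ⊕-mod : ∀ {m a a′ b b′} → a ≈[ m ] a′ → b ≈[ m ] b′ → a ⊕ b ≈[ m ] a′ ⊕ b′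
  ⊕-mod p q k k<m = +-cong (p k k<m) (q k k<m)

  ⊛-modˡ : ∀ {m} a {b b′} → b ≈[ m ] b′ → a ⊛ b ≈[ m ] a ⊛ b′
  ⊛-modˡ a q = ⊛-cong-mod {a = a} (λ _ _ → refl) q

  all-mod⇒ : ∀ {a b} → (∀ m → a ≈[ m ] b) → a ≋ b
  all-mod⇒ p k = p (suc k) k (ℕₚ.n<1+n k)

  constant-* : ∀ x y → constant (x * y) ≋ constant x ⊛ constant y
  constant-* x y k = sym (trans (constant-⊛ x (constant y) k) (go k))
    where
    go : ∀ k → x * constant y k ≈ constant (x * y) k
    go zero    = refl
    go (suc k) = zeroʳ x

  constant-+ : ∀ x y → constant (x + y) ≋ constant x ⊕ constant y
  constant-+ x y zero    = refl
  constant-+ x y (suc k) = sym (+-identityʳ 0#)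

  constant-cong : ∀ {x y} → x ≈ y → constant x ≋ constant y
  constant-cong e zero    = e
  constant-cong e (suc k) = refl

  -- First-passage decomposition: cut a path from height h + 1 at its first visit to height h.
  heightSeries-factor : ∀ t q m h → heightSeries t q (suc h) ≈[ m ]
    constant (q ^ suc h) ⊛ (dilate (q ^ suc h * q ^ suc h) (narayana t q) ⊛ heightSeries t q h)
  heightSeries-factor t q zero    h k ()
  -- Induction on the precision, for all h together: the first-step recursion multiplies the series
  -- at heights h + 2 and h + 1 by x, so their factorisation is needed only modulo x^m.
  heightSeries-factor t q (suc m) h = begin
    P (suc h)                                             ≈⟨ ⇒mod (heightSeries-suc t q h) ⟩
    C ⊛ P h ⊕ X ⊛ (C ⊛ P (suc (suc h)) ⊕ T ⊛ (C ⊛ C) ⊛ P (suc h))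
      ≈⟨ ⊕-mod {a = C ⊛ P h} (⇒mod λ _ → refl)
          (var-⊛-mod (⊕-mod (⊛-modˡ C up²) (⊛-modˡ (T ⊛ (C ⊛ C)) (heightSeries-factor t q m h)))) ⟩
    C ⊛ P h ⊕ X ⊛ (C ⊛ (Q ⊛ C ⊛ (D′ ⊛ (C ⊛ (D ⊛ P h)))) ⊕ T ⊛ (C ⊛ C) ⊛ (C ⊛ (D ⊛ P h)))
      ≈⟨ ⇒mod (solve 7 (λ x t q c s s′ p →
           c :* p :+ x :* (c :* (q :* c :* (s′ :* (c :* (s :* p)))) :+ t :* (c :* c) :* (c :* (s :* p)))
           := c :* ((con 1 :+ c :* c :* x :* (q :* (s′ :* s) :+ t :* s)) :* p))
           (λ _ → refl) X T Q C D D′ (P h)) ⟩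
    C ⊛ ((constant 1# ⊕ C ⊛ C ⊛ X ⊛ (Q ⊛ (D′ ⊛ D) ⊕ T ⊛ D)) ⊛ P h)
      ≈⟨ ⊛-modˡ C (⊛-cong-mod {b = P h} (λ k k<m → sym (D-expand k k<m)) (⇒mod λ _ → refl)) ⟩
    C ⊛ (D ⊛ P h) ∎
    where
    open SetoidReasoning (modSetoid (suc m))
    P : ℕ → Series
    P = heightSeries t q
    x y : Carrier
    x = q ^ suc h
    y = x * x
    X T Q C D D′ : Series
    X = var
    T = constant t
    Q = constant q
    C = constant x
    D = dilate y (P 0)
    D′ = dilate (q ^ suc (suc h) * q ^ suc (suc h)) (P 0)
    up² : P (suc (suc h)) ≈[ m ] Q ⊛ C ⊛ (D′ ⊛ (C ⊛ (D ⊛ P h)))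
    up² k k<m = trans (heightSeries-factor t q m (suc h) k k<m)
      (⊛-cong-mod (⇒mod (constant-* q x)) (⊛-modˡ D′ (heightSeries-factor t q m h)) k k<m)
    -- The factorisation at height 0 under x ↦ yx. Since y = q^(2(h+1)), the inner dilation by q²
    -- becomes the dilation in D′.
    P₁≈ : dilate y (P 1) ≈[ m ] Q ⊛ (D′ ⊛ D)
    P₁≈ k k<m = trans (dilate-mod y (heightSeries-factor t q m 0) k k<m) (lemma k)
      where
      lemma : dilate y (constant (q * 1#) ⊛ (dilate (q * 1# * (q * 1#)) (P 0) ⊛ P 0)) ≋ Q ⊛ (D′ ⊛ D)
      lemma = S.trans (dilate-⊛ y (constant (q * 1#)) _) (⊛-cong
        (S.trans (dilate-constant y (q * 1#)) (constant-cong (*-identityʳ q)))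
        (S.trans (dilate-⊛ y (dilate (q * 1# * (q * 1#)) (P 0)) (P 0)) (⊛-cong
          (S.trans (dilate-dilate y (q * 1# * (q * 1#)) (P 0)) (dilate-cong
            (Scalar.solve 2 (λ q x → (x Scalar.:* x)
                Scalar.:* (q Scalar.:* Scalar.con 1 Scalar.:* (q Scalar.:* Scalar.con 1))
              Scalar.:= (q Scalar.:* x) Scalar.:* (q Scalar.:* x)) refl q x) (λ _ → refl)))
          (λ _ → refl))))
        where module Scalar = SemiringSolver commutativeSemiring
    D-expand : D ≈[ suc m ] constant 1# ⊕ C ⊛ C ⊛ X ⊛ (Q ⊛ (D′ ⊛ D) ⊕ T ⊛ D)
    D-expand = begin
      D ≈⟨ ⇒mod (λ k → *-congˡ (heightSeries-zero t q k)) ⟩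
      dilate y (constant 1# ⊕ X ⊛ (P 1 ⊕ T ⊛ P 0))
        ≈⟨ ⇒mod (S.trans (dilate-⊕ y (constant 1#) _) (S.+-cong (dilate-constant y 1#)
             (S.trans (dilate-⊛ y X _) (⊛-cong
                 (S.trans (dilate-var y) (⊛-cong (constant-* x x) (λ _ → refl)))
               (S.trans (dilate-⊕ y (P 1) _) (S.+-cong (λ _ → refl)
                 (S.trans (dilate-⊛ y T (P 0)) (⊛-cong (dilate-constant y t) (λ _ → refl))))))))) ⟩
      constant 1# ⊕ C ⊛ C ⊛ X ⊛ (dilate y (P 1) ⊕ T ⊛ D)
        ≈⟨ ⊕-mod {a = constant 1#} (⇒mod λ _ → refl) (begin
             C ⊛ C ⊛ X ⊛ (dilate y (P 1) ⊕ T ⊛ D)   ≈⟨ ⇒mod (move (dilate y (P 1) ⊕ T ⊛ D)) ⟩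
             X ⊛ (C ⊛ C ⊛ (dilate y (P 1) ⊕ T ⊛ D))
               ≈⟨ var-⊛-mod (⊛-modˡ (C ⊛ C) (⊕-mod {b = T ⊛ D} P₁≈ (⇒mod λ _ → refl))) ⟩
             X ⊛ (C ⊛ C ⊛ (Q ⊛ (D′ ⊛ D) ⊕ T ⊛ D))   ≈⟨ ⇒mod (S.sym (move (Q ⊛ (D′ ⊛ D) ⊕ T ⊛ D))) ⟩
             C ⊛ C ⊛ X ⊛ (Q ⊛ (D′ ⊛ D) ⊕ T ⊛ D) ∎) ⟩
      constant 1# ⊕ C ⊛ C ⊛ X ⊛ (Q ⊛ (D′ ⊛ D) ⊕ T ⊛ D) ∎
      where
      move : ∀ a → C ⊛ C ⊛ X ⊛ a ≋ X ⊛ (C ⊛ C ⊛ a)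
      move a = solve 3 (λ c x a → c :* c :* x :* a := x :* (c :* c :* a)) (λ _ → refl) C X a

  narayana-functional : ∀ t q → let f = narayana t q in
    f ≋ constant 1# ⊕ var ⊛ (constant t ⊛ f ⊕ constant q ⊛ (dilate (q * q) f ⊛ f))
  narayana-functional t q = S.trans (heightSeries-zero t q) (S.+-cong (λ _ → refl) (⊛-cong (λ _ → refl)
    (S.trans (S.+-comm (heightSeries t q 1) _) (S.+-cong (λ _ → refl) (S.trans
      (all-mod⇒ (λ m → heightSeries-factor t q m 0))
      (⊛-cong (constant-cong (*-identityʳ q)) (⊛-cong
        (dilate-cong (*-cong (*-identityʳ q) (*-identityʳ q)) (λ _ → refl)) (λ _ → refl))))))))

  -- The second parameter is tied to the first by an equation instead of being defined as t q⁻², so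
  -- that the results can also be read with q⁻¹ for q and the two parameters exchanged.
  module _ {t t′ q : Carrier} (t≈q²t′ : t ≈ q * q * t′) where
    private
      y : Carrier
      y = q * q
      f f′ f₁ h h₁ X T Q Y Z B : Series
      f = narayana t q
      f′ = narayana t′ q
      f₁ = dilate y f
      h = dilate y f′
      h₁ = dilate y h
      X = var
      T = constant t
      Q = constant q
      Y = constant y
      Z = (T ⊕ Q ⊛ f₁) ⊛ f
      B = T ⊕ Q ⊛ f

      f-functional : f ≋ constant 1# ⊕ X ⊛ Z
      f-functional = S.trans (narayana-functional t q) (S.+-cong (λ _ → refl) (⊛-cong (λ _ → refl)
        (solve 4 (λ t f q f₁ → t :* f :+ q :* (f₁ :* f) := (t :+ q :* f₁) :* f) (λ _ → refl) T f Q f₁)))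

      h-functional : h ≋ constant 1# ⊕ X ⊛ (T ⊕ Y ⊛ Q ⊛ h₁) ⊛ h
      h-functional = S.trans (λ k → *-congˡ (narayana-functional t′ q k))
        (S.trans (dilate-⊕ y (constant 1#) _) (S.+-cong (dilate-constant y 1#)
          (S.trans (dilate-⊛ y X _) (S.trans (⊛-cong (dilate-var y)
            (S.trans (dilate-⊕ y (constant t′ ⊛ f′) _) (S.+-cong
              (S.trans (dilate-⊛ y (constant t′) f′) (⊛-cong (dilate-constant y t′) (λ _ → refl)))
              (S.trans (dilate-⊛ y Q _) (⊛-cong (dilate-constant y q) (dilate-⊛ y (dilate y f′) f′))))))
          (S.trans (solve 6 (λ y x t′ h q h₁ → y :* x :* (t′ :* h :+ q :* (h₁ :* h))
              := x :* (y :* t′ :+ y :* q :* h₁) :* h)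
                     (λ _ → refl) Y X (constant t′) h Q h₁)
            (⊛-cong (⊛-cong {X} (λ _ → refl)
                (S.+-cong (S.trans (S.sym (constant-* y t′)) (constant-cong (sym t≈q²t′)))
                (λ _ → refl)))
                    (λ _ → refl)))))))

      -- The contiguous relation under x ↦ q²x, which turns B into T ⊕ Q ⊛ f₁.
      shifted : ∀ {m} → f ≈[ m ] constant 1# ⊕ X ⊛ (B ⊛ h) →
          f₁ ≈[ m ] constant 1# ⊕ Y ⊛ X ⊛ ((T ⊕ Q ⊛ f₁) ⊛ h₁)
      shifted p k k<m = trans (dilate-mod y p k k<m) (lemma k)
        where
        lemma : dilate y (constant 1# ⊕ X ⊛ (B ⊛ h)) ≋ constant 1# ⊕ Y ⊛ X ⊛ ((T ⊕ Q ⊛ f₁) ⊛ h₁)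
        lemma = S.trans (dilate-⊕ y (constant 1#) _) (S.+-cong (dilate-constant y 1#)
          (S.trans (dilate-⊛ y X _) (⊛-cong (dilate-var y) (S.trans (dilate-⊛ y B h) (⊛-cong
            (S.trans (dilate-⊕ y T _) (S.+-cong (dilate-constant y t)
              (S.trans (dilate-⊛ y Q f) (⊛-cong (dilate-constant y q) (λ _ → refl)))))
            (λ _ → refl))))))

      -- As f = 1 + x Z, the claim is Z = B h one degree lower. Inserting the dilated claim, known
      -- to that degree, into Z gives Z = B + G Z, while the functional equation of h reads h = 1 +
      -- G h with the same G.
      contiguous-mod : ∀ m → f ≈[ m ] constant 1# ⊕ X ⊛ (B ⊛ h)
      contiguous-mod zero    k ()
      contiguous-mod (suc m) = begin
        f                            ≈⟨ ⇒mod f-functional ⟩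
        constant 1# ⊕ X ⊛ Z          ≈⟨ ⊕-mod {a = constant 1#} (λ _ _ → refl) (var-⊛-mod Z≈Bh) ⟩
        constant 1# ⊕ X ⊛ (B ⊛ h) ∎
        where
        open SetoidReasoning (modSetoid (suc m))
        G : Series
        G = X ⊛ (T ⊕ Y ⊛ Q ⊛ h₁)
        Z≈ : Z ≈[ m ] B ⊕ G ⊛ Z
        Z≈ = M.begin
          (T ⊕ Q ⊛ f₁) ⊛ f
            M.≈⟨ ⊛-cong-mod {b = f} (⊕-mod {a = T} (λ _ _ → refl)
                (⊛-modˡ Q (shifted (contiguous-mod m)))) (λ _ _ → refl) ⟩
          (T ⊕ Q ⊛ (constant 1# ⊕ Y ⊛ X ⊛ ((T ⊕ Q ⊛ f₁) ⊛ h₁))) ⊛ f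
            M.≈⟨ ⇒mod (solve 7 (λ t q y x f f₁ h₁ →
                 (t :+ q :* (con 1 :+ y :* x :* ((t :+ q :* f₁) :* h₁))) :* f
                 := t :* f :+ (q :* f :+ x :* (y :* q :* h₁) :* ((t :+ q :* f₁) :* f))) (λ _ → refl)
                     T Q Y X f f₁ h₁) ⟩
          T ⊛ f ⊕ (Q ⊛ f ⊕ X ⊛ (Y ⊛ Q ⊛ h₁) ⊛ Z)
            M.≈⟨ ⇒mod (S.+-cong (⊛-cong (λ _ → refl) f-functional) (λ _ → refl)) ⟩
          T ⊛ (constant 1# ⊕ X ⊛ Z) ⊕ (Q ⊛ f ⊕ X ⊛ (Y ⊛ Q ⊛ h₁) ⊛ Z)
            M.≈⟨ ⇒mod (solve 5 (λ t x z qf w → t :* (con 1 :+ x :* z) :+ (qf :+ x :* w :* z)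
                 := t :+ qf :+ x :* (t :+ w) :* z) (λ _ → refl) T X Z (Q ⊛ f) (Y ⊛ Q ⊛ h₁)) ⟩
          B ⊕ G ⊛ Z M.∎
          where module M = SetoidReasoning (modSetoid m)
        Z≈Bh : Z ≈[ m ] B ⊛ h
        Z≈Bh k k<m = +-cancelʳ ((G ⊛ h ⊛ Z) k) _ _ (balance k k<m)
          where
          -- Both sides equal h Z. Evaluating it by the two fixed-point equations replaces a
          -- division by 1 - G.
          balance : Z ⊕ G ⊛ h ⊛ Z ≈[ m ] B ⊛ h ⊕ G ⊛ h ⊛ Z
          balance = M.begin
            Z ⊕ G ⊛ h ⊛ Z  M.≈⟨ ⇒mod (solve 3 (λ z g h → z :+ g :* h :* z := (con 1 :+ g :* h) :* z)
                (λ _ → refl) Z G h) ⟩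
            (constant 1# ⊕ G ⊛ h) ⊛ Z M.≈⟨ ⇒mod (⊛-cong (S.sym h-functional) (λ _ → refl)) ⟩
            h ⊛ Z M.≈⟨ ⊛-modˡ h Z≈ ⟩
            h ⊛ (B ⊕ G ⊛ Z) M.≈⟨ ⇒mod (solve 4
                (λ h b g z → h :* (b :+ g :* z) := b :* h :+ g :* h :* z) (λ _ → refl) h B G Z) ⟩
            B ⊛ h ⊕ G ⊛ h ⊛ Z M.∎
            where module M = SetoidReasoning (modSetoid m)

    contiguous : narayana t q ≋
      constant 1# ⊕ var ⊛ ((constant t ⊕ constant q ⊛ narayana t q) ⊛ dilate (q * q) (narayana t′ q))
    contiguous = all-mod⇒ contiguous-mod

    -- From f = 1 + x Z and Z = (t+q) f + w Z, where the second equation comes from inserting the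
    -- dilated contiguous relation into Z. Read with subtraction: f - 1 = (t+q) x f + w (f - 1).
    narayana-positive : let f = narayana t q
                            w = var ⊛ (constant (q * q * q) ⊛ dilate (q * q * (q * q))
                                (narayana t′ q)) in
      f ⊕ w ≋ constant 1# ⊕ constant (t + q) ⊛ (var ⊛ f) ⊕ w ⊛ f
    narayana-positive = begin
      f ⊕ w                                             ≈⟨ S.+-cong f-functional (λ _ → refl) ⟩
      constant 1# ⊕ X ⊛ Z ⊕ w
          ≈⟨ S.+-cong (S.+-cong (λ _ → refl) (⊛-cong (λ _ → refl) Z≈)) (λ _ → refl) ⟩
      constant 1# ⊕ X ⊛ (U ⊛ f ⊕ w ⊛ Z) ⊕ w
        ≈⟨ solve 5 (λ x u f w z → con 1 :+ x :* (u :* f :+ w :* z) :+ w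
            := con 1 :+ u :* (x :* f) :+ w :* (con 1 :+ x :* z))
             (λ _ → refl) X U f w Z ⟩
      constant 1# ⊕ U ⊛ (X ⊛ f) ⊕ w ⊛ (constant 1# ⊕ X ⊛ Z)
        ≈⟨ S.+-cong (λ _ → refl) (⊛-cong (λ _ → refl) (S.sym f-functional)) ⟩
      constant 1# ⊕ U ⊛ (X ⊛ f) ⊕ w ⊛ f ∎
      where
      open SetoidReasoning S.setoid
      U w : Series
      U = constant (t + q)
      w = X ⊛ (constant (q * q * q) ⊛ dilate (q * q * (q * q)) f′)
      w≈ : w ≋ X ⊛ (Y ⊛ Q ⊛ h₁)
      w≈ = ⊛-cong (λ _ → refl) (⊛-cong (constant-* y q) (S.sym (dilate-dilate y y f′)))
      Z≈ : Z ≋ U ⊛ f ⊕ w ⊛ Z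
      Z≈ = begin
        (T ⊕ Q ⊛ f₁) ⊛ f ≈⟨ ⊛-cong (S.+-cong {T} (λ _ → refl) (⊛-cong {Q} (λ _ → refl)
                              (all-mod⇒ λ m → shifted {m} (⇒mod contiguous)))) (λ _ → refl) ⟩
        (T ⊕ Q ⊛ (constant 1# ⊕ Y ⊛ X ⊛ ((T ⊕ Q ⊛ f₁) ⊛ h₁))) ⊛ f
          ≈⟨ solve 7 (λ t q y x f f₁ h₁ →
               (t :+ q :* (con 1 :+ y :* x :* ((t :+ q :* f₁) :* h₁))) :* f
               := (t :+ q) :* f :+ x :* (y :* q :* h₁) :* ((t :+ q :* f₁) :* f)) (λ _ → refl) T Q Y X
                   f f₁ h₁ ⟩
        (T ⊕ Q) ⊛ f ⊕ X ⊛ (Y ⊛ Q ⊛ h₁) ⊛ Z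
          ≈⟨ S.+-cong (⊛-cong (S.sym (constant-+ t q)) (λ _ → refl)) (⊛-cong (S.sym w≈) (λ _ → refl)) ⟩
        U ⊛ f ⊕ w ⊛ Z ∎

  -- The analogue of narayana-positive for the part of the bilateral sequence with negative indices.
  narayana-negative : ∀ {t t′ q p} → p * q ≈ 1# → t′ ≈ p * p * t →
    let g = narayana t p
        B = constant t ⊕ constant q ⊛ narayana t′ p in
    constant (t + q) ⊛ g ≋ B ⊛ (constant 1# ⊕ constant t ⊛ (var ⊛ g))
  narayana-negative {t} {t′} {q} {p} pq≈1 t′≈ k = +-cancelʳ _ _ _ (balance k)
    where
    open SetoidReasoning S.setoid
    g g′ g₂ X T T′ Q P U B : Series
    g = narayana t p
    g′ = narayana t′ p
    g₂ = dilate (p * p) g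
    X = var
    T = constant t
    T′ = constant t′
    Q = constant q
    P = constant p
    U = constant (t + q)
    B = T ⊕ Q ⊛ g′
    QP≈1 : Q ⊛ P ≋ constant 1#
    QP≈1 = S.trans (S.sym (constant-* q p)) (constant-cong (trans (*-comm q p) pq≈1))
    T′≈ : T′ ≋ P ⊛ P ⊛ T
    T′≈ = S.trans (constant-cong t′≈)
        (S.trans (constant-* (p * p) t) (⊛-cong (constant-* p p) (λ _ → refl)))
    -- The contiguous relation with p = q⁻¹ for q, where t′ = p² t takes the part of the first
    -- parameter. After multiplication by q, the relations q t′ = p t and q p = 1 reproduce B on the
    -- right.
    B≈ : B ≋ U ⊕ P ⊛ X ⊛ g₂ ⊛ B
    B≈ = begin
      T ⊕ Q ⊛ g′ ≈⟨ S.+-cong {T} (λ _ → refl) (⊛-cong {Q} (λ _ → refl) (contiguous t′≈)) ⟩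
      T ⊕ Q ⊛ (constant 1# ⊕ X ⊛ ((T′ ⊕ P ⊛ g′) ⊛ g₂))
        ≈⟨ S.+-cong {T} (λ _ → refl) (⊛-cong {Q} (λ _ → refl) (S.+-cong {constant 1#} (λ _ → refl)
             (⊛-cong {X} (λ _ → refl) (⊛-cong (S.+-cong T′≈ (λ _ → refl)) (λ _ → refl))))) ⟩
      T ⊕ Q ⊛ (constant 1# ⊕ X ⊛ ((P ⊛ P ⊛ T ⊕ P ⊛ g′) ⊛ g₂))
        ≈⟨ solve 6 (λ t q x p g g₂ → t :+ q :* (con 1 :+ x :* ((p :* p :* t :+ p :* g) :* g₂))
             := t :+ q :+ (q :* p) :* (p :* x :* g₂ :* t) :+ (q :* p) :* (x :* g₂ :* g)) (λ _ → refl)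
                 T Q X P g′ g₂ ⟩
      T ⊕ Q ⊕ Q ⊛ P ⊛ (P ⊛ X ⊛ g₂ ⊛ T) ⊕ Q ⊛ P ⊛ (X ⊛ g₂ ⊛ g′)
        ≈⟨ S.+-cong (S.+-cong (S.sym (constant-+ t q)) (⊛-cong QP≈1 (λ _ → refl)))
             (S.trans (⊛-cong QP≈1 (λ _ → refl))
                 (S.trans (S.*-identityˡ _) (S.sym
                 (S.trans (⊛-cong QP≈1 (λ _ → refl)) (S.*-identityˡ _))))) ⟩
      U ⊕ constant 1# ⊛ (P ⊛ X ⊛ g₂ ⊛ T) ⊕ Q ⊛ P ⊛ (X ⊛ g₂ ⊛ g′)
        ≈⟨ solve 7 (λ u t q x p g g₂ → u :+ con 1 :* (p :* x :* g₂ :* t) :+ q :* p :* (x :* g₂ :* g)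
             := u :+ p :* x :* g₂ :* (t :+ q :* g)) (λ _ → refl) U T Q X P g′ g₂ ⟩
      U ⊕ P ⊛ X ⊛ g₂ ⊛ B ∎
    balance : U ⊛ g ⊕ P ⊛ X ⊛ g₂ ⊛ g ⊛ B ≋ B ⊛ (constant 1# ⊕ T ⊛ (X ⊛ g)) ⊕ P ⊛ X ⊛ g₂ ⊛ g ⊛ B
    balance = begin
      U ⊛ g ⊕ P ⊛ X ⊛ g₂ ⊛ g ⊛ B
        ≈⟨ solve 6 (λ u g p x g₂ b → u :* g :+ p :* x :* g₂ :* g :* b
            := (u :+ p :* x :* g₂ :* b) :* g) (λ _ → refl) U g P X g₂ B ⟩
      (U ⊕ P ⊛ X ⊛ g₂ ⊛ B) ⊛ g ≈⟨ ⊛-cong (S.sym B≈) (narayana-functional t p) ⟩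
      B ⊛ (constant 1# ⊕ X ⊛ (T ⊛ g ⊕ P ⊛ (g₂ ⊛ g)))
        ≈⟨ solve 6 (λ b x t g p g₂ → b :* (con 1 :+ x :* (t :* g :+ p :* (g₂ :* g)))
             := b :* (con 1 :+ t :* (x :* g)) :+ p :* x :* g₂ :* g :* b) (λ _ → refl) B X T g P g₂ ⟩
      B ⊛ (constant 1# ⊕ T ⊛ (X ⊛ g)) ⊕ P ⊛ X ⊛ g₂ ⊛ g ⊛ B ∎

-- Reduction of a Töplitz determinant for abstract bilateral sequences.

m⊖[m+n] : ∀ m n → m ⊖ (m ℕ.+ n) ≡ ℤ.- (+ n)
m⊖[m+n] m n = ≡.trans (≡.cong (_⊖ (m ℕ.+ n)) (≡.sym (ℕₚ.+-identityʳ m)))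
  (≡.trans (+-cancelˡ-⊖ m 0 n) (≡.trans (⊖-≤ z≤n) ≡.refl))

[m+n]⊖m : ∀ m n → (m ℕ.+ n) ⊖ m ≡ + n
[m+n]⊖m m n = ≡.trans (≡.cong ((m ℕ.+ n) ⊖_) (≡.sym (ℕₚ.+-identityʳ m))) (+-cancelˡ-⊖ m n 0)

m⊖[m+1+n] : ∀ m n → m ⊖ (m ℕ.+ suc n) ≡ -[1+ n ]
m⊖[m+1+n] m n = m⊖[m+n] m (suc n)

module ToeplitzReduction {c ℓ} (R : CommutativeRing c ℓ) where
  open CommutativeRing R hiding (zero)
  open Narayana R using (det; _^_; sum)
  open Determinant R
  open PowerSeries R using (_⊛_)
  open RingProperties ring
  open SemiringSum semiring using (sum-cong-≋; ∑-distrib-+; *-distribˡ-sum)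
  open SemiringSolver commutativeSemiring using (solve; _:+_; _:*_; _:=_)
  open SetoidReasoning setoid

  opaque
    -- Summands indexed by ℕ instead of `Fin`, so that ranges can be split and shifted by plain
    -- arithmetic.
    ∑ : ℕ → (ℕ → Carrier) → Carrier
    ∑ n f = sum {n} (λ i → f (toℕ i))

    sum-∑ : ∀ n f → sum {n} (λ i → f (toℕ i)) ≈ ∑ n f
    sum-∑ n f = refl

    ∑-zero-terms : ∀ f → ∑ 0 f ≈ 0#
    ∑-zero-terms f = refl

    ∑-suc : ∀ n f → ∑ (suc n) f ≈ f 0 + ∑ n (f ∘ suc)
    ∑-suc n f = refl

    ∑-cong : ∀ n {f g : ℕ → Carrier} → (∀ i → i ℕ.< n → f i ≈ g i) → ∑ n f ≈ ∑ n g
    ∑-cong n e = sum-cong-≋ {n} λ i → e (toℕ i) (toℕ<n i)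

    ∑-zero : ∀ n {f} → (∀ i → i ℕ.< n → f i ≈ 0#) → ∑ n f ≈ 0#
    ∑-zero n {f} e = sum-zero {n} (λ i → f (toℕ i)) λ i → e (toℕ i) (toℕ<n i)

    ∑-+ : ∀ n f g → ∑ n (λ i → f i + g i) ≈ ∑ n f + ∑ n g
    ∑-+ n f g = ∑-distrib-+ {n} (λ i → f (toℕ i)) (λ i → g (toℕ i))

    ∑-*ˡ : ∀ n x f → ∑ n (λ i → x * f i) ≈ x * ∑ n f
    ∑-*ˡ n x f = sym (*-distribˡ-sum {n} x (λ i → f (toℕ i)))

  ∑-split : ∀ m n f → ∑ (m ℕ.+ n) f ≈ ∑ m f + ∑ n (λ i → f (m ℕ.+ i))
  ∑-split zero    n f = sym (trans (+-congʳ (∑-zero-terms f)) (+-identityˡ _))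
  ∑-split (suc m) n f = trans (∑-suc (m ℕ.+ n) f) (trans (+-congˡ (∑-split m n (f ∘ suc)))
    (trans (sym (+-assoc _ _ _)) (+-congʳ (sym (∑-suc m f)))))

  ∑-if : ∀ p n (f g : ℕ → Carrier) →
    ∑ (p ℕ.+ n) (λ j → if j <ᵇ p then f j else g j) ≈ ∑ p f + ∑ n (λ j → g (p ℕ.+ j))
  ∑-if zero    n f g = sym (trans (+-congʳ (∑-zero-terms f)) (+-identityˡ _))
  ∑-if (suc p) n f g = trans (∑-suc (p ℕ.+ n) _) (trans (+-congˡ (∑-if p n (f ∘ suc) (g ∘ suc)))
    (trans (sym (+-assoc _ _ _)) (+-congʳ (sym (∑-suc p f)))))

  ⊛-∑ : ∀ a b k → (a ⊛ b) k ≈ ∑ (suc k) (λ i → a i * b (k ℕ.∸ i))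
  ⊛-∑ a b zero    = sym (trans (∑-suc 0 _) (trans (+-congˡ (∑-zero-terms _)) (+-identityʳ _)))
  ⊛-∑ a b (suc k) = trans (+-congˡ (⊛-∑ (a ∘ suc) b k)) (sym (∑-suc (suc k) _))

  -- Iverson brackets with values in the ring, which make the entries of C below ring expressions in
  -- l and k.
  [_≐_] [_≺_] : ℕ → ℕ → Carrier
  [ zero  ≐ zero  ] = 1#
  [ zero  ≐ suc _ ] = 0#
  [ suc _ ≐ zero  ] = 0#
  [ suc l ≐ suc k ] = [ l ≐ k ]

  [ _     ≺ zero  ] = 0#
  [ zero  ≺ suc _ ] = 1#
  [ suc l ≺ suc d ] = [ l ≺ d ]

  ≐-refl : ∀ k → [ k ≐ k ] ≈ 1#
  ≐-refl zero    = refl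
  ≐-refl (suc k) = ≐-refl k

  ≐-< : ∀ {l k} → l ℕ.< k → [ l ≐ k ] ≈ 0#
  ≐-< {zero}  {suc k} _         = refl
  ≐-< {suc l} {suc k} (s≤s l<k) = ≐-< l<k

  ≺-< : ∀ {l d} → l ℕ.< d → [ l ≺ d ] ≈ 1#
  ≺-< {zero}  {suc d} _         = refl
  ≺-< {suc l} {suc d} (s≤s l<d) = ≺-< l<d

  ≺-≥ : ∀ {l d} → d ℕ.≤ l → [ l ≺ d ] ≈ 0#
  ≺-≥ {l}     {zero}  _         = refl
  ≺-≥ {suc l} {suc d} (s≤s d≤l) = ≺-≥ d≤l

  ≺-total : ∀ l k → [ l ≺ suc k ] + [ k ≺ l ] ≈ 1#
  ≺-total zero    k       = +-identityʳ 1#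
  ≺-total (suc l) zero    = +-identityˡ 1#
  ≺-total (suc l) (suc k) = ≺-total l k

  ∑-≐ : ∀ n (f : ℕ → Carrier) {k} → k ℕ.< n → ∑ n (λ l → f l * [ l ≐ k ]) ≈ f k
  ∑-≐ (suc n) f {zero}  _         = trans (∑-suc n _) (trans
    (+-cong (*-identityʳ _) (∑-zero n λ i _ → zeroʳ _)) (+-identityʳ _))
  ∑-≐ (suc n) f {suc k} (s≤s k<n) = trans (∑-suc n _)
    (trans (+-cong (zeroʳ _) (∑-≐ n (f ∘ suc) k<n)) (+-identityˡ _))

  ∑-≺ : ∀ n f {d} → d ℕ.≤ n → ∑ n (λ l → [ l ≺ d ] * f l) ≈ ∑ d f
  ∑-≺ n f {zero} _ = trans (∑-zero n λ i _ → zeroˡ _) (sym (∑-zero-terms f))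
  ∑-≺ (suc n) f {suc d} (s≤s d≤n) = trans (∑-suc n _)
    (trans (+-cong (*-identityˡ _) (∑-≺ n (f ∘ suc) d≤n)) (sym (∑-suc d f)))

  ∑-≻ : ∀ k n (f : ℕ → Carrier) → ∑ (suc k ℕ.+ n) (λ l → [ k ≺ l ] * f l) ≈ ∑ n (λ i → f (suc k ℕ.+ i))
  ∑-≻ zero    n f = trans (∑-suc n _) (trans (+-cong (zeroˡ _) (∑-cong n λ i _ → *-identityˡ _))
      (+-identityˡ _))
  ∑-≻ (suc k) n f = trans (∑-suc (suc k ℕ.+ n) _)
      (trans (+-cong (zeroˡ _) (∑-≻ k n (f ∘ suc))) (+-identityˡ _))

  -- Intended reading: F is N, u is t + q, ψ is the rescaled sequence for t q⁻², and `positive` and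
  -- `negative` are coefficient forms of `narayana-positive` and `narayana-negative`.
  module _
    (u : Carrier) (F ψ F⁺ F⁻ : ℤ → Carrier)
    (F≈ : ∀ z → F z ≈ F⁺ z + F⁻ z)
    (F⁺-zero : F⁺ (+ 0) ≈ 0#) (F⁺-neg : ∀ k → F⁺ -[1+ k ] ≈ 0#)
    (F⁻-zero : F⁻ (+ 0) ≈ 1#) (F⁻-pos : ∀ k → F⁻ (+ suc k) ≈ 0#)
    (positive : ∀ m → F (+ suc m) ≈ u * F (+ m) + ∑ m (λ i → F⁺ (m ⊖ i) * ψ (+ suc i)))
    (negative : ∀ m → F (ℤ.- (+ m)) + ∑ (suc m) (λ i → F⁻ (ℤ.- (+ i)) * ψ (i ⊖ m)) ≈ u * F -[1+ m ])
    where

    private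
      F⁺-≤ : ∀ r j → F⁺ (r ⊖ (r ℕ.+ j)) ≈ 0#
      F⁺-≤ r zero    = trans (reflexive (≡.cong F⁺ (m⊖[m+n] r 0))) F⁺-zero
      F⁺-≤ r (suc j) = trans (reflexive (≡.cong F⁺ (m⊖[m+n] r (suc j)))) (F⁺-neg j)

      F⁺-≤′ : ∀ {r l} → r ℕ.≤ l → F⁺ (r ⊖ l) ≈ 0#
      F⁺-≤′ {r} r≤l = ≡.subst (λ l → F⁺ (r ⊖ l) ≈ 0#) (ℕₚ.m+[n∸m]≡n r≤l) (F⁺-≤ r _)

      F⁻-> : ∀ {r l} → l ℕ.< r → F⁻ (r ⊖ l) ≈ 0#
      F⁻-> {r} {l} l<r = ≡.subst (λ r → F⁻ (r ⊖ l) ≈ 0#)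
        (≡.trans (ℕₚ.+-suc l _) (ℕₚ.m+[n∸m]≡n l<r))
        (trans (reflexive (≡.cong F⁻ ([m+n]⊖m l (suc (r ℕ.∸ suc l))))) (F⁻-pos _))

    -- For r > k the F⁻ terms vanish and `positive` at r - k - 1 remains; for r ≤ k the F⁺ terms
    -- vanish and `negative` at k - r remains. The bound N truncates a sum whose terms with l ≥ r
    -- are zero.
    convolution : ∀ N r k → k ℕ.< N → r ℕ.≤ N →
      F (r ⊖ k) + ∑ (suc k) (λ l → F⁻ (r ⊖ l) * ψ (l ⊖ k))
        ≈ u * F (r ⊖ suc k) + ∑ N (λ l → [ k ≺ l ] * (F⁺ (r ⊖ l) * ψ (l ⊖ k)))
    convolution N r k k<N r≤N with ℕₚ.≤-<-connex r k
    ... | inj₁ r≤k = ≡.subst (λ k → F (r ⊖ k) + ∑ (suc k) (λ l → F⁻ (r ⊖ l) * ψ (l ⊖ k))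
                        ≈ u * F (r ⊖ suc k) + ∑ N (λ l → [ k ≺ l ] * (F⁺ (r ⊖ l) * ψ (l ⊖ k))))
                        (ℕₚ.m+[n∸m]≡n r≤k) (below (k ℕ.∸ r))
      where
      below : ∀ m → let k = r ℕ.+ m in
        F (r ⊖ k) + ∑ (suc k) (λ l → F⁻ (r ⊖ l) * ψ (l ⊖ k))
          ≈ u * F (r ⊖ suc k) + ∑ N (λ l → [ k ≺ l ] * (F⁺ (r ⊖ l) * ψ (l ⊖ k)))
      below m = begin
        F (r ⊖ k′) + ∑ (suc k′) H
          ≡⟨ ≡.cong₂ (λ z n → F z + ∑ n H) (m⊖[m+n] r m) (≡.sym (ℕₚ.+-suc r m)) ⟩
        F (ℤ.- (+ m)) + ∑ (r ℕ.+ suc m) H                    ≈⟨ +-congˡ (∑-split r (suc m) H) ⟩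
        F (ℤ.- (+ m)) + (∑ r H + ∑ (suc m) (λ i → H (r ℕ.+ i)))
          ≈⟨ +-congˡ (trans (+-cong (∑-zero r λ l l<r → trans (*-congʳ (F⁻-> l<r)) (zeroˡ _))
               (∑-cong (suc m) λ i _ → *-cong (reflexive (≡.cong F⁻ (m⊖[m+n] r i)))
                                              (reflexive (≡.cong ψ (+-cancelˡ-⊖ r i m)))))
               (+-identityˡ _)) ⟩
        F (ℤ.- (+ m)) + ∑ (suc m) (λ i → F⁻ (ℤ.- (+ i)) * ψ (i ⊖ m)) ≈⟨ negative m ⟩
        u * F -[1+ m ]
          ≡⟨ ≡.cong (λ z → u * F z) (≡.sym
              (≡.trans (≡.cong (r ⊖_) (≡.sym (ℕₚ.+-suc r m))) (m⊖[m+1+n] r m))) ⟩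
        u * F (r ⊖ suc k′)                                   ≈⟨ sym (+-identityʳ _) ⟩
        u * F (r ⊖ suc k′) + 0#
          ≈⟨ +-congˡ (sym (∑-zero N λ l _ → trivial l)) ⟩
        u * F (r ⊖ suc k′) + ∑ N (λ l → [ k′ ≺ l ] * (F⁺ (r ⊖ l) * ψ (l ⊖ k′))) ∎
        where
        k′ : ℕ
        k′ = r ℕ.+ m
        H : ℕ → Carrier
        H l = F⁻ (r ⊖ l) * ψ (l ⊖ k′)
        trivial : ∀ l → [ k′ ≺ l ] * (F⁺ (r ⊖ l) * ψ (l ⊖ k′)) ≈ 0#
        trivial l with ℕₚ.≤-<-connex l k′
        ... | inj₁ l≤k = trans (*-congʳ (≺-≥ l≤k)) (zeroˡ _)
        ... | inj₂ k<l = trans (*-congˡ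
            (trans (*-congʳ (F⁺-≤′ (ℕₚ.≤-trans (ℕₚ.m≤m+n r m) (ℕₚ.<⇒≤ k<l)))) (zeroˡ _))) (zeroʳ _)
    ... | inj₂ k<r = ≡.subst (λ r → r ℕ.≤ N → F (r ⊖ k) + ∑ (suc k) (λ l → F⁻ (r ⊖ l) * ψ (l ⊖ k))
                        ≈ u * F (r ⊖ suc k) + ∑ N (λ l → [ k ≺ l ] * (F⁺ (r ⊖ l) * ψ (l ⊖ k))))
                        (ℕₚ.m+[n∸m]≡n k<r) (above (r ℕ.∸ suc k)) r≤N
      where
      above : ∀ m → let r = suc k ℕ.+ m in r ℕ.≤ N →
        F (r ⊖ k) + ∑ (suc k) (λ l → F⁻ (r ⊖ l) * ψ (l ⊖ k))
          ≈ u * F (r ⊖ suc k) + ∑ N (λ l → [ k ≺ l ] * (F⁺ (r ⊖ l) * ψ (l ⊖ k)))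
      above m r≤N = begin
        F (r′ ⊖ k) + ∑ (suc k) (λ l → F⁻ (r′ ⊖ l) * ψ (l ⊖ k))
          ≈⟨ +-cong (reflexive (≡.cong F (≡.trans (≡.cong (_⊖ k) (≡.sym (ℕₚ.+-suc k m)))
              ([m+n]⊖m k (suc m)))))
                    (∑-zero (suc k) λ l l<k → trans
                        (*-congʳ (F⁻-> (ℕₚ.<-≤-trans l<k (ℕₚ.m≤m+n (suc k) m)))) (zeroˡ _)) ⟩
        F (+ suc m) + 0#                                     ≈⟨ trans (+-identityʳ _) (positive m) ⟩
        u * F (+ m) + ∑ m (λ i → F⁺ (m ⊖ i) * ψ (+ suc i))
          ≈⟨ +-cong (*-congˡ (reflexive (≡.cong F (≡.sym ([m+n]⊖m (suc k) m))))) (sym tail-sum) ⟩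
        u * F (r′ ⊖ suc k) + ∑ N (λ l → [ k ≺ l ] * H l) ∎
        where
        r′ n : ℕ
        r′ = suc k ℕ.+ m
        n = N ℕ.∸ r′
        H : ℕ → Carrier
        H l = F⁺ (r′ ⊖ l) * ψ (l ⊖ k)
        tail-sum : ∑ N (λ l → [ k ≺ l ] * H l) ≈ ∑ m (λ i → F⁺ (m ⊖ i) * ψ (+ suc i))
        tail-sum = begin
          ∑ N (λ l → [ k ≺ l ] * H l)
            ≡⟨ ≡.cong (λ n → ∑ n (λ l → [ k ≺ l ] * H l))
                (≡.sym (≡.trans (≡.sym (ℕₚ.+-assoc (suc k) m n)) (ℕₚ.m+[n∸m]≡n r≤N))) ⟩
          ∑ (suc k ℕ.+ (m ℕ.+ n)) (λ l → [ k ≺ l ] * H l)    ≈⟨ ∑-≻ k (m ℕ.+ n) H ⟩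
          ∑ (m ℕ.+ n) (λ i → H (suc k ℕ.+ i))               ≈⟨ ∑-split m n (λ i → H (suc k ℕ.+ i)) ⟩
          ∑ m (λ i → H (suc k ℕ.+ i)) + ∑ n (λ i → H (suc k ℕ.+ (m ℕ.+ i)))
            ≈⟨ +-cong (∑-cong m λ i _ → *-cong (reflexive (≡.cong F⁺ (+-cancelˡ-⊖ (suc k) m i)))
                 (reflexive (≡.cong ψ (≡.trans (≡.cong (_⊖ k) (≡.sym (ℕₚ.+-suc k i)))
                     ([m+n]⊖m k (suc i))))))
                 (∑-zero n λ i _ → trans (*-congʳ (trans
                    (reflexive (≡.cong F⁺ (+-cancelˡ-⊖ (suc k) m (m ℕ.+ i)))) (F⁺-≤ m i))) (zeroˡ _)) ⟩
          ∑ m (λ i → F⁺ (m ⊖ i) * ψ (+ suc i)) + 0# ≈⟨ +-identityʳ _ ⟩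
          ∑ m (λ i → F⁺ (m ⊖ i) * ψ (+ suc i)) ∎

    -- Row operations are read off from the splitting F = F⁺ + F⁻ at row p; the columns of the
    -- unimodular matrix C are a unit vector followed by u x^(k+1) − x^k + (the part of ψ x^k strictly
    -- between the degrees k and s + p).
    module _ (s p ρ : ℕ) (≤d : p ℕ.+ ρ ℕ.≤ s ℕ.+ p) (d≤ : s ℕ.+ p ℕ.≤ suc (p ℕ.+ ρ)) where
      private
        m d : ℕ
        m = p ℕ.+ ρ
        d = s ℕ.+ p

        C B : ℕ → ℕ → Carrier
        C l zero    = [ l ≐ m ]
        C l (suc k) = - [ l ≐ k ] + u * [ l ≐ suc k ] + [ l ≺ d ] * ([ k ≺ l ] * ψ (l ⊖ k))
        B zero    zero    = 1#
        B zero    (suc k) = 0#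
        B (suc j) zero    = 0#
        B (suc j) (suc k) = ψ ((s ℕ.+ j) ⊖ k)

        A : ℕ → ℕ → Carrier
        A = splitToeplitz p F⁻ (λ z → - F⁺ z) (λ i → F ((s ℕ.+ i) ⊖ m))

        -- Column k + 1 of C adds the terms F ψ with k < l < d. Their F⁻ parts complete the sum over
        -- l ≤ k from `convolution` to one over all l < d; their F⁺ parts cancel and leave the terms
        -- with l ≥ d, negated. Since F⁻ vanishes for l < s, shifting l by s gives row i of A
        -- against column k of ψ.
        columns : ∀ i k → i ℕ.≤ m → k ℕ.< m →
          ∑ (suc m) (λ l → F ((s ℕ.+ i) ⊖ l) * C l (suc k)) ≈ ∑ (suc m) (λ l → A i l * B l (suc k))
        columns i k i≤m k<m = begin
          ∑ (suc m) (λ l → F (r ⊖ l) * C l (suc k))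
            ≈⟨ ∑-cong (suc m) (λ l _ → trans
                 (solve 6 (λ f a u b x y → f :* (a :+ u :* b :+ x :* y)
                     := f :* a :+ (u :* (f :* b) :+ x :* (f :* y)))
                    refl (F (r ⊖ l)) (- [ l ≐ k ]) u [ l ≐ suc k ] [ l ≺ d ] ([ k ≺ l ] * ψ (l ⊖ k)))
                 (+-congʳ (trans (sym (-‿distribʳ-* _ _)) (trans (-‿cong refl) (sym (-1*x≈-x _)))))) ⟩
          ∑ (suc m) (λ l → - 1# * (F (r ⊖ l) * [ l ≐ k ])
              + (u * (F (r ⊖ l) * [ l ≐ suc k ]) + [ l ≺ d ] * (F (r ⊖ l) * ([ k ≺ l ] * ψ (l ⊖ k)))))
            ≈⟨ trans (∑-+ (suc m) _ _) (+-cong (∑-*ˡ (suc m) (- 1#) _)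
                 (trans (∑-+ (suc m) _ _) (+-congʳ (∑-*ˡ (suc m) u _)))) ⟩
          - 1# * ∑ (suc m) (λ l → F (r ⊖ l) * [ l ≐ k ])
              + (u * ∑ (suc m) (λ l → F (r ⊖ l) * [ l ≐ suc k ])
            + ∑ (suc m) (λ l → [ l ≺ d ] * (F (r ⊖ l) * ([ k ≺ l ] * ψ (l ⊖ k)))))
            ≈⟨ +-cong (trans (*-congˡ (∑-≐ (suc m) (λ l → F (r ⊖ l)) (ℕₚ.m<n⇒m<1+n k<m))) (-1*x≈-x _))
                 (+-cong (*-congˡ (∑-≐ (suc m) (λ l → F (r ⊖ l)) (s≤s k<m)))
                         (∑-≺ (suc m) (λ l → F (r ⊖ l) * ([ k ≺ l ] * ψ (l ⊖ k))) d≤)) ⟩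
          - F (r ⊖ k) + (u * F (r ⊖ suc k) + ∑ d (λ l → F (r ⊖ l) * ([ k ≺ l ] * ψ (l ⊖ k))))
            ≈⟨ balance ⟩
          ∑ d (λ l → F⁻ (r ⊖ l) * ψ (l ⊖ k)) + - ∑ ρ (λ j → F⁺ (r ⊖ (d ℕ.+ j)) * ψ ((d ℕ.+ j) ⊖ k))
            ≈⟨ +-cong upper lower ⟩
          ∑ p (λ j → F⁻ (i ⊖ j) * ψ ((s ℕ.+ j) ⊖ k))
              + ∑ ρ (λ j → - F⁺ (i ⊖ (p ℕ.+ j)) * ψ ((s ℕ.+ (p ℕ.+ j)) ⊖ k))
            ≈⟨ sym (∑-if p ρ _ _) ⟩
          ∑ m (λ j → if j <ᵇ p then F⁻ (i ⊖ j) * ψ ((s ℕ.+ j) ⊖ k) else - F⁺ (i ⊖ j) * ψ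
              ((s ℕ.+ j) ⊖ k))
            ≈⟨ ∑-cong m (λ j _ → push (j <ᵇ p) (ψ ((s ℕ.+ j) ⊖ k))) ⟩
          ∑ m (λ j → A i (suc j) * B (suc j) (suc k))
              ≈⟨ sym (trans (∑-suc m _) (trans (+-congʳ (zeroʳ _)) (+-identityˡ _))) ⟩
          ∑ (suc m) (λ l → A i l * B l (suc k)) ∎
          where
          r : ℕ
          r = s ℕ.+ i
          push : ∀ b {x y} z → (if b then x * z else y * z) ≈ (if b then x else y) * z
          push true  z = refl
          push false z = refl
          upper : ∑ d (λ l → F⁻ (r ⊖ l) * ψ (l ⊖ k)) ≈ ∑ p (λ j → F⁻ (i ⊖ j) * ψ ((s ℕ.+ j) ⊖ k))
          upper = trans (∑-split s p _) (trans (+-cong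
            (∑-zero s λ l l<s → trans (*-congʳ (F⁻-> (ℕₚ.<-≤-trans l<s (ℕₚ.m≤m+n s i)))) (zeroˡ _))
            (∑-cong p λ j _ → *-congʳ (reflexive (≡.cong F⁻ (+-cancelˡ-⊖ s i j))))) (+-identityˡ _))
          lower : - ∑ ρ (λ j → F⁺ (r ⊖ (d ℕ.+ j)) * ψ ((d ℕ.+ j) ⊖ k)) ≈
                  ∑ ρ (λ j → - F⁺ (i ⊖ (p ℕ.+ j)) * ψ ((s ℕ.+ (p ℕ.+ j)) ⊖ k))
          lower = trans (sym (-1*x≈-x _)) (trans (sym (∑-*ˡ ρ (- 1#) _)) (∑-cong ρ λ j _ →
            trans (sym (*-assoc _ _ _)) (*-cong
              (trans (-1*x≈-x _) (-‿cong (reflexive (≡.cong F⁺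
                (≡.trans (≡.cong (r ⊖_) (ℕₚ.+-assoc s p j)) (+-cancelˡ-⊖ s i (p ℕ.+ j)))))))
              (reflexive (≡.cong (λ l → ψ (l ⊖ k)) (ℕₚ.+-assoc s p j))))))
          -- The bound `≤d` puts the cut d above every k < m; the bound `d≤`, used above, keeps l <
          -- d within the columns of the matrix.
          k<d : k ℕ.< d
          k<d = ℕₚ.<-≤-trans k<m ≤d
          -- Truncating the convolution at d + ρ = s + m loses nothing, as r = s + i with i ≤ m.
          r≤N : r ℕ.≤ d ℕ.+ ρ
          r≤N = ≡.subst (r ℕ.≤_) (≡.sym (ℕₚ.+-assoc s p ρ)) (ℕₚ.+-monoʳ-≤ s i≤m)
          h⁺ h⁻ : ℕ → Carrier
          h⁺ l = F⁺ (r ⊖ l) * ψ (l ⊖ k)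
          h⁻ l = F⁻ (r ⊖ l) * ψ (l ⊖ k)
          X Y Z W : Carrier
          X = ∑ d (λ l → [ k ≺ l ] * h⁺ l)
          Y = ∑ d (λ l → [ k ≺ l ] * h⁻ l)
          Z = ∑ d (λ l → [ l ≺ suc k ] * h⁻ l)
          W = ∑ ρ (λ j → h⁺ (d ℕ.+ j))
          conv : F (r ⊖ k) + Z ≈ u * F (r ⊖ suc k) + (X + W)
          conv = trans (+-congˡ (∑-≺ d h⁻ k<d))
              (trans (convolution (d ℕ.+ ρ) r k (ℕₚ.<-≤-trans k<d (ℕₚ.m≤m+n d ρ)) r≤N)
            (+-congˡ (trans (∑-split d ρ _) (+-congˡ (∑-cong ρ λ j _ →
              trans (*-congʳ (≺-< (ℕₚ.<-≤-trans k<d (ℕₚ.m≤m+n d j)))) (*-identityˡ _))))))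
          split-F : ∑ d (λ l → F (r ⊖ l) * ([ k ≺ l ] * ψ (l ⊖ k))) ≈ X + Y
          split-F = trans (∑-cong d λ l _ → trans (*-congʳ (F≈ (r ⊖ l)))
            (solve 4 (λ a b x y → (a :+ b) :* (x :* y) := x :* (a :* y) :+ x :* (b :* y)) refl _ _ _
                _)) (∑-+ d _ _)
          split-F⁻ : ∑ d h⁻ ≈ Z + Y
          split-F⁻ = trans (∑-cong d λ l _ → trans (sym (*-identityˡ _))
              (trans (*-congʳ (sym (≺-total l k))) (distribʳ _ _ _))) (∑-+ d _ _)
          balance : - F (r ⊖ k) + (u * F (r ⊖ suc k) + ∑ d
              (λ l → F (r ⊖ l) * ([ k ≺ l ] * ψ (l ⊖ k)))) ≈ ∑ d h⁻ + - W
          balance = begin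
            - f + (g + _)                ≈⟨ +-congˡ (+-congˡ split-F) ⟩
            - f + (g + (X + Y))          ≈⟨ sym (trans (+-congˡ (-‿inverseʳ W)) (+-identityʳ _)) ⟩
            - f + (g + (X + Y)) + (W + - W)
              ≈⟨ solve 6 (λ f g x y w w′ → f :+ (g :+ (x :+ y)) :+ (w :+ w′)
                  := f :+ (g :+ (x :+ w)) :+ (y :+ w′))
                   refl (- f) g X Y W (- W) ⟩
            - f + (g + (X + W)) + (Y + - W) ≈⟨ +-congʳ (+-congˡ (sym conv)) ⟩
            - f + (f + Z) + (Y + - W)
              ≈⟨ solve 5 (λ f′ f z y w → f′ :+ (f :+ z) :+ (y :+ w) := (f′ :+ f) :+ ((z :+ y) :+ w))
                  refl (- f) f Z Y (- W) ⟩
            (- f + f) + ((Z + Y) + - W)  ≈⟨ trans (+-congʳ (-‿inverseˡ f)) (+-identityˡ _) ⟩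
            (Z + Y) + - W                ≈⟨ +-congʳ (sym split-F⁻) ⟩
            ∑ d h⁻ + - W ∎
            where
            f g : Carrier
            f = F (r ⊖ k)
            g = u * F (r ⊖ suc k)

        factorization : ∀ (i k : Fin (suc m)) →
          ∑ (suc m) (λ l → F ((s ℕ.+ toℕ i) ⊖ l) * C l (toℕ k))
              ≈ ∑ (suc m) (λ l → A (toℕ i) l * B l (toℕ k))
        factorization i zero    = trans (∑-≐ (suc m) (λ l → F ((s ℕ.+ toℕ i) ⊖ l)) (ℕₚ.n<1+n m))
          (sym (trans (∑-suc m _) (trans (+-cong (*-identityʳ _) (∑-zero m λ j _ → zeroʳ _))
              (+-identityʳ _))))
        factorization i (suc k) = columns (toℕ i) (toℕ k) (ℕₚ.≤-pred (toℕ<n i)) (toℕ<n k)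

        det-C : det (suc m) (λ i j → C (toℕ i) (toℕ j)) ≈ 1#
        det-C = det-cyclicLower m C (λ l → ≐-<) (≐-refl m)
          (λ k → trans (+-cong (+-cong (-‿cong (≐-refl k))
              (trans (*-congˡ (≐-< (ℕₚ.n<1+n k))) (zeroʳ _)))
                         (trans (*-congˡ (trans (*-congʳ (≺-≥ {k} {k} ℕₚ.≤-refl)) (zeroˡ _)))
                             (zeroʳ _)))
                       (trans (+-identityʳ _) (+-identityʳ _)))
          (λ l k l<k → trans (+-cong (+-cong (trans (-‿cong (≐-< l<k)) -0#≈0#)
              (trans (*-congˡ (≐-< (ℕₚ.m<n⇒m<1+n l<k))) (zeroʳ _)))
                         (trans (*-congˡ (trans (*-congʳ (≺-≥ (ℕₚ.<⇒≤ l<k))) (zeroˡ _))) (zeroʳ _)))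
                       (trans (+-identityʳ _) (+-identityʳ _)))

      -- M C = A B with det C = 1, and det A is a pivot times the diagonal of a triangular block.
      -- The two bounds force the pivot to be F at 0 or at 1.
      det-toeplitzReduction :
        det (suc (p ℕ.+ ρ)) (λ i j → F ((s ℕ.+ toℕ i) ⊖ toℕ j)) ≈
        (- 1#) ^ p * (F ((s ℕ.+ p) ⊖ (p ℕ.+ ρ)) * (- F⁺ (+ 1)) ^ ρ) *
        det (p ℕ.+ ρ) (λ i j → ψ ((s ℕ.+ toℕ i) ⊖ toℕ j))
      det-toeplitzReduction = begin
        det (suc m) M                                ≈⟨ sym (*-identityʳ _) ⟩
        det (suc m) M * 1#                           ≈⟨ *-congˡ (sym det-C) ⟩
        det (suc m) M * det (suc m) C′               ≈⟨ sym (det-⊗ (suc m) M C′) ⟩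
        det (suc m) (M ⊗ C′)
            ≈⟨ det-cong (suc m) (λ i k → trans
            (sum-∑ (suc m) (λ l → F ((s ℕ.+ toℕ i) ⊖ l) * C l (toℕ k)))
                                                        (trans (factorization i k) (sym
                                                            (sum-∑ (suc m) (λ l → A (toℕ i) l * B l
                                                            (toℕ k)))))) ⟩
        det (suc m) (A′ ⊗ B′)                        ≈⟨ det-⊗ (suc m) A′ B′ ⟩
        det (suc m) A′ * det (suc m) B′
          ≈⟨ *-cong (det-splitToeplitz p ρ F⁻ (λ z → - F⁺ z) (λ i → F ((s ℕ.+ i) ⊖ m)) F⁻-zero F⁻-pos
                       (trans (-‿cong F⁺-zero) -0#≈0#) (λ k → trans (-‿cong (F⁺-neg k)) -0#≈0#))
                    (det-1⊕ m B′ refl (λ j → refl)) ⟩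
        (- 1#) ^ p * (F ((s ℕ.+ p) ⊖ (p ℕ.+ ρ)) * (- F⁺ (+ 1)) ^ ρ) *
        det (p ℕ.+ ρ) (λ i j → ψ ((s ℕ.+ toℕ i) ⊖ toℕ j)) ∎
        where
        M C′ A′ B′ : Matrix (suc m) (suc m)
        M i j  = F ((s ℕ.+ toℕ i) ⊖ toℕ j)
        C′ i j = C (toℕ i) (toℕ j)
        A′ i j = A (toℕ i) (toℕ j)
        B′ i j = B (toℕ i) (toℕ j)

-- Integer powers of units.

module UnitPowers {c ℓ} (R : CommutativeRing c ℓ) where
  open CommutativeRing R hiding (zero)
  open Narayana R
  open SemiringExp commutativeSemiring using (^-homo-*; ^-distrib-*)
  open SemiringSolver commutativeSemiring using (solve; _:*_; _:=_)
  open SetoidReasoning setoid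

  val-⁻¹ : ∀ u → val (u ⁻¹) * val u ≈ 1#
  val-⁻¹ (x , y , yx≈1 , xy≈1) = yx≈1

  ^ℤ-⊖ : ∀ u m n → u ^ℤ (m ⊖ n) ≈ val u ^ m * val (u ⁻¹) ^ n
  ^ℤ-⊖ u m zero = sym (*-identityʳ _)
  ^ℤ-⊖ u zero (suc n) = sym (*-identityˡ _)
  ^ℤ-⊖ u (suc m) (suc n) = begin
    u ^ℤ (suc m ⊖ suc n) ≡⟨ ≡.cong (u ^ℤ_) ([1+m]⊖[1+n]≡m⊖n m n) ⟩
    u ^ℤ (m ⊖ n)         ≈⟨ ^ℤ-⊖ u m n ⟩
    x ^ m * y ^ n        ≈⟨ sym (*-identityˡ _) ⟩
    1# * (x ^ m * y ^ n) ≈⟨ *-congʳ (sym (val-⁻¹ u)) ⟩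
    y * x * (x ^ m * y ^ n)
      ≈⟨ solve 4 (λ x y a b → y :* x :* (a :* b) := x :* a :* (y :* b)) refl x y (x ^ m) (y ^ n) ⟩
    x ^ suc m * y ^ suc n ∎
    where
    x y : Carrier
    x = val u
    y = val (u ⁻¹)

  ^ℤ-+ : ∀ u a b → u ^ℤ (a ℤ.+ b) ≈ u ^ℤ a * u ^ℤ b
  ^ℤ-+ u (+ m)    (+ n)    = ^-homo-* (val u) m n
  ^ℤ-+ u (+ m)    -[1+ n ] = ^ℤ-⊖ u m (suc n)
  ^ℤ-+ u -[1+ m ] (+ n)    = trans (^ℤ-⊖ u n (suc m)) (*-comm _ _)
  ^ℤ-+ u -[1+ m ] -[1+ n ] = trans (*-congˡ (^-homo-* (val (u ⁻¹)) (suc m) n))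
    (solve 3 (λ y a b → y :* (a :* b) := a :* (y :* b)) refl (val (u ⁻¹)) _ _)

  ^ℤ-≡ : ∀ u {a b} → a ≡ b → u ^ℤ a ≈ u ^ℤ b
  ^ℤ-≡ u e = reflexive (≡.cong (u ^ℤ_) e)

  ^ℤ-merge : ∀ u a b {c} → a ℤ.+ b ≡ c → u ^ℤ a * u ^ℤ b ≈ u ^ℤ c
  ^ℤ-merge u a b e = trans (sym (^ℤ-+ u a b)) (^ℤ-≡ u e)

  ^ℤ-* : ∀ u a n → (u ^ℤ a) ^ n ≈ u ^ℤ (a ℤ.* + n)
  ^ℤ-* u a zero    = ^ℤ-≡ u (≡.sym (ℤₚ.*-zeroʳ a))
  ^ℤ-* u a (suc n) = trans (*-congˡ (^ℤ-* u a n)) (^ℤ-merge u a (a ℤ.* + n) (≡.sym (lemma a (+ n))))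
    where
    lemma : ∀ a n → a ℤ.* (+ 1 ℤ.+ n) ≡ a ℤ.+ a ℤ.* n
    lemma = solve-∀

  ^ℤ-⁻¹ : ∀ u a → (u ⁻¹) ^ℤ a ≈ u ^ℤ (ℤ.- a)
  ^ℤ-⁻¹ u (+ zero)  = refl
  ^ℤ-⁻¹ u (+ suc n) = refl
  ^ℤ-⁻¹ u -[1+ n ]  = refl

  infixl 7 _·_
  _·_ : Unit → Unit → Unit
  u@(x , x′ , _) · v@(y , y′ , _) = x * y , x′ * y′ , inverse x x′ y y′ (val-⁻¹ u) (val-⁻¹ v) ,
    inverse x′ x y′ y (val-⁻¹ (u ⁻¹)) (val-⁻¹ (v ⁻¹))
    where
    inverse : ∀ x x′ y y′ → x′ * x ≈ 1# → y′ * y ≈ 1# → x′ * y′ * (x * y) ≈ 1#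
    inverse x x′ y y′ p q = trans
      (solve 4 (λ x x′ y y′ → x′ :* y′ :* (x :* y) := x′ :* x :* (y′ :* y)) refl x x′ y y′)
      (trans (*-cong p q) (*-identityˡ 1#))

  ^ℤ-· : ∀ u v a → (u · v) ^ℤ a ≈ u ^ℤ a * v ^ℤ a
  ^ℤ-· u v (+ n)    = ^-distrib-* (val u) (val v) n
  ^ℤ-· u v -[1+ n ] = ^-distrib-* (val (u ⁻¹)) (val (v ⁻¹)) (suc n)

  -- The parameter t q ⁻² of the sequence to which the determinants are reduced.
  twist : Unit → Unit → Unit
  twist t q = t · (q ⁻¹ · q ⁻¹)

  twist-^ℤ : ∀ t q a → twist t q ^ℤ a ≈ t ^ℤ a * q ^ℤ (ℤ.- (+ 2) ℤ.* a)
  twist-^ℤ t q a = trans (^ℤ-· t (q ⁻¹ · q ⁻¹) a) (*-congˡ (trans (^ℤ-· (q ⁻¹) (q ⁻¹) a)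
    (trans (*-cong (^ℤ-⁻¹ q a) (^ℤ-⁻¹ q a)) (^ℤ-merge q (ℤ.- a) (ℤ.- a) (lemma a)))))
    where
    lemma : ∀ a → ℤ.- a ℤ.+ ℤ.- a ≡ ℤ.- (+ 2) ℤ.* a
    lemma = solve-∀

-- Entries of the Töplitz matrix and the duality.

module NarayanaEntries {c ℓ} (R : CommutativeRing c ℓ) where
  open CommutativeRing R hiding (zero)
  open Narayana R
  open Determinant R
  open PathSeries R
  open UnitPowers R
  open SemiringSolver commutativeSemiring using (solve; _:*_; _:=_)
  open SetoidReasoning setoid

  Nℕ-narayana : ∀ k t q → Nℕ k t q ≈ narayana (val t) (val q) k
  Nℕ-narayana k t q = sumOver-cong (λ p → *-congˡ (reflexive (≡.cong (val q ^_) (area≡halfArea p))))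
      (paths (2 ℕ.* k) 0)

  Nℕ-zero : ∀ t q → Nℕ 0 t q ≈ 1#
  Nℕ-zero t q = trans (+-identityʳ _) (*-identityˡ 1#)

  -- For negative z this is the definition. For z ≥ 0 it is the definition at -z-1 solved for the
  -- other side, since the exponents 2z+1 and -2(z+1)+1 cancel.
  N-dual : ∀ z t q → N z t q ≈ t ^ℤ (+ 2 ℤ.* z ℤ.+ + 1) * N (ℤ.- z ℤ.- + 1) t (q ⁻¹)
  N-dual (+ k) t q = begin
    Nℕ k t q      ≈⟨ sym (*-identityˡ _) ⟩
    1# * Nℕ k t q ≈⟨ *-congʳ (sym (^ℤ-merge t (+ 2 ℤ.* + k ℤ.+ + 1) (ℤ.- (+ 2) ℤ.* + suc k ℤ.+ + 1)
        (lemma (+ k)))) ⟩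
    t ^ℤ (+ 2 ℤ.* + k ℤ.+ + 1) * t ^ℤ (ℤ.- (+ 2) ℤ.* + suc k ℤ.+ + 1) * Nℕ k t q ≈⟨ *-assoc _ _ _ ⟩
    t ^ℤ (+ 2 ℤ.* + k ℤ.+ + 1) * N -[1+ k ] t (q ⁻¹)
      ≡⟨ ≡.cong (λ z → t ^ℤ (+ 2 ℤ.* + k ℤ.+ + 1) * N z t (q ⁻¹)) (index k) ⟩
    t ^ℤ (+ 2 ℤ.* + k ℤ.+ + 1) * N (ℤ.- (+ k) ℤ.- + 1) t (q ⁻¹) ∎
    where
    lemma : ∀ k → (+ 2 ℤ.* k ℤ.+ + 1) ℤ.+ (ℤ.- (+ 2) ℤ.* (+ 1 ℤ.+ k) ℤ.+ + 1) ≡ + 0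
    lemma = solve-∀
    index : ∀ k → -[1+ k ] ≡ ℤ.- (+ k) ℤ.- + 1
    index zero    = ≡.refl
    index (suc k) = ≡.cong (-[1+_] ∘ suc) (≡.sym (ℕₚ.+-identityʳ k))
  N-dual -[1+ k ] t q = *-congʳ (^ℤ-≡ t (lemma (+ k)))
    where
    lemma : ∀ k → ℤ.- (+ 2) ℤ.* (+ 1 ℤ.+ k) ℤ.+ + 1 ≡ + 2 ℤ.* (ℤ.- (+ 1 ℤ.+ k)) ℤ.+ + 1
    lemma = solve-∀

  -- With z = s+i-j-1, the power t^(2z+1) is t^(2s-1) t^(2i) t^(-2j), which `det-conjugate` removes.
  -- The index -z-1 is the entry for 1-s after reversing the order of rows and columns.
  𝒩-dual : ∀ n s t q → 𝒩 n s t q ≈ (t ^ℤ (+ 2 ℤ.* s ℤ.- + 1)) ^ n * 𝒩 n (+ 1 ℤ.- s) t (q ⁻¹)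
  𝒩-dual n s t q = begin
    𝒩 n s t q ≈⟨ det-cong n entry ⟩
    det n (λ i j → t ^ℤ (+ 2 ℤ.* s ℤ.- + 1)
        * (t ^ℤ (+ 2 ℤ.* + toℕ i) * M (opposite i) (opposite j) * t ^ℤ (ℤ.- (+ 2) ℤ.* + toℕ j)))
      ≈⟨ det-conjugate n _ (λ i → t ^ℤ (+ 2 ℤ.* + toℕ i)) (λ j → t ^ℤ (ℤ.- (+ 2) ℤ.* + toℕ j))
           (λ i j → M (opposite i) (opposite j))
               (λ i → ^ℤ-merge t (+ 2 ℤ.* + toℕ i) _ (cancels (+ toℕ i))) ⟩
    (t ^ℤ (+ 2 ℤ.* s ℤ.- + 1)) ^ n * det n (λ i j → M (opposite i) (opposite j))
        ≈⟨ *-congˡ (det-reverse n M) ⟩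
    (t ^ℤ (+ 2 ℤ.* s ℤ.- + 1)) ^ n * 𝒩 n (+ 1 ℤ.- s) t (q ⁻¹) ∎
    where
    M : Matrix n n
    M i j = N (+ 1 ℤ.- s ℤ.+ + toℕ i ℤ.- + toℕ j ℤ.- + 1) t (q ⁻¹)
    cancels : ∀ i → + 2 ℤ.* i ℤ.+ ℤ.- (+ 2) ℤ.* i ≡ + 0
    cancels = solve-∀
    opposite-toℕ : ∀ (i : Fin n) → + toℕ (opposite i) ≡ + n ℤ.- (+ 1 ℤ.+ + toℕ i)
    opposite-toℕ i = ≡.trans (≡.cong +_ (opposite-prop i))
      (≡.sym (≡.trans (m-n≡m⊖n n (suc (toℕ i))) (ℤₚ.⊖-≥ (toℕ<n i))))
    powers : ∀ s i j → (+ 2 ℤ.* s ℤ.- + 1) ℤ.+ (+ 2 ℤ.* i ℤ.+ ℤ.- (+ 2) ℤ.* j)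
        ≡ + 2 ℤ.* (s ℤ.+ i ℤ.- j ℤ.- + 1) ℤ.+ + 1
    powers = solve-∀
    index : ∀ s i j n → ℤ.- (s ℤ.+ i ℤ.- j ℤ.- + 1) ℤ.- + 1 ≡
      + 1 ℤ.- s ℤ.+ (n ℤ.- (+ 1 ℤ.+ i)) ℤ.- (n ℤ.- (+ 1 ℤ.+ j)) ℤ.- + 1
    index = solve-∀
    entry : ∀ i j → N (s ℤ.+ + toℕ i ℤ.- + toℕ j ℤ.- + 1) t q ≈
      t ^ℤ (+ 2 ℤ.* s ℤ.- + 1) * (t ^ℤ (+ 2 ℤ.* + toℕ i) * M (opposite i) (opposite j) * t ^ℤ
          (ℤ.- (+ 2) ℤ.* + toℕ j))
    entry i j = begin
      N z t q ≈⟨ N-dual z t q ⟩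
      t ^ℤ (+ 2 ℤ.* z ℤ.+ + 1) * N (ℤ.- z ℤ.- + 1) t (q ⁻¹)
        ≈⟨ *-cong (sym (trans (*-congˡ (^ℤ-merge t ξ η ≡.refl))
            (^ℤ-merge t α (ξ ℤ.+ η) (powers s (+ toℕ i) (+ toℕ j)))))
             (reflexive (≡.cong (λ z → N z t (q ⁻¹)) (≡.trans (index s (+ toℕ i) (+ toℕ j) (+ n))
               (≡.cong₂ (λ i j → + 1 ℤ.- s ℤ.+ i ℤ.- j ℤ.- + 1) (≡.sym (opposite-toℕ i))
                   (≡.sym (opposite-toℕ j)))))) ⟩
      a * (x * y) * M (opposite i) (opposite j)
        ≈⟨ solve 4 (λ a x y m → a :* (x :* y) :* m := a :* (x :* m :* y)) refl a x y _ ⟩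
      a * (x * M (opposite i) (opposite j) * y) ∎
      where
      z α ξ η : ℤ
      z = s ℤ.+ + toℕ i ℤ.- + toℕ j ℤ.- + 1
      α = + 2 ℤ.* s ℤ.- + 1
      ξ = + 2 ℤ.* + toℕ i
      η = ℤ.- (+ 2) ℤ.* + toℕ j
      a x y : Carrier
      a = t ^ℤ α
      x = t ^ℤ ξ
      y = t ^ℤ η

-- The reduction step for q-Narayana polynomials.

module Reduction {c ℓ} (R : CommutativeRing c ℓ) where
  open CommutativeRing R hiding (zero)
  open Narayana R
  open Determinant R
  open PowerSeries R
  open PathSeries R
  open NarayanaSeries R
  open ToeplitzReduction R
  open UnitPowers R
  open NarayanaEntries R
  open RingProperties ring
  open SemiringExp commutativeSemiring using (^-homo-*; ^-distrib-*; ^-congˡ)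
  open SemiringSolver commutativeSemiring using (solve; _:+_; _:*_; _:=_; con)
  open SetoidReasoning setoid

  ∑-last : ∀ n f → ∑ (suc n) f ≈ ∑ n f + f n
  ∑-last zero    f = trans (∑-suc 0 f) (trans (+-comm _ _) (+-cong
    (trans (∑-zero-terms _) (sym (∑-zero-terms f))) refl))
  ∑-last (suc n) f = trans (∑-suc (suc n) f) (trans (+-congˡ (∑-last n (f ∘ suc)))
    (trans (sym (+-assoc _ _ _)) (+-congʳ (sym (∑-suc n f)))))

  module _ (t q : Unit) where
    private
      t̃ : Unit
      t̃ = twist t q
      u p : Carrier
      u = val t + val q
      p = val (q ⁻¹)
      f f̃ g g̃ : Series
      f = narayana (val t) (val q)
      f̃ = narayana (val t̃) (val q)
      g = narayana (val t) p
      g̃ = narayana (val t̃) p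
      F F⁺ F⁻ ψ : ℤ → Carrier
      F z = N z t q
      F⁺ (+ zero)  = 0#
      F⁺ (+ suc k) = N (+ suc k) t q
      F⁺ -[1+ k ]  = 0#
      F⁻ (+ zero)  = 1#
      F⁻ (+ suc k) = 0#
      F⁻ -[1+ k ]  = N -[1+ k ] t q
      -- The series w = q³ x f̃(q⁴x) of `narayana-positive` has the coefficient q^(4z-1) N_(z-1) at
      -- x^z for z ≥ 1; the same formula fits the side z ≤ 0, see `ψ-negative`.
      ψ z = q ^ℤ (+ 4 ℤ.* z ℤ.- + 1) * N (z ℤ.- + 1) t̃ q

      F≈ : ∀ z → F z ≈ F⁺ z + F⁻ z
      F≈ (+ zero)  = trans (Nℕ-zero t q) (sym (+-identityˡ 1#))
      F≈ (+ suc k) = sym (+-identityʳ _)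
      F≈ -[1+ k ]  = sym (+-identityˡ _)

      F-+ : ∀ k → F (+ k) ≈ f k
      F-+ k = Nℕ-narayana k t q

      F⁺-⊖ : ∀ {m i} → i ℕ.< m → F⁺ (m ⊖ i) ≈ f (m ℕ.∸ i)
      F⁺-⊖ {suc m} {zero}  _         = F-+ (suc m)
      F⁺-⊖ {suc m} {suc i} (s≤s i<m) = trans (reflexive (≡.cong F⁺ ([1+m]⊖[1+n]≡m⊖n m i))) (F⁺-⊖ i<m)

      q² q⁴ : Carrier
      q² = val q * val q
      q⁴ = q² * q²

      ŵ : Series
      ŵ = constant (q² * val q) ⊛ dilate q⁴ f̃

      ŵ-coefficient : ∀ k → ŵ k ≈ ψ (+ suc k)
      ŵ-coefficient k = begin
        ŵ k                            ≈⟨ constant-⊛ (q² * val q) (dilate q⁴ f̃) k ⟩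
        q² * val q * (q⁴ ^ k * f̃ k)    ≈⟨ sym (*-assoc _ _ _) ⟩
        q² * val q * q⁴ ^ k * f̃ k
          ≈⟨ *-cong (trans (*-cong q³≈ (trans (^-congˡ k q⁴≈) (^ℤ-* q (+ 4) k)))
              (^ℤ-merge q (+ 3) (+ 4 ℤ.* + k) (lemma (+ k))))
                    (sym (Nℕ-narayana k t̃ q)) ⟩
        ψ (+ suc k) ∎
        where
        q³≈ : q² * val q ≈ q ^ℤ + 3
        q³≈ = solve 1 (λ q → q :* q :* q := q :* (q :* (q :* con 1))) refl (val q)
        q⁴≈ : q⁴ ≈ q ^ℤ + 4
        q⁴≈ = solve 1 (λ q → q :* q :* (q :* q) := q :* (q :* (q :* (q :* con 1)))) refl (val q)
        lemma : ∀ k → + 3 ℤ.+ + 4 ℤ.* k ≡ + 4 ℤ.* (+ 1 ℤ.+ k) ℤ.- + 1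
        lemma = solve-∀

      t≈q²t̃ : val t ≈ q² * val t̃
      t≈q²t̃ = sym (trans (solve 3 (λ t q p → q :* q :* (t :* (p :* p)) := p :* q :* (p :* q) :* t)
          refl (val t) (val q) p)
        (trans (*-congʳ (trans (*-cong (val-⁻¹ q) (val-⁻¹ q)) (*-identityˡ 1#))) (*-identityˡ _)))

      -- The coefficient of x^(m+1) in `narayana-positive`. The last term of the convolution is ŵ m
      -- times f 0 = 1 and cancels the coefficient of w on the left, so m terms remain.
      positive : ∀ m → F (+ suc m) ≈ u * F (+ m) + ∑ m (λ i → F⁺ (m ⊖ i) * ψ (+ suc i))
      positive m = trans (F-+ (suc m)) (+-cancelʳ (ŵ m) _ _ (begin
        f (suc m) + ŵ m                                ≈⟨ +-congˡ (sym (var-⊛-suc ŵ m)) ⟩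
        (f ⊕ var ⊛ ŵ) (suc m)                          ≈⟨ narayana-positive t≈q²t̃ (suc m) ⟩
        0# + (constant u ⊛ (var ⊛ f)) (suc m) + (var ⊛ ŵ ⊛ f) (suc m)
          ≈⟨ +-cong (trans (+-identityˡ _)
              (trans (constant-⊛ u (var ⊛ f) (suc m)) (*-congˡ (var-⊛-suc f m))))
                    (trans (⊛-assoc var ŵ f (suc m)) (trans (var-⊛-suc (ŵ ⊛ f) m) (⊛-∑ ŵ f m))) ⟩
        u * f m + ∑ (suc m) (λ i → ŵ i * f (m ℕ.∸ i))
          ≈⟨ +-congˡ (trans (∑-last m _) (+-congˡ (trans (*-congˡ last≈1) (*-identityʳ _)))) ⟩
        u * f m + (∑ m (λ i → ŵ i * f (m ℕ.∸ i)) + ŵ m)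
          ≈⟨ sym (+-assoc _ _ _) ⟩
        u * f m + ∑ m (λ i → ŵ i * f (m ℕ.∸ i)) + ŵ m
          ≈⟨ +-congʳ (+-cong (*-congˡ (sym (F-+ m))) (∑-cong m λ i i<m →
               trans (*-comm _ _) (*-cong (sym (F⁺-⊖ i<m)) (ŵ-coefficient i)))) ⟩
        u * F (+ m) + ∑ m (λ i → F⁺ (m ⊖ i) * ψ (+ suc i)) + ŵ m ∎))
        where
        last≈1 : f (m ℕ.∸ m) ≈ 1#
        last≈1 = trans (reflexive (≡.cong f (ℕₚ.n∸n≡0 m))) (trans (sym (F-+ 0)) (Nℕ-zero t q))

      -- The generating function of t^(2m) N_(-m) for m ≥ 1, with constant term 1; it is the second
      -- factor in `narayana-negative`.
      e : Series
      e = constant 1# ⊕ constant (val t) ⊛ (var ⊛ g)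

      e-zero : e 0 ≈ 1#
      e-zero = trans (+-congˡ (trans (*-congˡ (zeroˡ _)) (zeroʳ _))) (+-identityʳ 1#)

      F-negative : ∀ m → F -[1+ m ] ≈ t ^ℤ (ℤ.- (+ 2) ℤ.* + m ℤ.- + 1) * g m
      F-negative m = *-cong (^ℤ-≡ t (lemma (+ m))) (Nℕ-narayana m t (q ⁻¹))
        where
        lemma : ∀ m → ℤ.- (+ 2) ℤ.* (+ 1 ℤ.+ m) ℤ.+ + 1 ≡ ℤ.- (+ 2) ℤ.* m ℤ.- + 1
        lemma = solve-∀

      F⁻-e : ∀ m → F⁻ (ℤ.- (+ m)) ≈ t ^ℤ (ℤ.- (+ 2) ℤ.* + m) * e m
      F⁻-e zero    = sym (trans (*-identityˡ _) e-zero)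
      F⁻-e (suc m) = begin
        F -[1+ m ] ≈⟨ F-negative m ⟩
        t ^ℤ (ℤ.- (+ 2) ℤ.* + m ℤ.- + 1) * g m
          ≈⟨ *-congʳ (sym (^ℤ-merge t (ℤ.- (+ 2) ℤ.* + suc m) (+ 1) (lemma (+ m)))) ⟩
        t ^ℤ (ℤ.- (+ 2) ℤ.* + suc m) * (val t * 1#) * g m
          ≈⟨ solve 3 (λ a t g → a :* (t :* con 1) :* g := a :* (con 0 :+ t :* g)) refl _ (val t) (g m) ⟩
        t ^ℤ (ℤ.- (+ 2) ℤ.* + suc m) * (0# + val t * g m)
          ≈⟨ *-congˡ (+-congˡ (sym (trans (constant-⊛ (val t) (var ⊛ g) (suc m))
              (*-congˡ (var-⊛-suc g m))))) ⟩
        t ^ℤ (ℤ.- (+ 2) ℤ.* + suc m) * e (suc m) ∎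
        where
        lemma : ∀ m → ℤ.- (+ 2) ℤ.* (+ 1 ℤ.+ m) ℤ.+ + 1 ≡ ℤ.- (+ 2) ℤ.* m ℤ.- + 1
        lemma = solve-∀

      F-e : ∀ m → F (ℤ.- (+ m)) ≈ t ^ℤ (ℤ.- (+ 2) ℤ.* + m) * e m
      F-e zero    = trans (Nℕ-zero t q) (F⁻-e zero)
      F-e (suc m) = F⁻-e (suc m)

      -- The power t̃^(-2j-1) in the definition of N carries q^(4j+2), which together with the
      -- factor q^(-4j-1) of ψ leaves q.
      ψ-negative : ∀ j → ψ (ℤ.- (+ j)) ≈ t ^ℤ (ℤ.- (+ 2) ℤ.* + j ℤ.- + 1) * (val q * g̃ j)
      ψ-negative j = begin
        q ^ℤ a * N (ℤ.- (+ j) ℤ.- + 1) t̃ q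
          ≡⟨ ≡.cong (λ z → q ^ℤ a * N z t̃ q) (index j) ⟩
        q ^ℤ a * (t̃ ^ℤ b * Nℕ j t̃ (q ⁻¹))
          ≈⟨ *-congˡ (*-cong (twist-^ℤ t q b) (Nℕ-narayana j t̃ (q ⁻¹))) ⟩
        q ^ℤ a * (t ^ℤ b * q ^ℤ (ℤ.- (+ 2) ℤ.* b) * g̃ j)
          ≈⟨ solve 4 (λ a b c g → a :* (b :* c :* g) := b :* (a :* c :* g)) refl _ _ _ _ ⟩
        t ^ℤ b * (q ^ℤ a * q ^ℤ (ℤ.- (+ 2) ℤ.* b) * g̃ j)
          ≈⟨ *-cong (^ℤ-≡ t (lemma (+ j)))
              (*-congʳ (trans (^ℤ-merge q a (ℤ.- (+ 2) ℤ.* b) (lemma′ (+ j))) (*-identityʳ _))) ⟩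
        t ^ℤ (ℤ.- (+ 2) ℤ.* + j ℤ.- + 1) * (val q * g̃ j) ∎
        where
        a b : ℤ
        a = + 4 ℤ.* (ℤ.- (+ j)) ℤ.- + 1
        b = ℤ.- (+ 2) ℤ.* + suc j ℤ.+ + 1
        index : ∀ k → ℤ.- (+ k) ℤ.- + 1 ≡ -[1+ k ]
        index zero    = ≡.refl
        index (suc k) = ≡.cong (-[1+_] ∘ suc) (ℕₚ.+-identityʳ k)
        lemma : ∀ m → ℤ.- (+ 2) ℤ.* (+ 1 ℤ.+ m) ℤ.+ + 1 ≡ ℤ.- (+ 2) ℤ.* m ℤ.- + 1
        lemma = solve-∀
        lemma′ : ∀ j → + 4 ℤ.* (ℤ.- j) ℤ.- + 1 ℤ.+ ℤ.- (+ 2) ℤ.* (ℤ.- (+ 2) ℤ.* (+ 1 ℤ.+ j) ℤ.+ + 1)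
            ≡ + 1
        lemma′ = solve-∀

      -- The coefficient of x^m in `narayana-negative` times τ = t^(-2m-1). The summand t of B
      -- yields the separate term F, the summand q g̃ the convolution with ψ.
      negative : ∀ m → F (ℤ.- (+ m)) + ∑ (suc m) (λ i → F⁻ (ℤ.- (+ i)) * ψ (i ⊖ m)) ≈ u * F -[1+ m ]
      negative m = begin
        F (ℤ.- (+ m)) + ∑ (suc m) (λ i → F⁻ (ℤ.- (+ i)) * ψ (i ⊖ m))
          ≈⟨ +-cong F-term (trans (∑-cong (suc m) λ i i≤m → ψ-term i (ℕₚ.≤-pred i≤m))
              (∑-*ˡ (suc m) τ _)) ⟩
        τ * (val t * e m) + τ * ∑ (suc m) (λ i → e i * (val q * g̃ (m ℕ.∸ i)))
          ≈⟨ sym (distribˡ τ _ _) ⟩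
        τ * (val t * e m + ∑ (suc m) (λ i → e i * (val q * g̃ (m ℕ.∸ i))))
          ≈⟨ *-congˡ (sym series) ⟩
        τ * (u * g m)       ≈⟨ solve 3 (λ t u g → t :* (u :* g) := u :* (t :* g)) refl τ u (g m) ⟩
        u * (τ * g m)       ≈⟨ *-congˡ (sym (F-negative m)) ⟩
        u * F -[1+ m ] ∎
        where
        τ : Carrier
        τ = t ^ℤ (ℤ.- (+ 2) ℤ.* + m ℤ.- + 1)
        F-term : F (ℤ.- (+ m)) ≈ τ * (val t * e m)
        F-term = trans (F-e m) (trans (*-congʳ (sym (trans (*-congˡ (sym (*-identityʳ _)))
          (^ℤ-merge t (ℤ.- (+ 2) ℤ.* + m ℤ.- + 1) (+ 1) (lemma (+ m)))))) (*-assoc _ _ _))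
          where
          lemma : ∀ m → ℤ.- (+ 2) ℤ.* m ℤ.- + 1 ℤ.+ + 1 ≡ ℤ.- (+ 2) ℤ.* m
          lemma = solve-∀
        ψ-term : ∀ i → i ℕ.≤ m → F⁻ (ℤ.- (+ i)) * ψ (i ⊖ m) ≈ τ * (e i * (val q * g̃ (m ℕ.∸ i)))
        ψ-term i i≤m = begin
          F⁻ (ℤ.- (+ i)) * ψ (i ⊖ m)
            ≈⟨ *-cong (F⁻-e i) (trans (reflexive (≡.cong ψ (ℤₚ.⊖-≤ i≤m))) (ψ-negative (m ℕ.∸ i))) ⟩
          t ^ℤ (ℤ.- (+ 2) ℤ.* + i) * e i * (t ^ℤ (ℤ.- (+ 2) ℤ.* + (m ℕ.∸ i) ℤ.- + 1)
              * (val q * g̃ (m ℕ.∸ i)))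
            ≈⟨ solve 4 (λ a e b x → a :* e :* (b :* x) := a :* b :* (e :* x)) refl _ _ _ _ ⟩
          t ^ℤ (ℤ.- (+ 2) ℤ.* + i) * t ^ℤ (ℤ.- (+ 2) ℤ.* + (m ℕ.∸ i) ℤ.- + 1)
              * (e i * (val q * g̃ (m ℕ.∸ i)))
            ≈⟨ *-congʳ (^ℤ-merge t (ℤ.- (+ 2) ℤ.* + i) (ℤ.- (+ 2) ℤ.* + (m ℕ.∸ i) ℤ.- + 1)
                 (≡.trans (lemma (+ i) (+ (m ℕ.∸ i)))
                     (≡.cong (λ k → ℤ.- (+ 2) ℤ.* + k ℤ.- + 1) (ℕₚ.m+[n∸m]≡n i≤m)))) ⟩
          τ * (e i * (val q * g̃ (m ℕ.∸ i))) ∎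
          where
          lemma : ∀ i j → ℤ.- (+ 2) ℤ.* i ℤ.+ (ℤ.- (+ 2) ℤ.* j ℤ.- + 1)
              ≡ ℤ.- (+ 2) ℤ.* (i ℤ.+ j) ℤ.- + 1
          lemma = solve-∀
        B : Series
        B = constant (val t) ⊕ constant (val q) ⊛ g̃
        series : u * g m ≈ val t * e m + ∑ (suc m) (λ i → e i * (val q * g̃ (m ℕ.∸ i)))
        series = begin
          u * g m ≈⟨ sym (constant-⊛ u g m) ⟩
          (constant u ⊛ g) m ≈⟨ narayana-negative (val-⁻¹ q) (*-comm (val t) (p * p)) m ⟩
          (B ⊛ e) m ≈⟨ ⊛-distribʳ e (constant (val t)) (constant (val q) ⊛ g̃) m ⟩
          (constant (val t) ⊛ e) m + (constant (val q) ⊛ g̃ ⊛ e) m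
            ≈⟨ +-cong (constant-⊛ (val t) e m) (trans (⊛-comm (constant (val q) ⊛ g̃) e m)
                 (trans (⊛-∑ e (constant (val q) ⊛ g̃) m)
                     (∑-cong (suc m) λ i _ → *-congˡ (constant-⊛ (val q) g̃ (m ℕ.∸ i))))) ⟩
          val t * e m + ∑ (suc m) (λ i → e i * (val q * g̃ (m ℕ.∸ i))) ∎

      ψ-det : ∀ m s → det m (λ i j → ψ ((s ℕ.+ toℕ i) ⊖ toℕ j))
          ≈ (q ^ℤ (+ 4 ℤ.* + s ℤ.- + 1)) ^ m * 𝒩 m (+ s) t̃ q
      ψ-det m s = trans (det-cong m entry)
          (det-conjugate m (q ^ℤ (+ 4 ℤ.* + s ℤ.- + 1)) (λ i → q ^ℤ (+ 4 ℤ.* + toℕ i))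
          (λ j → q ^ℤ (ℤ.- (+ 4) ℤ.* + toℕ j))
        (λ i j → N (+ s ℤ.+ + toℕ i ℤ.- + toℕ j ℤ.- + 1) t̃ q)
            (λ i → ^ℤ-merge q (+ 4 ℤ.* + toℕ i) (ℤ.- (+ 4) ℤ.* + toℕ i) (cancels (+ toℕ i))))
        where
        cancels : ∀ i → + 4 ℤ.* i ℤ.+ ℤ.- (+ 4) ℤ.* i ≡ + 0
        cancels = solve-∀
        powers : ∀ s i j → + 4 ℤ.* s ℤ.- + 1 ℤ.+ (+ 4 ℤ.* i ℤ.+ ℤ.- (+ 4) ℤ.* j)
            ≡ + 4 ℤ.* (s ℤ.+ i ℤ.- j) ℤ.- + 1
        powers = solve-∀
        entry : ∀ (i j : Fin m) → ψ ((s ℕ.+ toℕ i) ⊖ toℕ j) ≈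
          q ^ℤ (+ 4 ℤ.* + s ℤ.- + 1) * (q ^ℤ (+ 4 ℤ.* + toℕ i) * N
              (+ s ℤ.+ + toℕ i ℤ.- + toℕ j ℤ.- + 1) t̃ q * q ^ℤ (ℤ.- (+ 4) ℤ.* + toℕ j))
        entry i j = begin
          ψ ((s ℕ.+ toℕ i) ⊖ toℕ j) ≡⟨ ≡.cong ψ (≡.sym (m-n≡m⊖n (s ℕ.+ toℕ i) (toℕ j))) ⟩
          ψ (+ s ℤ.+ + toℕ i ℤ.- + toℕ j)
            ≈⟨ *-congʳ (sym (trans (*-congˡ (^ℤ-merge q ξ η ≡.refl))
                (^ℤ-merge q α (ξ ℤ.+ η) (powers (+ s) (+ toℕ i) (+ toℕ j))))) ⟩
          q ^ℤ α * (q ^ℤ ξ * q ^ℤ η) * N (+ s ℤ.+ + toℕ i ℤ.- + toℕ j ℤ.- + 1) t̃ q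
            ≈⟨ solve 4 (λ a x y m → a :* (x :* y) :* m := a :* (x :* m :* y)) refl _ _ _ _ ⟩
          q ^ℤ α * (q ^ℤ ξ * N (+ s ℤ.+ + toℕ i ℤ.- + toℕ j ℤ.- + 1) t̃ q * q ^ℤ η) ∎
          where
          α ξ η : ℤ
          α = + 4 ℤ.* + s ℤ.- + 1
          ξ = + 4 ℤ.* + toℕ i
          η = ℤ.- (+ 4) ℤ.* + toℕ j

      F-det : ∀ n s → 𝒩 n (+ suc s) t q ≈ det n (λ i j → F ((s ℕ.+ toℕ i) ⊖ toℕ j))
      F-det n s = det-cong n λ i j → reflexive (≡.cong F
        (≡.trans (lemma (+ s) (+ toℕ i) (+ toℕ j)) (m-n≡m⊖n (s ℕ.+ toℕ i) (toℕ j))))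
        where
        lemma : ∀ s i j → + 1 ℤ.+ s ℤ.+ i ℤ.- j ℤ.- + 1 ≡ s ℤ.+ i ℤ.- j
        lemma = solve-∀

      F₁≈u : F (+ 1) ≈ u
      F₁≈u = trans (positive 0) (trans
          (+-cong (trans (*-congˡ (Nℕ-zero t q)) (*-identityʳ u)) (∑-zero-terms _)) (+-identityʳ u))

      -- The last hypothesis is all that differs between the two cuts used in `𝒩-reduce`. The sign
      -- (-1)^p from the position of the pivot and (-1)^ρ from the entries -N_1 combine to (-1)^m.
      reduce : ∀ m s p ρ → p ℕ.+ ρ ≡ m → m ℕ.≤ s ℕ.+ p → s ℕ.+ p ℕ.≤ suc m →
        F ((s ℕ.+ p) ⊖ m) * u ^ ρ ≈ u ^ s →
        𝒩 (suc m) (+ suc s) t q ≈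
        (- 1#) ^ m * u ^ s * ((q ^ℤ (+ 4 ℤ.* + s ℤ.- + 1)) ^ m * 𝒩 m (+ s) t̃ q)
      reduce m s p ρ ≡.refl ≤d d≤ pivot = begin
        𝒩 (suc m) (+ suc s) t q ≈⟨ F-det (suc m) s ⟩
        det (suc m) (λ i j → F ((s ℕ.+ toℕ i) ⊖ toℕ j))
          ≈⟨ det-toeplitzReduction u F ψ F⁺ F⁻ F≈ refl (λ _ → refl) refl (λ _ → refl) positive
              negative s p ρ ≤d d≤ ⟩
        (- 1#) ^ p * (F ((s ℕ.+ p) ⊖ m) * (- F (+ 1)) ^ ρ) * det m (λ i j → ψ ((s ℕ.+ toℕ i) ⊖ toℕ j))
          ≈⟨ *-cong factor (ψ-det m s) ⟩
        (- 1#) ^ m * u ^ s * ((q ^ℤ (+ 4 ℤ.* + s ℤ.- + 1)) ^ m * 𝒩 m (+ s) t̃ q) ∎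
        where
        factor : (- 1#) ^ p * (F ((s ℕ.+ p) ⊖ m) * (- F (+ 1)) ^ ρ) ≈ (- 1#) ^ m * u ^ s
        factor = begin
          (- 1#) ^ p * (F ((s ℕ.+ p) ⊖ m) * (- F (+ 1)) ^ ρ)
            ≈⟨ *-congˡ (*-congˡ (trans (^-congˡ ρ (trans (-‿cong F₁≈u) (sym (-1*x≈-x u))))
                (^-distrib-* (- 1#) u ρ))) ⟩
          (- 1#) ^ p * (F ((s ℕ.+ p) ⊖ m) * ((- 1#) ^ ρ * u ^ ρ))
            ≈⟨ solve 4 (λ a b c d → a :* (b :* (c :* d)) := a :* c :* (b :* d)) refl
                 ((- 1#) ^ p) (F ((s ℕ.+ p) ⊖ m)) ((- 1#) ^ ρ) (u ^ ρ) ⟩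
          (- 1#) ^ p * (- 1#) ^ ρ * (F ((s ℕ.+ p) ⊖ m) * u ^ ρ)
            ≈⟨ *-cong (sym (^-homo-* (- 1#) p ρ)) pivot ⟩
          (- 1#) ^ m * u ^ s ∎

      F[1+m⊖m]≈u : ∀ m → F (suc m ⊖ m) ≈ u
      F[1+m⊖m]≈u m = trans (reflexive
          (≡.cong F (≡.trans (≡.cong (_⊖ m) (ℕₚ.+-comm 1 m)) ([m+n]⊖m m 1)))) F₁≈u

    -- For s ≤ m the cut is at p = m - s: the pivot is N_0 = 1 and the s diagonal entries give u^s.
    -- For s = m + 1 that p would be negative; with p = 0 only m diagonal entries are available, and
    -- the pivot N_1 = u supplies the missing factor.
    𝒩-reduce : ∀ m s → s ℕ.≤ suc m →
      𝒩 (suc m) (+ suc s) t q ≈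
      (- 1#) ^ m * (val t + val q) ^ s * ((q ^ℤ (+ 4 ℤ.* + s ℤ.- + 1)) ^ m * 𝒩 m (+ s) (twist t q) q)
    𝒩-reduce m s s≤1+m = Sum.[ interior , boundary ] (ℕₚ.m≤n⇒m<n∨m≡n s≤1+m)
      where
      boundary : s ≡ suc m → _
      boundary ≡.refl = reduce m (suc m) 0 m ≡.refl
        (ℕₚ.≤-trans (ℕₚ.n≤1+n m) (ℕₚ.m≤m+n (suc m) 0)) (ℕₚ.≤-reflexive (ℕₚ.+-identityʳ (suc m)))
        (*-congʳ (trans (reflexive (≡.cong (λ k → F (k ⊖ m)) (ℕₚ.+-identityʳ (suc m)))) (F[1+m⊖m]≈u m)))
      interior : s ℕ.< suc m → _
      interior (s≤s s≤m) = reduce m s (m ℕ.∸ s) s (ℕₚ.m∸n+n≡m s≤m)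
        (ℕₚ.≤-reflexive (≡.sym m≡)) (ℕₚ.m≤n⇒m≤1+n (ℕₚ.≤-reflexive m≡))
        (trans (*-congʳ (trans (reflexive (≡.cong F (≡.trans (≡.cong (_⊖ m) m≡) (ℤₚ.n⊖n≡0 m))))
            (Nℕ-zero t q))) (*-identityˡ _))
        where
        m≡ : s ℕ.+ (m ℕ.∸ s) ≡ m
        m≡ = ℕₚ.m+[n∸m]≡n s≤m

-- Triangular numbers and exact halves.

triangle : ℕ → ℕ
triangle zero    = 0
triangle (suc n) = n ℕ.+ triangle n

2*triangle : ∀ n → + 2 ℤ.* + triangle n ≡ + n ℤ.* + n ℤ.- + n
2*triangle zero    = ≡.refl
2*triangle (suc n) = ≡.trans (lemma₁ (+ n) (+ triangle n))
    (≡.trans (≡.cong (λ z → + 2 ℤ.* + n ℤ.+ z) (2*triangle n)) (lemma₂ (+ n)))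
  where
  lemma₁ : ∀ n t → + 2 ℤ.* (n ℤ.+ t) ≡ + 2 ℤ.* n ℤ.+ + 2 ℤ.* t
  lemma₁ = solve-∀
  lemma₂ : ∀ n → + 2 ℤ.* n ℤ.+ (n ℤ.* n ℤ.- n) ≡ (+ 1 ℤ.+ n) ℤ.* (+ 1 ℤ.+ n) ℤ.- (+ 1 ℤ.+ n)
  lemma₂ = solve-∀

triangle-+ : ∀ m n → triangle (m ℕ.+ n) ≡ triangle m ℕ.+ triangle n ℕ.+ m ℕ.* n
triangle-+ zero    n = ≡.sym (ℕₚ.+-identityʳ _)
triangle-+ (suc m) n = ≡.trans (≡.cong (m ℕ.+ n ℕ.+_) (triangle-+ m n))
  (solve 5 (λ m n a b c → m :+ n :+ (a :+ b :+ c) := m :+ a :+ b :+ (n :+ c)) ≡.refl m n (triangle m)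
      (triangle n) (m ℕ.* n))
  where
  open +-*-Solver

n[n∸1]/2≡triangle : ∀ n → n ℕ.* (n ℕ.∸ 1) / 2 ≡ triangle n
n[n∸1]/2≡triangle n = ≡.trans (≡.cong (_/ 2) (double n)) (m*n/n≡m (triangle n) 2)
  where
  double : ∀ n → n ℕ.* (n ℕ.∸ 1) ≡ triangle n ℕ.* 2
  double n = ℤₚ.+-injective (≡.trans (predecessor n) (≡.trans (≡.sym (2*triangle n))
    (≡.trans (ℤₚ.*-comm (+ 2) (+ triangle n)) (≡.sym (pos-* (triangle n) 2)))))
    where
    lemma : ∀ n → (+ 1 ℤ.+ n) ℤ.* n ≡ (+ 1 ℤ.+ n) ℤ.* (+ 1 ℤ.+ n) ℤ.- (+ 1 ℤ.+ n)
    lemma = solve-∀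
    predecessor : ∀ n → + (n ℕ.* (n ℕ.∸ 1)) ≡ + n ℤ.* + n ℤ.- + n
    predecessor zero    = ≡.refl
    predecessor (suc n) = ≡.trans (pos-* (suc n) n) (lemma (+ n))

i*2/2≡i : ∀ i → (i ℤ.* + 2) /ℕ 2 ≡ i
i*2/2≡i (+ k) = ≡.trans (≡.cong (_/ℕ 2) (≡.sym (pos-* k 2))) (≡.cong +_ (m*n/n≡m k 2))
-- For a negative dividend `_/ℕ_` branches on the remainder, which has to be exposed as 0 before the
-- quotient reduces.
i*2/2≡i -[1+ k ] with suc k ℕ.* 2 ℕ.% 2 | m*n%n≡0 (suc k) 2
... | .0 | ≡.refl = ≡.cong (λ n → ℤ.- (+ n)) (m*n/n≡m (suc k) 2)

/2-unique : ∀ {i j} → i ≡ j ℤ.* + 2 → i /ℕ 2 ≡ j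
/2-unique {j = j} e = ≡.trans (≡.cong (_/ℕ 2) e) (i*2/2≡i j)

-- Iteration of the reduction and the closed form.

module ClosedForm {c ℓ} (R : CommutativeRing c ℓ) where
  open CommutativeRing R hiding (zero)
  open Narayana R
  open UnitPowers R
  open NarayanaEntries R
  open Reduction R
  open SemiringExp commutativeSemiring using (^-homo-*; ^-distrib-*; ^-congˡ)
  open SemiringSolver commutativeSemiring using (solve; _:*_; _:=_; con)
  open MonoidSum *-commutativeMonoid using () renaming (sum-cong-≋ to product-cong)
  open SetoidReasoning setoid

  ∏-cong : ∀ n {f g : ℕ → Carrier} → (∀ k → k ℕ.≤ n → f k ≈ g k) → ∏ n f ≈ ∏ n g
  ∏-cong n e = product-cong {n} λ i → e (suc (toℕ i)) (toℕ<n i)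

  -- The exponents n, ..., 1 add up to `triangle (suc n)`.
  ∏-scale : ∀ n a (g : ℕ → Carrier) →
    ∏ n (λ k → (a * g k) ^ (suc n ℕ.∸ k)) ≈ a ^ triangle (suc n) * ∏ n (λ k → g k ^ (suc n ℕ.∸ k))
  ∏-scale zero    a g = sym (*-identityˡ 1#)
  ∏-scale (suc n) a g = begin
    (a * g 1) ^ suc n * ∏ n (λ k → (a * g (suc k)) ^ (suc n ℕ.∸ k))
      ≈⟨ *-cong (^-distrib-* a (g 1) (suc n)) (∏-scale n a (g ∘ suc)) ⟩
    a ^ suc n * g 1 ^ suc n * (a ^ triangle (suc n) * ∏ n (λ k → g (suc k) ^ (suc n ℕ.∸ k)))
      ≈⟨ solve 4 (λ a b c d → a :* b :* (c :* d) := a :* c :* (b :* d)) refl _ _ _ _ ⟩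
    a ^ suc n * a ^ triangle (suc n) * (g 1 ^ suc n * ∏ n (λ k → g (suc k) ^ (suc n ℕ.∸ k)))
      ≈⟨ *-congʳ (sym (^-homo-* a (suc n) (triangle (suc n)))) ⟩
    a ^ triangle (suc (suc n)) * ∏ (suc n) (λ k → g k ^ (suc (suc n) ℕ.∸ k)) ∎

  factors : ℕ → Unit → Unit → Carrier
  factors s t q = ∏[1≤ k ≤ s ] ((val t + q ^ℤ (+ 2 ℤ.* + k ℤ.- + 1)) ^ (suc s ℕ.∸ k))

  -- The claimed value for size n = s + p and index s + 1. In these coordinates (n-(s+1))(n-s)/2 is
  -- `triangle p`, so no division occurs; p is the size that remains when the index has come down to
  -- 1.
  closedForm : ℕ → ℕ → Unit → Unit → Carrier
  closedForm s p t q = (- 1#) ^ triangle (s ℕ.+ p) * t ^ℤ (ℤ.- (+ triangle p))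
    * q ^ℤ (+ triangle (s ℕ.+ p) ℤ.* (+ 2 ℤ.* + s ℤ.+ + 1)) * factors s t q

  -- As t + q^(2k+1) = q² (t q⁻² + q^(2k-1)), all factors but the first are, up to powers of q,
  -- those of the twisted parameter.
  factors-suc : ∀ s t q → factors (suc s) t q ≈
    (val t + val q) ^ suc s * (q ^ℤ (+ 2 ℤ.* + triangle (suc s)) * factors s (twist t q) q)
  factors-suc s t q = *-cong (^-congˡ (suc s) (+-congˡ (*-identityʳ (val q)))) (begin
    ∏ s (λ k → g k ^ (suc s ℕ.∸ k))
      ≈⟨ ∏-cong s (λ k _ → ^-congˡ (suc s ℕ.∸ k) (untwist k)) ⟩
    ∏ s (λ k → (q ^ℤ + 2 * (val (twist t q) + q ^ℤ (+ 2 ℤ.* + k ℤ.- + 1))) ^ (suc s ℕ.∸ k))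
      ≈⟨ ∏-scale s (q ^ℤ + 2) (λ k → val (twist t q) + q ^ℤ (+ 2 ℤ.* + k ℤ.- + 1)) ⟩
    (q ^ℤ + 2) ^ triangle (suc s) * factors s (twist t q) q
      ≈⟨ *-congʳ (^ℤ-* q (+ 2) (triangle (suc s))) ⟩
    q ^ℤ (+ 2 ℤ.* + triangle (suc s)) * factors s (twist t q) q ∎)
    where
    g : ℕ → Carrier
    g k = val t + q ^ℤ (+ 2 ℤ.* + suc k ℤ.- + 1)
    lemma : ∀ k → + 2 ℤ.+ (+ 2 ℤ.* k ℤ.- + 1) ≡ + 2 ℤ.* (+ 1 ℤ.+ k) ℤ.- + 1
    lemma = solve-∀
    untwist : ∀ k → g k ≈ q ^ℤ + 2 * (val (twist t q) + q ^ℤ (+ 2 ℤ.* + k ℤ.- + 1))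
    untwist k = sym (trans (distribˡ _ _ _) (+-cong
      (trans (solve 3 (λ q p t → q :* (q :* con 1) :* (t :* (p :* p)) := p :* q :* (p :* q) :* t)
          refl (val q) (val (q ⁻¹)) (val t))
        (trans (*-congʳ (trans (*-cong (val-⁻¹ q) (val-⁻¹ q)) (*-identityˡ 1#))) (*-identityˡ _)))
      (^ℤ-merge q (+ 2) (+ 2 ℤ.* + k ℤ.- + 1) (lemma (+ k)))))

  ^ℤ-merge₃ : ∀ u a b c {d} → a ℤ.+ (b ℤ.+ c) ≡ d → u ^ℤ a * (u ^ℤ b * u ^ℤ c) ≈ u ^ℤ d
  ^ℤ-merge₃ u a b c e = trans (*-congˡ (^ℤ-merge u b c ≡.refl)) (^ℤ-merge u a (b ℤ.+ c) e)

  -- For a positive s one reduction lowers s and keeps p. For s = 0 the reduction arrives at index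
  -- 0, and the duality returns to index 1 with q⁻¹ for q and p lowered by one.
  𝒩-closed : ∀ s p t q → 𝒩 (s ℕ.+ p) (+ suc s) t q ≈ closedForm s p t q
  𝒩-closed zero zero t q = solve 0 (con 1 := con 1 :* con 1 :* con 1 :* con 1) refl
  𝒩-closed zero (suc p) t q = begin
    𝒩 (suc p) (+ 1) t q ≈⟨ 𝒩-reduce t q p 0 z≤n ⟩
    ε p * 1# * ((q ^ℤ (+ 4 ℤ.* + 0 ℤ.- + 1)) ^ p * 𝒩 p (+ 0) t̃ q)
      ≈⟨ *-congˡ (*-cong (^ℤ-* q (+ 4 ℤ.* + 0 ℤ.- + 1) p) (trans (𝒩-dual p (+ 0) t̃ q)
           (*-cong (trans (^ℤ-* t̃ (+ 2 ℤ.* + 0 ℤ.- + 1) p) (twist-^ℤ t q -p))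
               (𝒩-closed zero p t̃ (q ⁻¹))))) ⟩
    ε p * 1# * (q ^ℤ -p * (t ^ℤ -p * q ^ℤ 2p * (ε τ * t̃ ^ℤ (ℤ.- (+ τ)) * (q ⁻¹) ^ℤ τ′ * 1#)))
      ≈⟨ *-congˡ (*-congˡ (*-congˡ (*-congʳ
          (*-cong (*-congˡ (twist-^ℤ t q (ℤ.- (+ τ)))) (^ℤ-⁻¹ q τ′))))) ⟩
    ε p * 1# * (q ^ℤ -p * (t ^ℤ -p * q ^ℤ 2p
        * (ε τ * (t ^ℤ (ℤ.- (+ τ)) * q ^ℤ 2τ) * q ^ℤ (ℤ.- τ′) * 1#)))
      ≈⟨ solve 8 (λ a b c d e f g h → a :* con 1 :* (b :* (c :* d :* (e :* (f :* g) :* h :* con 1)))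
           := a :* e :* (c :* f) :* (b :* (d :* (g :* h))) :* con 1) refl (ε p) _ _ _ _ _ _ _ ⟩
    ε p * ε τ * (t ^ℤ -p * t ^ℤ (ℤ.- (+ τ))) * (q ^ℤ -p * (q ^ℤ 2p * (q ^ℤ 2τ * q ^ℤ (ℤ.- τ′)))) * 1#
      ≈⟨ *-congʳ (*-cong (*-cong (sym (^-homo-* (- 1#) p τ))
          (^ℤ-merge t -p (ℤ.- (+ τ)) (t-lemma (+ p) (+ τ))))
           (trans (*-congˡ (^ℤ-merge₃ q 2p 2τ (ℤ.- τ′) ≡.refl))
               (^ℤ-merge q -p _ (q-lemma (+ p) (+ τ))))) ⟩
    closedForm zero (suc p) t q ∎
    where
    ε : ℕ → Carrier
    ε k = (- 1#) ^ k
    t̃ : Unit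
    t̃ = twist t q
    τ : ℕ
    τ = triangle p
    -p 2p 2τ τ′ : ℤ
    -p = -[1+ 0 ] ℤ.* + p
    2p = ℤ.- (+ 2) ℤ.* -p
    2τ = ℤ.- (+ 2) ℤ.* ℤ.- (+ τ)
    τ′ = + τ ℤ.* (+ 2 ℤ.* + 0 ℤ.+ + 1)
    t-lemma : ∀ p τ → -[1+ 0 ] ℤ.* p ℤ.+ ℤ.- τ ≡ ℤ.- (p ℤ.+ τ)
    t-lemma = solve-∀
    q-lemma : ∀ p τ → -[1+ 0 ] ℤ.* p
        ℤ.+ (ℤ.- (+ 2) ℤ.* (-[1+ 0 ] ℤ.* p)
        ℤ.+ (ℤ.- (+ 2) ℤ.* ℤ.- τ ℤ.+ ℤ.- (τ ℤ.* (+ 2 ℤ.* + 0 ℤ.+ + 1))))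
      ≡ (p ℤ.+ τ) ℤ.* (+ 2 ℤ.* + 0 ℤ.+ + 1)
    q-lemma = solve-∀
  𝒩-closed (suc s) p t q = begin
    𝒩 (suc m) (+ suc (suc s)) t q ≈⟨ 𝒩-reduce t q m (suc s) (s≤s (ℕₚ.m≤m+n s p)) ⟩
    ε m * v * ((q ^ℤ (+ 4 ℤ.* + suc s ℤ.- + 1)) ^ m * 𝒩 m (+ suc s) t̃ q)
      ≈⟨ *-congˡ (*-cong (^ℤ-* q (+ 4 ℤ.* + suc s ℤ.- + 1) m) (𝒩-closed s p t̃ q)) ⟩
    ε m * v * (q ^ℤ α * (ε τ * t̃ ^ℤ (ℤ.- (+ triangle p)) * q ^ℤ β * Π))
      ≈⟨ *-congˡ (*-congˡ (*-congʳ (*-congʳ (*-congˡ (twist-^ℤ t q (ℤ.- (+ triangle p))))))) ⟩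
    ε m * v * (q ^ℤ α * (ε τ * (t ^ℤ (ℤ.- (+ triangle p)) * q ^ℤ γ) * q ^ℤ β * Π))
      ≈⟨ solve 8 (λ a b c d e f g h → a :* b :* (c :* (d :* (e :* f) :* g :* h))
           := a :* d :* e :* (c :* (f :* g)) :* (b :* h)) refl (ε m) v _ _ _ _ _ Π ⟩
    ε m * ε τ * t ^ℤ (ℤ.- (+ triangle p)) * (q ^ℤ α * (q ^ℤ γ * q ^ℤ β)) * (v * Π)
      ≈⟨ *-congʳ (*-cong (*-congʳ (sym (^-homo-* (- 1#) m τ)))
           (trans (^ℤ-merge₃ q α γ β exponents) (^ℤ-+ q δ κ))) ⟩
    ε (m ℕ.+ τ) * t ^ℤ (ℤ.- (+ triangle p)) * (q ^ℤ δ * q ^ℤ κ) * (v * Π)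
      ≈⟨ solve 5 (λ a b c d e → a :* (b :* c) :* (d :* e) := a :* b :* (d :* (c :* e))) refl _
          (q ^ℤ δ) (q ^ℤ κ) v Π ⟩
    ε (m ℕ.+ τ) * t ^ℤ (ℤ.- (+ triangle p)) * q ^ℤ δ * (v * (q ^ℤ κ * Π))
      ≈⟨ *-congˡ (sym (factors-suc s t q)) ⟩
    closedForm (suc s) p t q ∎
    where
    ε : ℕ → Carrier
    ε k = (- 1#) ^ k
    t̃ : Unit
    t̃ = twist t q
    m τ : ℕ
    m = s ℕ.+ p
    τ = triangle m
    v Π : Carrier
    v = (val t + val q) ^ suc s
    Π = factors s t̃ q
    α β γ δ κ : ℤ
    α = (+ 4 ℤ.* + suc s ℤ.- + 1) ℤ.* + m
    β = + τ ℤ.* (+ 2 ℤ.* + s ℤ.+ + 1)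
    γ = ℤ.- (+ 2) ℤ.* ℤ.- (+ triangle p)
    δ = + triangle (suc m) ℤ.* (+ 2 ℤ.* + suc s ℤ.+ + 1)
    κ = + 2 ℤ.* + triangle (suc s)
    -- With the triangular numbers of s and p as free variables the two sides differ by 2(s² - s) -
    -- 4 `triangle s`; this term is carried along and then removed by `2*triangle`.
    exponents : α ℤ.+ (γ ℤ.+ β) ≡ δ ℤ.+ κ
    exponents = ≡.trans (≡.cong (λ τ → α ℤ.+ (γ ℤ.+ τ ℤ.* (+ 2 ℤ.* + s ℤ.+ + 1))) τ≡)
      (≡.trans (lemma₁ (+ s) (+ p) (+ triangle s) (+ triangle p))
        (≡.trans (≡.cong (λ z → z ℤ.+ (+ 2 ℤ.* (+ s ℤ.* + s ℤ.- + s) ℤ.- + 2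
            ℤ.* (+ 2 ℤ.* + triangle s)))
                    (≡.cong (λ τ → (+ m ℤ.+ τ) ℤ.* (+ 2 ℤ.* + suc s ℤ.+ + 1) ℤ.+ κ) (≡.sym τ≡)))
          (≡.trans (≡.cong (λ z → δ ℤ.+ κ ℤ.+ (+ 2 ℤ.* (+ s ℤ.* + s ℤ.- + s) ℤ.- + 2 ℤ.* z))
              (2*triangle s))
            (lemma₂ (δ ℤ.+ κ) (+ 2 ℤ.* (+ s ℤ.* + s ℤ.- + s))))))
      where
      τ≡ : + τ ≡ + triangle s ℤ.+ + triangle p ℤ.+ + s ℤ.* + p
      τ≡ = ≡.trans (≡.cong +_ (triangle-+ s p))
          (≡.cong (λ z → + (triangle s ℕ.+ triangle p) ℤ.+ z) (pos-* s p))
      lemma₁ : ∀ s p σ π →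
        (+ 4 ℤ.* (+ 1 ℤ.+ s) ℤ.- + 1) ℤ.* (s ℤ.+ p)
            ℤ.+ (ℤ.- (+ 2) ℤ.* ℤ.- π ℤ.+ (σ ℤ.+ π ℤ.+ s ℤ.* p) ℤ.* (+ 2 ℤ.* s ℤ.+ + 1)) ≡
        (s ℤ.+ p ℤ.+ (σ ℤ.+ π ℤ.+ s ℤ.* p)) ℤ.* (+ 2 ℤ.* (+ 1 ℤ.+ s) ℤ.+ + 1) ℤ.+ + 2 ℤ.* (s ℤ.+ σ)
        ℤ.+ (+ 2 ℤ.* (s ℤ.* s ℤ.- s) ℤ.- + 2 ℤ.* (+ 2 ℤ.* σ))
      lemma₁ = solve-∀
      lemma₂ : ∀ a b → a ℤ.+ (b ℤ.- b) ≡ a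
      lemma₂ = solve-∀

  𝒩-positive : ∀ s p {n} t q → s ℕ.+ p ≡ n → 𝒩 n (+ suc s) t q ≈ φ n (+ suc s) t q * factors s t q
  𝒩-positive s p {n} t q ≡.refl = trans (𝒩-closed s p t q) (*-congʳ (sym (*-cong
    (*-cong (reflexive (≡.cong ((- 1#) ^_) (n[n∸1]/2≡triangle n)))
        (^ℤ-≡ t (≡.cong ℤ.-_ (/2-unique {j = + triangle p} t-exponent))))
    (^ℤ-≡ q (/2-unique {j = + triangle n ℤ.* (+ 2 ℤ.* + s ℤ.+ + 1)} q-exponent)))))
    where
    t-exponent : (+ n ℤ.- + suc s) ℤ.* (+ n ℤ.- + suc s ℤ.+ + 1) ≡ + triangle p ℤ.* + 2
    t-exponent = ≡.trans (lemma (+ s) (+ p))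
        (≡.trans (≡.sym (2*triangle p)) (ℤₚ.*-comm (+ 2) (+ triangle p)))
      where
      lemma : ∀ s p → (s ℤ.+ p ℤ.- (+ 1 ℤ.+ s)) ℤ.* (s ℤ.+ p ℤ.- (+ 1 ℤ.+ s) ℤ.+ + 1) ≡ p ℤ.* p ℤ.- p
      lemma = solve-∀
    q-exponent : + n ℤ.* (+ n ℤ.- + 1) ℤ.* (+ 2 ℤ.* + suc s ℤ.- + 1)
        ≡ + triangle n ℤ.* (+ 2 ℤ.* + s ℤ.+ + 1) ℤ.* + 2
    q-exponent = ≡.trans (lemma₁ (+ n) (+ s))
      (≡.trans (≡.cong (ℤ._* (+ 2 ℤ.* + s ℤ.+ + 1)) (≡.sym (2*triangle n)))
          (lemma₂ (+ triangle n) (+ s)))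
      where
      lemma₁ : ∀ n s → n ℤ.* (n ℤ.- + 1) ℤ.* (+ 2 ℤ.* (+ 1 ℤ.+ s) ℤ.- + 1)
          ≡ (n ℤ.* n ℤ.- n) ℤ.* (+ 2 ℤ.* s ℤ.+ + 1)
      lemma₁ = solve-∀
      lemma₂ : ∀ τ s → + 2 ℤ.* τ ℤ.* (+ 2 ℤ.* s ℤ.+ + 1) ≡ τ ℤ.* (+ 2 ℤ.* s ℤ.+ + 1) ℤ.* + 2
      lemma₂ = solve-∀

  -- The duality sends the index -s to s + 1 and q to q⁻¹, where `𝒩-closed` applies; the factors t +
  -- q^(2k-1) thereby become t + q^(-2k+1).
  𝒩-negative : ∀ s p {n} t q → s ℕ.+ p ≡ n → 𝒩 n (ℤ.- (+ s)) t q ≈ φ n (ℤ.- (+ s)) t q *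
    (∏[1≤ k ≤ s ] ((val t + q ^ℤ (ℤ.- (+ 2) ℤ.* + k ℤ.+ + 1)) ^ (s ℕ.∸ k ℕ.+ 1)))
  𝒩-negative s p {n} t q ≡.refl = begin
    𝒩 n (ℤ.- (+ s)) t q ≈⟨ 𝒩-dual n (ℤ.- (+ s)) t q ⟩
    (t ^ℤ (+ 2 ℤ.* (ℤ.- (+ s)) ℤ.- + 1)) ^ n * 𝒩 n (+ 1 ℤ.- (ℤ.- (+ s))) t (q ⁻¹)
      ≈⟨ *-cong (^ℤ-* t (+ 2 ℤ.* (ℤ.- (+ s)) ℤ.- + 1) n)
           (trans (reflexive (≡.cong (λ z → 𝒩 n z t (q ⁻¹))
               (≡.cong (λ z → + 1 ℤ.+ z) (ℤₚ.neg-involutive (+ s)))))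
                  (𝒩-closed s p t (q ⁻¹))) ⟩
    t ^ℤ α * (ε * t ^ℤ β * (q ⁻¹) ^ℤ γ * factors s t (q ⁻¹))
      ≈⟨ solve 5 (λ a e b c f → a :* (e :* b :* c :* f) := e :* (a :* b) :* c :* f) refl (t ^ℤ α) ε
          (t ^ℤ β) ((q ⁻¹) ^ℤ γ) _ ⟩
    ε * (t ^ℤ α * t ^ℤ β) * (q ⁻¹) ^ℤ γ * factors s t (q ⁻¹)
      ≈⟨ *-cong (*-cong (*-cong (reflexive (≡.cong ((- 1#) ^_) (≡.sym (n[n∸1]/2≡triangle n))))
                          (trans (^ℤ-merge t α β (lemma₁ (+ s) (+ n) (+ triangle p)))
                                 (^ℤ-≡ t (≡.cong ℤ.-_ (≡.sym (/2-unique {j = ν} t-exponent))))))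
                   (trans (^ℤ-⁻¹ q γ) (^ℤ-≡ q (≡.sym (/2-unique {j = ℤ.- γ} q-exponent)))))
           (∏-cong s λ k k≤s → factor k k≤s) ⟩
    φ n (ℤ.- (+ s)) t q * (∏[1≤ k ≤ s ]
        ((val t + q ^ℤ (ℤ.- (+ 2) ℤ.* + k ℤ.+ + 1)) ^ (s ℕ.∸ k ℕ.+ 1))) ∎
    where
    ε : Carrier
    ε = (- 1#) ^ triangle n
    α β γ ν : ℤ
    α = (+ 2 ℤ.* (ℤ.- (+ s)) ℤ.- + 1) ℤ.* + n
    β = ℤ.- (+ triangle p)
    γ = + triangle n ℤ.* (+ 2 ℤ.* + s ℤ.+ + 1)
    -- The value of (n+s)(n+s+1)/2 for n = s + p, in the form in which the exponents of the duality
    -- and of the closed form add up.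
    ν = + triangle p ℤ.+ (+ 2 ℤ.* + s ℤ.+ + 1) ℤ.* + n
    lemma₁ : ∀ s n τ → (+ 2 ℤ.* (ℤ.- s) ℤ.- + 1) ℤ.* n ℤ.+ ℤ.- τ ≡ ℤ.- (τ ℤ.+ (+ 2 ℤ.* s ℤ.+ + 1) ℤ.* n)
    lemma₁ = solve-∀
    t-exponent : (+ n ℤ.- ℤ.- (+ s)) ℤ.* (+ n ℤ.- ℤ.- (+ s) ℤ.+ + 1) ≡ ν ℤ.* + 2
    t-exponent = ≡.trans (lemma (+ s) (+ p))
      (≡.trans (≡.cong (λ z → z ℤ.+ + 2 ℤ.* ((+ 2 ℤ.* + s ℤ.+ + 1) ℤ.* (+ s ℤ.+ + p)))
          (≡.sym (2*triangle p)))
        (lemma′ (+ triangle p) ((+ 2 ℤ.* + s ℤ.+ + 1) ℤ.* (+ s ℤ.+ + p))))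
      where
      lemma : ∀ s p → (s ℤ.+ p ℤ.- ℤ.- s) ℤ.* (s ℤ.+ p ℤ.- ℤ.- s ℤ.+ + 1) ≡
        (p ℤ.* p ℤ.- p) ℤ.+ + 2 ℤ.* ((+ 2 ℤ.* s ℤ.+ + 1) ℤ.* (s ℤ.+ p))
      lemma = solve-∀
      lemma′ : ∀ τ a → + 2 ℤ.* τ ℤ.+ + 2 ℤ.* a ≡ (τ ℤ.+ a) ℤ.* + 2
      lemma′ = solve-∀
    q-exponent : + n ℤ.* (+ n ℤ.- + 1) ℤ.* (+ 2 ℤ.* (ℤ.- (+ s)) ℤ.- + 1) ≡ ℤ.- γ ℤ.* + 2
    q-exponent = ≡.trans (lemma (+ n) (+ s))
      (≡.trans (≡.cong (λ z → ℤ.- (z ℤ.* (+ 2 ℤ.* + s ℤ.+ + 1))) (≡.sym (2*triangle n)))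
          (lemma′ (+ triangle n) (+ s)))
      where
      lemma : ∀ n s → n ℤ.* (n ℤ.- + 1) ℤ.* (+ 2 ℤ.* (ℤ.- s) ℤ.- + 1)
          ≡ ℤ.- ((n ℤ.* n ℤ.- n) ℤ.* (+ 2 ℤ.* s ℤ.+ + 1))
      lemma = solve-∀
      lemma′ : ∀ τ s → ℤ.- (+ 2 ℤ.* τ ℤ.* (+ 2 ℤ.* s ℤ.+ + 1)) ≡ ℤ.- (τ ℤ.* (+ 2 ℤ.* s ℤ.+ + 1)) ℤ.* + 2
      lemma′ = solve-∀
    factor : ∀ k → k ℕ.≤ s → (val t + (q ⁻¹) ^ℤ (+ 2 ℤ.* + k ℤ.- + 1)) ^ (suc s ℕ.∸ k) ≈
      (val t + q ^ℤ (ℤ.- (+ 2) ℤ.* + k ℤ.+ + 1)) ^ (s ℕ.∸ k ℕ.+ 1)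
    factor k k≤s = trans
      (^-congˡ (suc s ℕ.∸ k) (+-congˡ (trans (^ℤ-⁻¹ q (+ 2 ℤ.* + k ℤ.- + 1)) (^ℤ-≡ q (lemma (+ k))))))
      (reflexive (≡.cong ((val t + q ^ℤ (ℤ.- (+ 2) ℤ.* + k ℤ.+ + 1)) ^_)
        (≡.trans (ℕₚ.+-∸-assoc 1 k≤s) (ℕₚ.+-comm 1 (s ℕ.∸ k)))))
      where
      lemma : ∀ k → ℤ.- (+ 2 ℤ.* k ℤ.- + 1) ≡ ℤ.- (+ 2) ℤ.* k ℤ.+ + 1
      lemma = solve-∀

theorem9 : ∀ {c ℓ} (R : CommutativeRing c ℓ) →
    let open CommutativeRing R
        open Narayana R
    in (t q : Unit) (n : ℕ) (s : ℤ) →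
       ℤ.- (+ n) ℤ.≤ s → s ℤ.≤ + n ℤ.+ + 1 →
       (+ 1 ℤ.≤ s →
          𝒩 n s t q ≈ φ n s t q *
            (∏[1≤ k ≤ ∣ s ∣ ℕ.∸ 1 ] ((val t + q ^ℤ (+ 2 ℤ.* + k ℤ.- + 1)) ^ (∣ s ∣ ℕ.∸ k))))
       ×
       (s ℤ.≤ + 0 →
          𝒩 n s t q ≈ φ n s t q *
            (∏[1≤ k ≤ ∣ s ∣ ] ((val t + q ^ℤ (ℤ.- (+ 2) ℤ.* + k ℤ.+ + 1)) ^ (∣ s ∣ ℕ.∸ k ℕ.+ 1))))
theorem9 R t q n (+ zero) _ _ =
  (λ { (ℤ.+≤+ ()) }) ,
  (λ _ → 𝒩-negative 0 n t q ≡.refl)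
  where open ClosedForm R
theorem9 R t q n (+ suc s) _ (ℤ.+≤+ 1+s≤n+1) =
  (λ _ → 𝒩-positive s (n ℕ.∸ s) t q
           (ℕₚ.m+[n∸m]≡n (ℕₚ.≤-pred (≡.subst (suc s ℕ.≤_) (ℕₚ.+-comm n 1) 1+s≤n+1)))) ,
  (λ { (ℤ.+≤+ ()) })
  where open ClosedForm R
theorem9 R t q n -[1+ s ] -n≤s _ =
  (λ ()) ,
  (λ _ → 𝒩-negative (suc s) (n ℕ.∸ suc s) t q
      (ℕₚ.m+[n∸m]≡n (ℤₚ.drop‿+≤+ (ℤₚ.neg-cancel-≤ {+ n} {+ suc s} -n≤s))))
  where open ClosedForm R
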